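{- Let $A$ and $B$ be $F$-multiplicity-free skew shapes of size $n$. Then $s_A = s_B$ if and only if $B \in \{A, A^\circ\}$. Otherwise (i.e. if $B\notin\{A,A^\circ\}$), $s_A - s_B$ is $F$-positive (equivalently, $\mathrm{supp}_F(A) \supseteq \mathrm{supp}_F(B)$) if and only if one of the following conditions holds up to antipodal rotation of $A$ and/or $B$ (i.e. after possibly replacing $A$ by $A^\circ$ and/or $B$ by $B^\circ$): (a) $A = (1^\ell) \oplus (n-\ell)$ and $B \in \{(n-\ell, 1^\ell),\ (n-\ell+1, 1^{\ell-1})\}$ for some $1 \leq \ell \leq n-1$; (b) $A = (1^2) \oplus (n-2)$ and $B = (n-2, 2)$ with $n\geq 4$; (c) $A= (1^{n-2}) \oplus (2)$ and $B = (2,2, 1^{n-4})$ with $n\geq 4$.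
   Context: A composition of $n$ is a sequence of positive integers with sum $n$; a partition is a weakly decreasing composition. Compositions $\alpha=(\alpha_1,\dots,\alpha_k)$ of $n$ correspond bijectively to subsets of $[n-1]=\{1,\dots,n-1\}$ via $S(\alpha)=\{\alpha_1,\alpha_1+\alpha_2,\dots,\alpha_1+\cdots+\alpha_{k-1}\}$. Young diagrams are left-justified with row $1$ at the top; a skew shape $\lambda/\mu$ is the Young diagram of $\lambda$ with the boxes of $\mu\subseteq\lambda$ removed from its top-left. A partition $\lambda$ is identified with the skew shape $\lambda/\emptyset$. The size of a skew shape is its number of boxes. Skew shapes are identified when they differ only by empty rows or empty columns (in particular, by translation). A standard Young tableau (SYT) of a skew shape $A$ with $n$ boxes is a filling of the boxes by $1,\dots,n$, each used once, increasing left to right along rows and down columns. Its descent set is the set of $i$ such that $i+1$ appears in a strictly lower row than $i$, and its descent composition is the composition of $n$ corresponding to its descent set. The monomial quasisymmetric functions are $M_\alpha=\sum_{i_1<\cdots<i_k}x_{i_1}^{\alpha_1}\cdots x_{i_k}^{\alpha_k}$, and the fundamental quasisymmetric functions are $F_\alpha=\sum_{S(\alpha)\subseteq S(\beta)\subseteq[n-1]}M_\beta$ for $\alpha$ of size $n$; they form a basis of the quasisymmetric functions. The skew Schur function is $s_A=\sum_T F_{\mathrm{comp}(T)}$, the sum being over all SYT $T$ of shape $A$, where $\mathrm{comp}(T)$ is the descent composition of $T$. The $F$-support $\mathrm{supp}_F(A)$ is the set of compositions $\alpha$ such that $F_\alpha$ has positive coefficient in $s_A$. A quasisymmetric function is $F$-positive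 if all its coefficients in the $F$-basis are nonnegative. A skew shape $A$ is $F$-multiplicity-free if all coefficients in the $F$-expansion of $s_A$ are $0$ or $1$ (equivalently, all SYT of shape $A$ have distinct descent sets). $A^\circ$ denotes the antipodal rotation of $A$, i.e. $A$ rotated by $180^\circ$. $1^\ell$ denotes a sequence of $\ell$ copies of $1$. $A\oplus B$ denotes the skew shape obtained by placing $A$ immediately below and to the left of $B$ so that $A$ and $B$ have no rows or columns in common; e.g. $(1^2)\oplus(2)=311/1$. -}

module Defs where

open import Data.Fin.Base as Fin using (Fin; toℕ)
import Data.Fin.Properties as Fin
open import Data.Integer.Base as ℤ using (ℤ; 0ℤ; 1ℤ)
open import Data.List.Base as List
  using (List; []; _∷_; map; concatMap; filter; foldr; applyUpTo; upTo; allFin;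
         takeWhile; length; lookup; replicate)
open import Data.List.Relation.Unary.All using (All)
open import Data.List.Relation.Unary.All.Properties using (all-takeWhile)
open import Data.List.Relation.Unary.Linked using (Linked; []; [-]; _∷_)
open import Data.List.Relation.Unary.Linked.Properties using (applyUpTo⁺₂)
import Data.List.Properties as List
open import Data.List.Membership.DecPropositional using (_∈?_)
open import Data.Nat.Base
open import Data.Nat.ListAction using (sum)
open import Data.Nat.Properties
open import Data.List.Relation.Binary.Subset.DecPropositional _≟_ using (_⊆?_)
open import Data.Product.Base using (Σ-syntax; ∃-syntax; _×_; _,_; proj₁; proj₂)
open import Data.Sum.Base using (_⊎_)
open import Data.Vec.Base as Vec using (Vec)
open import Relation.Binary.PropositionalEquality using (_≡_)
open import Relation.Nullary.Decidable using (Dec; yes; no; _×-dec_; _→-dec_)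
open import Relation.Nullary.Negation using (contradiction)
open import Relation.Unary using (Pred)
open import Level using (0ℓ)

------------------------------------------------------------------------
-- Compositions

_⊨_ : List ℕ → ℕ → Set
α ⊨ n = All (0 <_) α × sum α ≡ n

-- Every composition of n, once each: a composition of n + 1 either starts
-- with a 1 or arises by adding 1 to the first part of a composition of n.
compositions : ℕ → List (List ℕ)
compositions zero    = [] ∷ []
compositions (suc n) = concatMap extend (compositions n)
  where
  extend : List ℕ → List (List ℕ)
  extend []      = (1 ∷ []) ∷ []
  extend (a ∷ α) = (1 ∷ a ∷ α) ∷ (suc a ∷ α) ∷ []

S : List ℕ → List ℕ
S []          = []
S (_ ∷ [])    = []
S (a ∷ b ∷ α) = a ∷ map (a +_) (S (b ∷ α))

-- The inverse of S: the subset {d₁ < … < dₖ} of [n-1], listed increasingly,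
-- goes to (d₁, d₂ - d₁, …, dₖ - dₖ₋₁, n - dₖ).
compositionOf : ℕ → List ℕ → List ℕ
compositionOf zero      _  = []
compositionOf n@(suc _) ds = differences 0 ds
  where
  differences : ℕ → List ℕ → List ℕ
  differences p []       = n ∸ p ∷ []
  differences p (d ∷ ds) = d ∸ p ∷ differences d ds

------------------------------------------------------------------------
-- Partitions

record Partition : Set where
  constructor mkPartition
  field
    parts      : List ℕ
    decreasing : Linked _≥_ parts
    positive   : All (0 <_) parts

open Partition public

nth : List ℕ → ℕ → ℕ
nth []       _       = 0
nth (x ∷ _)  zero    = x
nth (_ ∷ xs) (suc i) = nth xs i

-- Rows are numbered from 0, and missing parts are 0.
part : Partition → ℕ → ℕ
part p = nth (parts p)

nth-decreasing : ∀ {xs} → Linked _≥_ xs → ∀ i → nth xs i ≥ nth xs (suc i)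
nth-decreasing []       _       = z≤n
nth-decreasing [-]      _       = z≤n
nth-decreasing (r ∷ _)  zero    = r
nth-decreasing (_ ∷ rs) (suc i) = nth-decreasing rs i

part-decreasing : ∀ p i → part p i ≥ part p (suc i)
part-decreasing p = nth-decreasing (decreasing p)

part-antitone : ∀ p {i j} → i ≤ j → part p i ≥ part p j
part-antitone p i≤j = go (≤⇒≤′ i≤j)
  where
  go : ∀ {i j} → i ≤′ j → part p i ≥ part p j
  go ≤′-refl         = ≤-refl
  go (≤′-step {n} q) = ≤-trans (part-decreasing p n) (go q)

takeWhile-linked : ∀ {xs} → Linked _≥_ xs → Linked _≥_ (takeWhile (0 <?_) xs)
takeWhile-linked []                    = []
takeWhile-linked {zero  ∷ []} [-]      = []
takeWhile-linked {suc _ ∷ []} [-]      = [-]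
takeWhile-linked {zero  ∷ _}  (_ ∷ _)  = []
takeWhile-linked {suc _ ∷ zero  ∷ _} (_ ∷ _)  = [-]
takeWhile-linked {suc _ ∷ suc _ ∷ _} (r ∷ rs) = r ∷ takeWhile-linked rs

-- The partition with parts f 0, …, f (k - 1), trailing zeros dropped.
fromRows : (f : ℕ → ℕ) (k : ℕ) → (∀ i → f i ≥ f (suc i)) → Partition
fromRows f k f↓ = mkPartition
  (takeWhile (0 <?_) (applyUpTo f k))
  (takeWhile-linked (applyUpTo⁺₂ f k f↓))
  (all-takeWhile (0 <?_) (applyUpTo f k))

fromRows-mono : ∀ f g k f↓ g↓ → (∀ i → f i ≤ g i) →
                ∀ i → part (fromRows f k f↓) i ≤ part (fromRows g k g↓) i
fromRows-mono f g k _ _ = go f g k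
  where
  go : ∀ f g k → (∀ i → f i ≤ g i) → ∀ i →
       nth (takeWhile (0 <?_) (applyUpTo f k)) i ≤ nth (takeWhile (0 <?_) (applyUpTo g k)) i
  go f g zero    f≤g i = z≤n
  go f g (suc k) f≤g i with f 0 | g 0 | f≤g 0
  go f g (suc k) f≤g i       | zero  | _     | _ = z≤n
  go f g (suc k) f≤g zero    | suc _ | suc _ | r = r
  go f g (suc k) f≤g (suc i) | suc _ | suc _ | _ =
    go (λ j → f (suc j)) (λ j → g (suc j)) k (λ j → f≤g (suc j)) i

------------------------------------------------------------------------
-- Skew shapes

record SkewShape : Set where
  constructor mkSkew
  field
    outer       : Partition
    inner       : Partition
    inner⊆outer : ∀ i → part inner i ≤ part outer i

open SkewShape public

straight : Partition → SkewShape
straight p = mkSkew p (mkPartition [] [] All.[]) (λ _ → z≤n)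

height : SkewShape → ℕ
height A = length (parts (outer A))

width : SkewShape → ℕ
width A = part (outer A) 0

-- A box is a pair (row , column), both counted from 0, row 0 at the top.
Box : Set
Box = ℕ × ℕ

row col : Box → ℕ
row = proj₁
col = proj₂

-- The boxes in reading order: rows from the top, each from left to right.
boxes : SkewShape → List Box
boxes A = concatMap boxesInRow (upTo (height A))
  where
  boxesInRow : ℕ → List Box
  boxesInRow i = applyUpTo (λ j → i , part (inner A) i + j) (part (outer A) i ∸ part (inner A) i)

size : SkewShape → ℕ
size A = length (boxes A)

-- Deletes the empty rows and columns: each coordinate is replaced by the
-- number of smaller coordinates that actually occur.
compress : List Box → List Box
compress bs = map (λ b → rank (map row bs) (row b) , rank (map col bs) (col b)) bs
  where
  rank : List ℕ → ℕ → ℕ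
  rank occupied i = length (filter (λ j → _∈?_ _≟_ j occupied) (upTo i))

-- Equality of skew shapes.  Both sides are in reading order, so equality of
-- the lists is equality of the sets of boxes.
infix 4 _≋_
_≋_ : SkewShape → SkewShape → Set
A ≋ B = compress (boxes A) ≡ compress (boxes B)

-- Antipodal rotation, inside the rectangle height A × width A.
infix 8 _°
_° : SkewShape → SkewShape
A ° = mkSkew
  (fromRows (rotated (inner A)) (height A) (rotated↓ (inner A)))
  (fromRows (rotated (outer A)) (height A) (rotated↓ (outer A)))
  (fromRows-mono (rotated (outer A)) (rotated (inner A)) (height A) (rotated↓ (outer A)) (rotated↓ (inner A))
     (λ i → ∸-monoʳ-≤ (width A) (inner⊆outer A (height A ∸ suc i))))
  where
  rotated : Partition → ℕ → ℕ
  rotated p i = width A ∸ part p (height A ∸ suc i)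

  rotated↓ : ∀ p i → rotated p i ≥ rotated p (suc i)
  rotated↓ p i = ∸-monoʳ-≤ (width A) (part-antitone p (∸-monoʳ-≤ (height A) (n≤1+n (suc i))))

-- The rows of B, moved right past all columns of A, followed by the rows of A.
infixr 6 _⊕_
_⊕_ : SkewShape → SkewShape → SkewShape
A ⊕ B = mkSkew
  (fromRows (stacked (outer A) (outer B)) k (stacked↓ (outer A) (outer B) (λ _ → ≤-refl)))
  (fromRows (stacked (inner A) (inner B)) k (stacked↓ (inner A) (inner B) (inner⊆outer A)))
  (fromRows-mono (stacked (inner A) (inner B)) (stacked (outer A) (outer B)) k
     (stacked↓ (inner A) (inner B) (inner⊆outer A)) (stacked↓ (outer A) (outer B) (λ _ → ≤-refl)) stacked-mono)
  where
  k : ℕ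
  k = height B + height A

  stacked : Partition → Partition → ℕ → ℕ
  stacked p q i with i <? height B
  ... | yes _ = width A + part q i
  ... | no  _ = part p (i ∸ height B)

  stacked↓ : ∀ p q → (∀ j → part p j ≤ part (outer A) j) →
             ∀ i → stacked p q i ≥ stacked p q (suc i)
  stacked↓ p q p≤ i with i <? height B | suc i <? height B
  ... | yes _   | yes _   = +-monoʳ-≤ (width A) (part-decreasing q i)
  ... | yes _   | no  _   = ≤-trans (≤-trans (p≤ _) (part-antitone (outer A) z≤n)) (m≤m+n (width A) _)
  ... | no  i≮h | yes i<h = contradiction (<⇒≤ i<h) i≮h
  ... | no  _   | no  _   = part-antitone p (∸-monoˡ-≤ (height B) (n≤1+n i))

  stacked-mono : ∀ i → stacked (inner A) (inner B) i ≤ stacked (outer A) (outer B) i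
  stacked-mono i with i <? height B
  ... | yes _ = +-monoʳ-≤ (width A) (inner⊆outer B i)
  ... | no  _ = inner⊆outer A (i ∸ height B)

------------------------------------------------------------------------
-- Standard Young tableaux

-- Box number p (in reading order) is filled with the entry 1 + toℕ (T p).
Filling : SkewShape → Set
Filling A = Vec (Fin (size A)) (size A)

module _ (A : SkewShape) where

  private
    boxAt : Fin (size A) → Box
    boxAt = lookup (boxes A)

  -- As there are as many boxes as possible entries, injectivity says that each
  -- entry is used exactly once.
  IsSYT : Filling A → Set
  IsSYT T =
    (∀ p q → Vec.lookup T p ≡ Vec.lookup T q → p ≡ q) ×
    (∀ p q → row (boxAt p) ≡ row (boxAt q) → col (boxAt p) < col (boxAt q) →
             Vec.lookup T p Fin.< Vec.lookup T q) ×
    (∀ p q → col (boxAt p) ≡ col (boxAt q) → row (boxAt p) < row (boxAt q) →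
             Vec.lookup T p Fin.< Vec.lookup T q)

  isSYT? : ∀ T → Dec (IsSYT T)
  isSYT? T =
    (Fin.all? λ p → Fin.all? λ q → (Vec.lookup T p Fin.≟ Vec.lookup T q) →-dec (p Fin.≟ q)) ×-dec
    (Fin.all? λ p → Fin.all? λ q → (row (boxAt p) ≟ row (boxAt q)) →-dec
      ((col (boxAt p) <? col (boxAt q)) →-dec (Vec.lookup T p Fin.<? Vec.lookup T q))) ×-dec
    (Fin.all? λ p → Fin.all? λ q → (col (boxAt p) ≟ col (boxAt q)) →-dec
      ((row (boxAt p) <? row (boxAt q)) →-dec (Vec.lookup T p Fin.<? Vec.lookup T q)))

  IsDescent : Filling A → ℕ → Set
  IsDescent T i = ∃[ p ] ∃[ q ]
    suc (toℕ (Vec.lookup T p)) ≡ i × suc (toℕ (Vec.lookup T q)) ≡ suc i ×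
    row (boxAt p) < row (boxAt q)

  isDescent? : ∀ T i → Dec (IsDescent T i)
  isDescent? T i = Fin.any? λ p → Fin.any? λ q →
    (suc (toℕ (Vec.lookup T p)) ≟ i) ×-dec (suc (toℕ (Vec.lookup T q)) ≟ suc i) ×-dec
    (row (boxAt p) <? row (boxAt q))

  descents : Filling A → List ℕ
  descents T = filter (isDescent? T) (applyUpTo suc (size A ∸ 1))

  comp : Filling A → List ℕ
  comp T = compositionOf (size A) (descents T)

vectors : ∀ {X : Set} → List X → (m : ℕ) → List (Vec X m)
vectors xs zero    = Vec.[] ∷ []
vectors xs (suc m) = concatMap (λ x → map (x Vec.∷_) (vectors xs m)) xs

SYTs : (A : SkewShape) → List (Filling A)
SYTs A = filter (isSYT? A) (vectors (allFin (size A)) (size A))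

------------------------------------------------------------------------
-- Quasisymmetric functions, as formal power series over ℤ in x₁, x₂, …

-- A series is given by its coefficients; the list (e₁ , … , eᵣ) stands for
-- the monomial x₁^e₁ ⋯ xᵣ^eᵣ.
Series : Set
Series = List ℕ → ℤ

infix 4 _≐_
_≐_ : Series → Series → Set
f ≐ g = ∀ e → f e ≡ g e

infixl 6 _⊖_
_⊖_ : Series → Series → Series
(f ⊖ g) e = f e ℤ.- g e

infixr 7 _·_
_·_ : ℤ → Series → Series
(c · f) e = c ℤ.* f e

∑ : List Series → Series
∑ fs e = foldr (λ f s → f e ℤ.+ s) 0ℤ fs

-- A monomial occurs in M α, with coefficient 1 (the indices i₁ < … < iₖ are
-- determined by it), exactly when its nonzero exponents read in order are α.
M : List ℕ → Series
M α e with List.≡-dec _≟_ (filter (0 <?_) e) α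
... | yes _ = 1ℤ
... | no  _ = 0ℤ

F : List ℕ → Series
F α = ∑ (map M (filter (λ β → S α ⊆? S β) (compositions (sum α))))

s : SkewShape → Series
s A = ∑ (map (λ T → F (comp A T)) (SYTs A))

-- c gives the coefficients of f, homogeneous of degree n, in the F-basis;
-- only the values of c at compositions of n matter.
FExpansion : ℕ → Series → (List ℕ → ℤ) → Set
FExpansion n f c = f ≐ ∑ (map (λ α → c α · F α) (compositions n))

FPositive : ℕ → Series → Set
FPositive n f = ∃[ c ] FExpansion n f c × (∀ α → α ⊨ n → 0ℤ ℤ.≤ c α)

FMultiplicityFree : SkewShape → Set
FMultiplicityFree A =
  ∃[ c ] FExpansion (size A) (s A) c × (∀ α → α ⊨ size A → c α ≡ 0ℤ ⊎ c α ≡ 1ℤ)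

suppF : SkewShape → Pred (List ℕ) 0ℓ
suppF A α = α ⊨ size A × ∃[ c ] FExpansion (size A) (s A) c × 0ℤ ℤ.< c α

------------------------------------------------------------------------
-- The exceptional pairs

IsPartitionShape : SkewShape → List ℕ → Set
IsPartitionShape A xs = Σ[ p ∈ Partition ] parts p ≡ xs × A ≋ straight p

IsDirectSum : SkewShape → List ℕ → List ℕ → Set
IsDirectSum A xs ys =
  Σ[ p ∈ Partition ] Σ[ q ∈ Partition ] parts p ≡ xs × parts q ≡ ys × A ≋ straight p ⊕ straight q

HookPair : ℕ → SkewShape → SkewShape → Set
HookPair n A B = ∃[ ℓ ] 1 ≤ ℓ × ℓ ≤ n ∸ 1 ×
  IsDirectSum A (replicate ℓ 1) (n ∸ ℓ ∷ []) ×
  (IsPartitionShape B (n ∸ ℓ ∷ replicate ℓ 1) ⊎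
   IsPartitionShape B (n ∸ ℓ + 1 ∷ replicate (ℓ ∸ 1) 1))

TwoRowPair : ℕ → SkewShape → SkewShape → Set
TwoRowPair n A B = 4 ≤ n ×
  IsDirectSum A (1 ∷ 1 ∷ []) (n ∸ 2 ∷ []) ×
  IsPartitionShape B (n ∸ 2 ∷ 2 ∷ [])

TwoColumnPair : ℕ → SkewShape → SkewShape → Set
TwoColumnPair n A B = 4 ≤ n ×
  IsDirectSum A (replicate (n ∸ 2) 1) (2 ∷ []) ×
  IsPartitionShape B (2 ∷ 2 ∷ replicate (n ∸ 4) 1)

ExceptionalPair : ℕ → SkewShape → SkewShape → Set
ExceptionalPair n A B = HookPair n A B ⊎ TwoRowPair n A B ⊎ TwoColumnPair n A B

UpToRotation : (SkewShape → SkewShape → Set) → SkewShape → SkewShape → Set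
UpToRotation R A B = R A B ⊎ R (A °) B ⊎ R A (B °) ⊎ R (A °) (B °)

-- The F-basis determines s_A through the set of descent vectors of the tableaux of A, so everything
-- reduces to inclusions between these sets.  A tableau is read as the word of the rows of its entries,
-- a path in Young's lattice.  Parts of multiplicity-free shapes cut out by a path are again
-- multiplicity-free; adding the rows from the bottom to the top, each new row either gives a shape of
-- one of the types
--   hook, 1^k ⊕ m, (m+2,2), (2,2,1^k), (3,3), (4,4), (2,2,2), (2,2,2,2)
-- up to rotation, or produces, up to widening gaps between rows, one of finitely many shapes or of a
-- few parametric families with two tableaux of the same descents.  The descent vectors of the types are
-- explicit, and comparing their lengths, their numbers of descents and the vectors of the form 1…10…0
-- leaves the exceptional pairs.

module Submission where

open import Defs
open import Data.Bool.Base using (Bool; true; false; T; _∧_)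
import Data.Bool.Properties as Bool
import Data.Fin.Base as Fin
open import Data.Fin.Base using (Fin; toℕ; zero; suc)
import Data.Fin.Properties as Fin
open import Data.Integer.Base as ℤ using (ℤ; 0ℤ; 1ℤ)
import Data.Integer.Properties as ℤ
open import Data.List.Base hiding (find; merge; sum; product; and; or; all; any; unsnoc; _─_)
import Data.List.Properties as List
open import Data.List.Membership.Propositional using (_∈_; _∉_; find; lose)
open import Data.List.Membership.Propositional.Properties
open import Data.List.Relation.Binary.Subset.Propositional using (_⊆_)
open import Data.List.Relation.Unary.All as All using (All; []; _∷_)
import Data.List.Relation.Unary.All.Properties as All
import Data.List.Relation.Unary.Any.Properties as Any
open import Data.List.Relation.Unary.Any as Any using (here; there)
open import Data.List.Relation.Unary.AllPairs as AllPairs using (AllPairs; []; _∷_)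
import Data.List.Relation.Unary.AllPairs.Properties as AllPairs
open import Data.List.Relation.Unary.Linked using (Linked; []; [-]; _∷_)
open import Data.List.Relation.Unary.Unique.Propositional using (Unique)
import Data.List.Relation.Unary.Unique.Propositional.Properties as Unique
open import Data.Nat.Base hiding (parity)
open import Data.Nat.Tactic.RingSolver using (solve-∀)
open import Data.Nat.Induction using (<-rec)
open import Data.Nat.ListAction using (sum)
open import Data.Nat.Properties as ℕ using (_≟_; _<?_; _≤?_; ≤-refl; ≤-trans; +-comm; +-assoc; +-suc; +-identityʳ)
open import Data.List.Relation.Binary.Subset.DecPropositional ℕ._≟_ using (_⊆?_)
open import Data.Product.Base using (Σ-syntax; ∃-syntax; ∃₂; _×_; _,_; proj₁; proj₂)
open import Data.Sum.Base using (_⊎_; inj₁; inj₂; [_,_]′)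
open import Data.Unit.Base using (⊤; tt)
open import Data.Empty using (⊥-elim)
open import Data.Vec.Base as Vec using (Vec)
import Data.Vec.Properties as Vec
open import Function.Base using (_∘_; id; _$_)
open import Function.Bundles using (_⇔_; mk⇔; Equivalence)
open import Relation.Binary.Definitions using (DecidableEquality; tri<; tri≈; tri>)
open import Relation.Binary.PropositionalEquality
open import Relation.Nullary using (¬_; Dec; yes; no; does; contradiction)
open import Relation.Nullary.Decidable using (_×-dec_; ¬?; does-⇔; True; toWitness)
open import Data.List.Membership.DecPropositional using (_∈?_)
open import Relation.Unary using (Decidable; _⊇_)

-- Finite sums of integers

-- A piece may be cut off only where the ascent at the cut is forced: an initial piece must end in
-- the bottom row (no ascent follows), a final piece must begin in the top row (no ascent) or below
-- all remaining rows (always an ascent). Hence lower rows are shortened on the right only together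
-- with the top row, and when the top row already has the length occurring in a clash, each possible
-- length of the rows below it needs a clash of its own. Widening gaps needs no such care: moving
-- higher rows further right only loosens the conditions on a path, so the two words of a clash
-- survive, although the wider shape may have more words. Rotation is harmless because replacing
-- each entry t by n + 1 - t reverses the descent vector, and the set of vectors of each type is
-- closed under reversal. Comparing types is then mostly arithmetic with the size and the least and
-- greatest number of descents. The `disjoint` shapes realise every vector with one of two
-- consecutive numbers of descents, which makes them the larger shapes in all exceptional pairs.

sumℤ : {X : Set} → (X → ℤ) → List X → ℤ
sumℤ g = foldr (λ x t → g x ℤ.+ t) 0ℤ

module _ {X : Set} where

  sumℤ-cong : ∀ {g h : X → ℤ} xs → (∀ x → x ∈ xs → g x ≡ h x) → sumℤ g xs ≡ sumℤ h xs
  sumℤ-cong []       g≡h = refl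
  sumℤ-cong (x ∷ xs) g≡h = cong₂ ℤ._+_ (g≡h x (here refl)) (sumℤ-cong xs (λ y y∈ → g≡h y (there y∈)))

  sumℤ-zero : ∀ (g : X → ℤ) xs → (∀ x → x ∈ xs → g x ≡ 0ℤ) → sumℤ g xs ≡ 0ℤ
  sumℤ-zero g []       g≡0 = refl
  sumℤ-zero g (x ∷ xs) g≡0 =
    cong₂ ℤ._+_ (g≡0 x (here refl)) (sumℤ-zero g xs (λ y y∈ → g≡0 y (there y∈)))

  sumℤ-single : ∀ (g : X → ℤ) {xs y} → Unique xs → y ∈ xs →
                (∀ x → x ∈ xs → x ≢ y → g x ≡ 0ℤ) → sumℤ g xs ≡ g y
  sumℤ-single g {x ∷ xs} (x∉ ∷ u) (here refl) g≡0 =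
    trans (cong (λ t → g x ℤ.+ t) (sumℤ-zero g xs λ z z∈ → g≡0 z (there z∈) (λ { refl → All.lookup x∉ z∈ refl })))
          (ℤ.+-identityʳ (g x))
  sumℤ-single g {x ∷ xs} (x∉ ∷ u) (there y∈) g≡0 =
    trans (cong₂ ℤ._+_ (g≡0 x (here refl) (All.lookup x∉ y∈))
                       (sumℤ-single g u y∈ (λ z z∈ → g≡0 z (there z∈))))
          (ℤ.+-identityˡ _)

  sumℤ-+ : ∀ (g h : X → ℤ) xs → sumℤ (λ x → g x ℤ.+ h x) xs ≡ sumℤ g xs ℤ.+ sumℤ h xs
  sumℤ-+ g h []       = refl
  sumℤ-+ g h (x ∷ xs) = begin
    (g x ℤ.+ h x) ℤ.+ sumℤ (λ y → g y ℤ.+ h y) xs  ≡⟨ cong (λ t → g x ℤ.+ h x ℤ.+ t) (sumℤ-+ g h xs) ⟩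
    (g x ℤ.+ h x) ℤ.+ (G ℤ.+ H)                    ≡⟨ ℤ.+-assoc (g x) (h x) (G ℤ.+ H) ⟩
    g x ℤ.+ (h x ℤ.+ (G ℤ.+ H))                    ≡⟨ cong (λ t → g x ℤ.+ t) (ℤ.+-assoc (h x) G H) ⟨
    g x ℤ.+ ((h x ℤ.+ G) ℤ.+ H)                    ≡⟨ cong (λ t → g x ℤ.+ (t ℤ.+ H)) (ℤ.+-comm (h x) G) ⟩
    g x ℤ.+ ((G ℤ.+ h x) ℤ.+ H)                    ≡⟨ cong (λ t → g x ℤ.+ t) (ℤ.+-assoc G (h x) H) ⟩
    g x ℤ.+ (G ℤ.+ (h x ℤ.+ H))                    ≡⟨ ℤ.+-assoc (g x) G (h x ℤ.+ H) ⟨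
    (g x ℤ.+ G) ℤ.+ (h x ℤ.+ H)                    ∎
    where
    open ≡-Reasoning
    G = sumℤ g xs
    H = sumℤ h xs

  sumℤ-neg : ∀ (g : X → ℤ) xs → sumℤ (λ x → ℤ.- g x) xs ≡ ℤ.- sumℤ g xs
  sumℤ-neg g []       = refl
  sumℤ-neg g (x ∷ xs) =
    trans (cong (λ t → ℤ.- g x ℤ.+ t) (sumℤ-neg g xs)) (sym (ℤ.neg-distrib-+ (g x) (sumℤ g xs)))

  sumℤ-- : ∀ (g h : X → ℤ) xs → sumℤ (λ x → g x ℤ.- h x) xs ≡ sumℤ g xs ℤ.- sumℤ h xs
  sumℤ-- g h xs = trans (sumℤ-+ g (ℤ.-_ ∘ h) xs) (cong (λ t → sumℤ g xs ℤ.+ t) (sumℤ-neg h xs))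

∑-map : ∀ {X : Set} (h : X → Series) xs e → ∑ (map h xs) e ≡ sumℤ (λ x → h x e) xs
∑-map h []       e = refl
∑-map h (x ∷ xs) e = cong (λ t → h x e ℤ.+ t) (∑-map h xs e)

-- Counting

module _ {X : Set} (_≟ₓ_ : DecidableEquality X) where

  count : X → List X → ℤ
  count y = sumℤ (λ x → [ x is y ])
    where
    [_is_] : X → X → ℤ
    [ x is y ] with x ≟ₓ y
    ... | yes _ = 1ℤ
    ... | no  _ = 0ℤ

  count-∷-≡ : ∀ {x y} xs → x ≡ y → count y (x ∷ xs) ≡ 1ℤ ℤ.+ count y xs
  count-∷-≡ {x} {y} xs x≡y with x ≟ₓ y
  ... | yes _  = refl
  ... | no x≢y = contradiction x≡y x≢y

  count-∷-≢ : ∀ {x y} xs → x ≢ y → count y (x ∷ xs) ≡ count y xs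
  count-∷-≢ {x} {y} xs x≢y with x ≟ₓ y
  ... | yes x≡y = contradiction x≡y x≢y
  ... | no _    = ℤ.+-identityˡ _

  count-nonneg : ∀ y xs → 0ℤ ℤ.≤ count y xs
  count-nonneg y []       = ℤ.≤-refl
  count-nonneg y (x ∷ xs) with x ≟ₓ y
  ... | yes _ = ℤ.≤-trans (count-nonneg y xs) (ℤ.i≤suc[i] (count y xs))
  ... | no  _ = subst (0ℤ ℤ.≤_) (sym (ℤ.+-identityˡ _)) (count-nonneg y xs)

  ∈⇒1≤count : ∀ {y xs} → y ∈ xs → 1ℤ ℤ.≤ count y xs
  ∈⇒1≤count {y} {x ∷ xs} (here refl) =
    subst (1ℤ ℤ.≤_) (sym (count-∷-≡ xs refl)) (ℤ.suc-mono (count-nonneg y xs))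
  ∈⇒1≤count {y} {x ∷ xs} (there y∈) with x ≟ₓ y
  ... | yes _ = ℤ.≤-trans (∈⇒1≤count y∈) (ℤ.i≤suc[i] (count y xs))
  ... | no  _ = subst (1ℤ ℤ.≤_) (sym (ℤ.+-identityˡ _)) (∈⇒1≤count y∈)

  0<count⇒∈ : ∀ {y} xs → 0ℤ ℤ.< count y xs → y ∈ xs
  0<count⇒∈ []       (ℤ.+<+ ())
  0<count⇒∈ {y} (x ∷ xs) 0<c with x ≟ₓ y
  ... | yes refl = here refl
  ... | no  _    = there (0<count⇒∈ xs (subst (0ℤ ℤ.<_) (ℤ.+-identityˡ _) 0<c))

  -- Stated for an indexed family because the two tableaux differ while their compositions agree;
  -- this is the source of a coefficient of at least 2.
  collision⇒2≤count : ∀ {Z : Set} (f : Z → X) {z z′ y} zs → z ∈ zs → z′ ∈ zs → z ≢ z′ →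
                      f z ≡ y → f z′ ≡ y → ℤ.+ 2 ℤ.≤ count y (map f zs)
  collision⇒2≤count f (w ∷ zs) (here refl) (here refl) z≢z′ _ _ = contradiction refl z≢z′
  collision⇒2≤count f (w ∷ zs) (here refl) (there z′∈) z≢z′ refl eq =
    subst (ℤ.+ 2 ℤ.≤_) (sym (count-∷-≡ (map f zs) refl))
      (ℤ.suc-mono (∈⇒1≤count (subst (_∈ map f zs) eq (∈-map⁺ f z′∈))))
  collision⇒2≤count f (w ∷ zs) (there z∈) (here refl) z≢z′ eq refl =
    subst (ℤ.+ 2 ℤ.≤_) (sym (count-∷-≡ (map f zs) refl))
      (ℤ.suc-mono (∈⇒1≤count (subst (_∈ map f zs) eq (∈-map⁺ f z∈))))
  collision⇒2≤count f {y = y} (w ∷ zs) (there z∈) (there z′∈) z≢z′ p q with f w ≟ₓ y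
  ... | yes _ = ℤ.≤-trans (collision⇒2≤count f zs z∈ z′∈ z≢z′ p q) (ℤ.i≤suc[i] (count y (map f zs)))
  ... | no  _ = subst (ℤ.+ 2 ℤ.≤_) (sym (ℤ.+-identityˡ _)) (collision⇒2≤count f zs z∈ z′∈ z≢z′ p q)

  -- Collects equal terms. With `h` the values of the `F α` at a monomial and `L` the list of all
  -- compositions, it turns a sum over tableaux into an expansion in the F-basis.
  sumℤ-by-value : ∀ (h : X → ℤ) {L} → Unique L → ∀ xs → (∀ x → x ∈ xs → x ∈ L) →
                  sumℤ h xs ≡ sumℤ (λ y → count y xs ℤ.* h y) L
  sumℤ-by-value h {L} u []       xs⊆ = sym (sumℤ-zero _ L (λ y _ → ℤ.*-zeroˡ (h y)))
  sumℤ-by-value h {L} u (x ∷ xs) xs⊆ = begin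
    h x ℤ.+ sumℤ h xs
      ≡⟨ cong₂ ℤ._+_ (sym single) (sumℤ-by-value h u xs (λ y y∈ → xs⊆ y (there y∈))) ⟩
    sumℤ (λ y → count y (x ∷ []) ℤ.* h y) L ℤ.+ sumℤ (λ y → count y xs ℤ.* h y) L
      ≡⟨ sumℤ-+ (λ y → count y (x ∷ []) ℤ.* h y) (λ y → count y xs ℤ.* h y) L ⟨
    sumℤ (λ y → count y (x ∷ []) ℤ.* h y ℤ.+ count y xs ℤ.* h y) L
      ≡⟨ sumℤ-cong L (λ y _ → addTerms y) ⟩
    sumℤ (λ y → count y (x ∷ xs) ℤ.* h y) L ∎
    where
    open ≡-Reasoning
    single : sumℤ (λ y → count y (x ∷ []) ℤ.* h y) L ≡ h x
    single = trans
      (sumℤ-single _ u (xs⊆ x (here refl)) λ y _ y≢x →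
        trans (cong (ℤ._* h y) (count-∷-≢ [] (y≢x ∘ sym))) (ℤ.*-zeroˡ (h y)))
      (trans (cong (ℤ._* h x) (count-∷-≡ [] refl)) (ℤ.*-identityˡ (h x)))
    addTerms : ∀ y → count y (x ∷ []) ℤ.* h y ℤ.+ count y xs ℤ.* h y ≡ count y (x ∷ xs) ℤ.* h y
    addTerms y with x ≟ₓ y
    ... | yes _ = sym (ℤ.*-distribʳ-+ (h y) 1ℤ (count y xs))
    ... | no  _ = sym (ℤ.*-distribʳ-+ (h y) 0ℤ (count y xs))

-- Compositions

-- The function local to `compositions`, restated so that proofs can refer to it.
extensions : List ℕ → List (List ℕ)
extensions []      = (1 ∷ []) ∷ []
extensions (a ∷ α) = (1 ∷ a ∷ α) ∷ (suc a ∷ α) ∷ []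

compositions-suc : ∀ n → compositions (suc n) ≡ concatMap extensions (compositions n)
compositions-suc n = List.concatMap-cong (λ { [] → refl ; (_ ∷ _) → refl }) (compositions n)

∈-compositions⇒⊨ : ∀ n {α} → α ∈ compositions n → α ⊨ n
∈-compositions⇒⊨ zero    (here refl) = [] , refl
∈-compositions⇒⊨ (suc n) α∈ rewrite compositions-suc n
  with find (∈-concatMap⁻ extensions {xs = compositions n} α∈)
... | []    , β∈ , here refl         with ∈-compositions⇒⊨ n β∈
...   | _ , refl = (s≤s z≤n ∷ []) , refl
∈-compositions⇒⊨ (suc n) α∈ | b ∷ β , β∈ , here refl with ∈-compositions⇒⊨ n β∈
...   | pos , refl = (s≤s z≤n ∷ pos) , refl
∈-compositions⇒⊨ (suc n) α∈ | b ∷ β , β∈ , there (here refl) with ∈-compositions⇒⊨ n β∈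
...   | (_ ∷ pos) , refl = (s≤s z≤n ∷ pos) , refl

⊨⇒∈-compositions : ∀ n {α} → α ⊨ n → α ∈ compositions n
⊨⇒∈-compositions zero    {[]}        _ = here refl
⊨⇒∈-compositions zero    {suc a ∷ α} (_ , ())
⊨⇒∈-compositions zero    {zero ∷ α}  (() ∷ _ , _)
⊨⇒∈-compositions (suc n) {suc zero ∷ []}    (_ , refl) = here refl
⊨⇒∈-compositions (suc n) {suc zero ∷ b ∷ β} (_ ∷ pos , eq) rewrite compositions-suc n =
  ∈-concatMap⁺ extensions (lose (⊨⇒∈-compositions n (pos , ℕ.suc-injective eq)) (here refl))
⊨⇒∈-compositions (suc n) {suc (suc a) ∷ β}  (_ ∷ pos , eq) rewrite compositions-suc n =
  ∈-concatMap⁺ extensions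
    (lose (⊨⇒∈-compositions n {suc a ∷ β} (s≤s z≤n ∷ pos , ℕ.suc-injective eq)) (there (here refl)))

unextend : List ℕ → List ℕ
unextend []                = []
unextend (zero        ∷ α) = α
unextend (suc zero    ∷ α) = α
unextend (suc (suc a) ∷ α) = suc a ∷ α

unextend-extensions : ∀ {α β} → All (0 <_) α → β ∈ extensions α → unextend β ≡ α
unextend-extensions {[]}        _ (here refl)         = refl
unextend-extensions {a ∷ α}     _ (here refl)         = refl
unextend-extensions {suc a ∷ α} _ (there (here refl)) = refl
unextend-extensions {zero ∷ α}  (() ∷ _) (there (here refl))

-- `g` recovers the element of `xs` from which an entry arose, so the lists that are joined are
-- disjoint.
concatMap-unique : ∀ {X Y : Set} (f : X → List Y) (g : Y → X) {xs} →
                   (∀ {x y} → x ∈ xs → y ∈ f x → g y ≡ x) → (∀ x → Unique (f x)) →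
                   Unique xs → Unique (concatMap f xs)
concatMap-unique f g {[]}     gf uf u        = []
concatMap-unique f g {x ∷ xs} gf uf (x∉ ∷ u) =
  Unique.++⁺ (uf x) (concatMap-unique f g (gf ∘ there) uf u) λ (y∈ , y∈′) →
    let x′ , x′∈ , y∈fx′ = find (∈-concatMap⁻ f {xs = xs} y∈′)
    in All.lookup x∉ x′∈ (trans (sym (gf (here refl) y∈)) (gf (there x′∈) y∈fx′))

compositions-unique : ∀ n → Unique (compositions n)
compositions-unique zero    = [] ∷ []
compositions-unique (suc n) rewrite compositions-suc n =
  concatMap-unique extensions unextend
    (λ α∈ → unextend-extensions (proj₁ (∈-compositions⇒⊨ n α∈)))
    (λ { [] → [] ∷ [] ; (a ∷ α) → ((λ ()) ∷ []) ∷ [] ∷ [] })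
    (compositions-unique n)

∈S⇒0< : ∀ {α x} → All (0 <_) α → x ∈ S α → 0 < x
∈S⇒0< {a ∷ b ∷ α} (0<a ∷ _)  (here refl) = 0<a
∈S⇒0< {a ∷ b ∷ α} (0<a ∷ _)  (there x∈) with ∈-map⁻ (a +_) x∈
... | y , _ , refl = ℕ.≤-trans 0<a (ℕ.m≤m+n a y)

+-positive : ∀ x {y} → 0 < y → x + y ≢ x
+-positive x {suc y} _ = ℕ.m+1+n≢m x

-- A composition coarser than b ∷ β either starts with b or merges b into its first part.
coarser-∷ : ∀ {a α b β} → All (0 <_) (a ∷ α) → All (0 <_) (b ∷ β) → a + sum α ≡ b + sum β → 0 < length α →
  (∀ {γ} → All (0 <_) γ → sum γ ≡ sum β → S γ ⊆ S β → γ ≡ β ⊎ length γ < length β) →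
  S (a ∷ α) ⊆ S (b ∷ β) → a ∷ α ≡ b ∷ β ⊎ length (a ∷ α) < length (b ∷ β)
coarser-∷ {a} {a′ ∷ α} {b} {[]}     _ _ _ _ ih α⊆β with () ← α⊆β (here refl)
coarser-∷ {a} {a′ ∷ α} {b} {b′ ∷ β} (0<a ∷ α⁺) (0<b ∷ β⁺) eq _ ih α⊆β with α⊆β (here refl)
... | here refl = [ inj₁ ∘ cong (a ∷_) , inj₂ ∘ s≤s ]′ (ih α⁺ (ℕ.+-cancelˡ-≡ a _ _ eq) tail⊆)
  where
  tail⊆ : S (a′ ∷ α) ⊆ S (b′ ∷ β)
  tail⊆ {x} x∈ with α⊆β (there (∈-map⁺ (a +_) x∈))
  ... | here a+x≡a = contradiction a+x≡a (+-positive a (∈S⇒0< α⁺ x∈))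
  ... | there a+x∈ with ∈-map⁻ (a +_) a+x∈
  ...   | y , y∈ , a+x≡a+y = subst (_∈ S (b′ ∷ β)) (ℕ.+-cancelˡ-≡ a y x (sym a+x≡a+y)) y∈
... | there a∈ with ∈-map⁻ (b +_) a∈
...   | y , y∈ , refl =
  inj₂ ([ (λ { refl → ≤-refl }) , ℕ.m<n⇒m<1+n ]′
    (ih (∈S⇒0< β⁺ y∈ ∷ α⁺) (ℕ.+-cancelˡ-≡ b _ _ (trans (sym (+-assoc b y _)) eq)) tail⊆))
  where
  tail⊆ : S (y ∷ a′ ∷ α) ⊆ S (b′ ∷ β)
  tail⊆ (here refl) = y∈
  tail⊆ (there z∈) with ∈-map⁻ (y +_) z∈
  ... | x , x∈ , refl with α⊆β (there (∈-map⁺ (b + y +_) x∈))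
  ...   | here b+y+x≡b = contradiction (trans (sym (+-assoc b y x)) b+y+x≡b)
            (+-positive b (≤-trans (∈S⇒0< β⁺ y∈) (ℕ.m≤m+n y x)))
  ...   | there b+y+x∈ with ∈-map⁻ (b +_) b+y+x∈
  ...     | w , w∈ , e = subst (_∈ S (b′ ∷ β)) (ℕ.+-cancelˡ-≡ b w (y + x) (trans (sym e) (+-assoc b y x))) w∈

-- Triangularity of the F-basis: the number of parts is the measure along which `FExpansion-unique`
-- determines the coefficients.
S⊆⇒≡⊎shorter : ∀ {α} β → All (0 <_) α → All (0 <_) β → sum α ≡ sum β → S α ⊆ S β → α ≡ β ⊎ length α < length β
S⊆⇒≡⊎shorter {[]}        []           _         _         _  _   = inj₁ refl
S⊆⇒≡⊎shorter {[]}        (suc b ∷ β)  _         (_ ∷ _)   () _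
S⊆⇒≡⊎shorter {suc a ∷ α} []           _         _         () _
S⊆⇒≡⊎shorter {zero ∷ α}  []           (() ∷ _)  _         _  _
S⊆⇒≡⊎shorter {[]}        (zero ∷ β)   _         (() ∷ _)  _  _
S⊆⇒≡⊎shorter {a ∷ []}    (b ∷ [])     _         _         eq _   = inj₁ (cong (_∷ []) (ℕ.+-cancelʳ-≡ 0 a b eq))
S⊆⇒≡⊎shorter {a ∷ []}    (b ∷ _ ∷ β)  _         _         _  _   = inj₂ (s≤s (s≤s z≤n))
S⊆⇒≡⊎shorter {a ∷ _ ∷ α} (b ∷ β)      α⁺ β⁺@(_ ∷ β′⁺)     eq α⊆β =
  coarser-∷ α⁺ β⁺ eq (s≤s z≤n) (λ γ⁺ eq′ → S⊆⇒≡⊎shorter β γ⁺ β′⁺ eq′) α⊆β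

-- The F-basis

M-on : ∀ α e → filter (0 <?_) e ≡ α → M α e ≡ 1ℤ
M-on α e eq with List.≡-dec _≟_ (filter (0 <?_) e) α
... | yes _ = refl
... | no ≢α = contradiction eq ≢α

M-off : ∀ α e → filter (0 <?_) e ≢ α → M α e ≡ 0ℤ
M-off α e ≢α with List.≡-dec _≟_ (filter (0 <?_) e) α
... | yes eq = contradiction eq ≢α
... | no  _  = refl

module _ {n} {α β : List ℕ} (α⊨ : α ⊨ n) (β⊨ : β ⊨ n) where

  private
    refinements : List (List ℕ)
    refinements = filter (λ γ → S α ⊆? S γ) (compositions (sum α))

    β-exponents : filter (0 <?_) β ≡ β
    β-exponents = List.filter-all (0 <?_) (proj₁ β⊨)

  -- The exponent sequence `β` is a monomial of `M β` alone, and `β` occurs once among the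
  -- refinements of `α`.
  F-coarser : S α ⊆ S β → F α β ≡ 1ℤ
  F-coarser α⊆β = begin
    F α β                             ≡⟨ ∑-map M refinements β ⟩
    sumℤ (λ γ → M γ β) refinements    ≡⟨ sumℤ-single _ unique β∈ (λ γ _ γ≢β → M-off γ β (γ≢β ∘ sym ∘ trans (sym β-exponents))) ⟩
    M β β                             ≡⟨ M-on β β β-exponents ⟩
    1ℤ                                ∎
    where
    open ≡-Reasoning
    unique : Unique refinements
    unique = Unique.filter⁺ (λ γ → S α ⊆? S γ) (compositions-unique (sum α))
    β∈ : β ∈ refinements
    β∈ = ∈-filter⁺ (λ γ → S α ⊆? S γ)
      (⊨⇒∈-compositions (sum α) (proj₁ β⊨ , trans (proj₂ β⊨) (sym (proj₂ α⊨)))) α⊆β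

  F-not-coarser : ¬ S α ⊆ S β → F α β ≡ 0ℤ
  F-not-coarser α⊈β = trans (∑-map M refinements β) (sumℤ-zero _ refinements λ γ γ∈ →
    M-off γ β λ e → α⊈β (subst (λ δ → S α ⊆ S δ) (trans (sym e) β-exponents)
      (proj₂ (∈-filter⁻ (λ γ → S α ⊆? S γ) {xs = compositions (sum α)} γ∈))))

-- Induction on the number of parts of the composition. At the exponents `β` only those `F γ` with
-- `γ` coarser than `β` contribute; unless `γ` is `β` it has fewer parts, so its coefficients agree
-- already and cancel.
FExpansion-unique : ∀ {n f} c d → FExpansion n f c → FExpansion n f d → ∀ {α} → α ⊨ n → c α ≡ d α
FExpansion-unique {n} {f} c d fc fd {α} α⊨ = <-rec P step (length α) α⊨ refl
  where
  P : ℕ → Set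
  P k = ∀ {β} → β ⊨ n → length β ≡ k → c β ≡ d β

  step : ∀ k → (∀ {j} → j < k → P j) → P k
  step k ih {β} β⊨ refl = ℤ.i-j≡0⇒i≡j (c β) (d β) (begin
    c β ℤ.- d β                                        ≡⟨ cong₂ ℤ._-_ (at-β c) (at-β d) ⟨
    term β                                             ≡⟨ sumℤ-single term (compositions-unique n) (⊨⇒∈-compositions n β⊨) off-β ⟨
    sumℤ term (compositions n)                         ≡⟨ sumℤ-- (λ γ → c γ ℤ.* F γ β) (λ γ → d γ ℤ.* F γ β) (compositions n) ⟩
    sumℤ (λ γ → c γ ℤ.* F γ β) (compositions n) ℤ.- sumℤ (λ γ → d γ ℤ.* F γ β) (compositions n)
                                                       ≡⟨ cong₂ ℤ._-_ (value c fc) (value d fd) ⟨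
    f β ℤ.- f β                                        ≡⟨ ℤ.+-inverseʳ (f β) ⟩
    0ℤ                                                 ∎)
    where
    open ≡-Reasoning
    term : List ℕ → ℤ
    term γ = c γ ℤ.* F γ β ℤ.- d γ ℤ.* F γ β
    value : ∀ e → FExpansion n f e → f β ≡ sumℤ (λ γ → e γ ℤ.* F γ β) (compositions n)
    value e fe = trans (fe β) (∑-map (λ γ → e γ · F γ) (compositions n) β)
    at-β : ∀ e → e β ℤ.* F β β ≡ e β
    at-β e = trans (cong (λ t → e β ℤ.* t) (F-coarser β⊨ β⊨ id)) (ℤ.*-identityʳ (e β))
    off-β : ∀ γ → γ ∈ compositions n → γ ≢ β → term γ ≡ 0ℤ
    off-β γ γ∈ γ≢β with S γ ⊆? S β
    ... | no γ⊈β rewrite F-not-coarser (∈-compositions⇒⊨ n γ∈) β⊨ γ⊈β | ℤ.*-zeroʳ (c γ) | ℤ.*-zeroʳ (d γ) = refl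
    ... | yes γ⊆β with S⊆⇒≡⊎shorter β (proj₁ (∈-compositions⇒⊨ n γ∈)) (proj₁ β⊨) (trans (proj₂ (∈-compositions⇒⊨ n γ∈)) (sym (proj₂ β⊨))) γ⊆β
    ...   | inj₁ γ≡β = contradiction γ≡β γ≢β
    ...   | inj₂ lt rewrite ih lt (∈-compositions⇒⊨ n γ∈) refl = ℤ.+-inverseʳ (d γ ℤ.* F γ β)

-- Descent compositions from bit vectors: bit i tells whether i is a descent

blocks : ℕ → List Bool → List ℕ
blocks k []          = k ∷ []
blocks k (true  ∷ β) = k ∷ blocks 1 β
blocks k (false ∷ β) = blocks (suc k) β

blocks-⊨ : ∀ {k} β → 0 < k → blocks k β ⊨ (k + length β)
blocks-⊨     []          0<k = (0<k ∷ []) , refl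
blocks-⊨ {k} (true  ∷ β) 0<k = let pos , eq = blocks-⊨ β (s≤s z≤n) in (0<k ∷ pos) , cong (k +_) eq
blocks-⊨ {k} (false ∷ β) 0<k =
  let pos , eq = blocks-⊨ {suc k} β (s≤s z≤n) in pos , trans eq (sym (+-suc k (length β)))

blocks-head : ∀ {k j γ} β → blocks k β ≡ j ∷ γ → k ≤ j
blocks-head []          refl = ≤-refl
blocks-head (true  ∷ β) refl = ≤-refl
blocks-head (false ∷ β) eq   = ℕ.<⇒≤ (blocks-head β eq)

-- The next bit can be read off: after `true` the first part is `k`, after `false` it exceeds `k` by
-- `blocks-head`.
blocks-injective : ∀ {k} β γ → length β ≡ length γ → blocks k β ≡ blocks k γ → β ≡ γ
blocks-injective []          []          _  _  = refl
blocks-injective (true ∷ β)  (true ∷ γ)  le eq =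
  cong (true ∷_) (blocks-injective β γ (ℕ.suc-injective le) (List.∷-injectiveʳ eq))
blocks-injective (false ∷ β) (false ∷ γ) le eq =
  cong (false ∷_) (blocks-injective β γ (ℕ.suc-injective le) eq)
blocks-injective (true ∷ β)  (false ∷ γ) le eq = contradiction (blocks-head γ (sym eq)) ℕ.1+n≰n
blocks-injective (false ∷ β) (true ∷ γ)  le eq = contradiction (blocks-head β eq) ℕ.1+n≰n

-- With d the previous descent, dropping one part from the composition of d ∷ ds leaves
-- the differences starting from d.
differences : ℕ → ℕ → List ℕ → List ℕ
differences m d ds = drop 1 (compositionOf (suc m) (d ∷ ds))

-- The invariant of the scan: `d` is the last descent found, `d + k` is the number examined next, so
-- `k` is the length of the current block, and `j` numbers remain.
differences-blocks : ∀ {P : ℕ → Set} (P? : Decidable P) {m d k} j f →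
                     (∀ i → f i ≡ d + k + i) → d + k + j ≡ suc m →
                     differences m d (filter P? (applyUpTo f j)) ≡ blocks k (map (does ∘ P?) (applyUpTo f j))
differences-blocks P? {m} {d} {k} zero f f≡ eq =
  cong (_∷ []) (trans (cong (_∸ d) (trans (sym eq) (+-identityʳ (d + k)))) (ℕ.m+n∸m≡n d k))
differences-blocks P? {m} {d} {k} (suc j) f f≡ eq with P? (f 0)
... | yes _ = cong₂ _∷_ f0∸d (differences-blocks P? j (f ∘ suc)
                (λ i → trans (f≡ (suc i)) (trans (+-suc (d + k) i) (cong (_+ i) (trans (cong suc (sym f0)) (+-comm 1 (f 0))))))
                (trans (cong (λ t → t + 1 + j) f0) (trans (+-assoc (d + k) 1 j) eq)))
  where
  f0 : f 0 ≡ d + k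
  f0 = trans (f≡ 0) (+-identityʳ (d + k))
  f0∸d : f 0 ∸ d ≡ k
  f0∸d = trans (cong (_∸ d) f0) (ℕ.m+n∸m≡n d k)
... | no  _ = differences-blocks P? j (f ∘ suc)
                (λ i → trans (f≡ (suc i)) (trans (+-suc (d + k) i) (cong (_+ i) (sym (+-suc d k)))))
                (trans (cong (_+ j) (+-suc d k)) (trans (sym (+-suc (d + k) j)) eq))

compositionOf-blocks : ∀ {P : ℕ → Set} (P? : Decidable P) m →
                       compositionOf (suc m) (filter P? (applyUpTo suc m)) ≡
                       blocks 1 (map (does ∘ P?) (applyUpTo suc m))
compositionOf-blocks P? m = differences-blocks P? {m} {0} {1} m suc (λ _ → refl) refl

compositionOfBits : ℕ → List Bool → List ℕ
compositionOfBits zero    β = []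
compositionOfBits (suc n) β = blocks 1 β

compositionOfBits-⊨ : ∀ n {β} → length β ≡ n ∸ 1 → compositionOfBits n β ⊨ n
compositionOfBits-⊨ zero    _    = [] , refl
compositionOfBits-⊨ (suc n) {β} refl = blocks-⊨ {1} β (s≤s z≤n)

compositionOfBits-injective : ∀ n {β γ} → length β ≡ n ∸ 1 → length γ ≡ n ∸ 1 →
                              compositionOfBits n β ≡ compositionOfBits n γ → β ≡ γ
compositionOfBits-injective zero    {[]} {[]} _  _  _  = refl
compositionOfBits-injective (suc n) {β}  {γ}  lβ lγ eq = blocks-injective β γ (trans lβ (sym lγ)) eq

descentBits : (A : SkewShape) → Filling A → List Bool
descentBits A T = map (does ∘ isDescent? A T) (applyUpTo suc (size A ∸ 1))

length-descentBits : ∀ A T → length (descentBits A T) ≡ size A ∸ 1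
length-descentBits A T = trans (List.length-map (does ∘ isDescent? A T) (applyUpTo suc (size A ∸ 1)))
                               (List.length-applyUpTo suc (size A ∸ 1))

comp-bits : ∀ A T → comp A T ≡ compositionOfBits (size A) (descentBits A T)
comp-bits A T = go (size A)
  where
  go : ∀ n → compositionOf n (filter (isDescent? A T) (applyUpTo suc (n ∸ 1))) ≡
             compositionOfBits n (map (does ∘ isDescent? A T) (applyUpTo suc (n ∸ 1)))
  go zero    = refl
  go (suc n) = compositionOf-blocks (isDescent? A T) n

∈-vectors : ∀ {X : Set} {xs : List X} {m} (v : Vec X m) → (∀ x → x ∈ xs) → v ∈ vectors xs m
∈-vectors Vec.[]      all∈ = here refl
∈-vectors {xs = xs} {suc m} (x Vec.∷ v) all∈ =
  ∈-concatMap⁺ (λ x → map (x Vec.∷_) (vectors xs m)) {xs = xs}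
    (lose {xs = xs} (all∈ x) (∈-map⁺ (x Vec.∷_) (∈-vectors v all∈)))

-- Multiplicities of descent compositions

-- What the F-expansion sees of a shape. The size is a parameter, so that two shapes whose sizes are
-- only propositionally equal can be compared at a common `n`.
record Family (n : ℕ) : Set₁ where
  field
    {Member}    : Set
    _≟ₘ_        : DecidableEquality Member
    members     : List Member
    composition : Member → List ℕ
    descents′   : Member → List Bool
    length≡     : ∀ T → length (descents′ T) ≡ n ∸ 1
    bits≡       : ∀ T → composition T ≡ compositionOfBits n (descents′ T)

  series : Series
  series = ∑ (map (λ T → F (composition T)) members)

  Occurs : List Bool → Set
  Occurs β = ∃[ T ] T ∈ members × descents′ T ≡ β

  multiplicity : List ℕ → ℤ
  multiplicity α = count (List.≡-dec _≟_) α (map composition members)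

  composition-⊨ : ∀ T → composition T ⊨ n
  composition-⊨ T = subst (_⊨ n) (sym (bits≡ T)) (compositionOfBits-⊨ n (length≡ T))

  expansion : FExpansion n series multiplicity
  expansion e = begin
    series e
      ≡⟨ ∑-map (F ∘ composition) members e ⟩
    sumℤ (λ T → F (composition T) e) members
      ≡⟨ List.foldr-map (λ α t → F α e ℤ.+ t) composition 0ℤ members ⟨
    sumℤ (λ α → F α e) (map composition members)
      ≡⟨ sumℤ-by-value (List.≡-dec _≟_) (λ α → F α e) (compositions-unique n) _ comps∈ ⟩
    sumℤ (λ α → (multiplicity α · F α) e) (compositions n)
      ≡⟨ ∑-map (λ α → multiplicity α · F α) (compositions n) e ⟨
    ∑ (map (λ α → multiplicity α · F α) (compositions n)) e ∎
    where
    open ≡-Reasoning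
    comps∈ : ∀ α → α ∈ map composition members → α ∈ compositions n
    comps∈ α α∈ with ∈-map⁻ composition α∈
    ... | T , _ , refl = ⊨⇒∈-compositions n (composition-⊨ T)

  Free : Set
  Free = ∃[ c ] FExpansion n series c × (∀ α → α ⊨ n → c α ≡ 0ℤ ⊎ c α ≡ 1ℤ)

  Support : List ℕ → Set
  Support α = α ⊨ n × ∃[ c ] FExpansion n series c × 0ℤ ℤ.< c α

  Occurs⇒1≤ : ∀ {β} → Occurs β → 1ℤ ℤ.≤ multiplicity (compositionOfBits n β)
  Occurs⇒1≤ (T , T∈ , refl) = ∈⇒1≤count (List.≡-dec _≟_)
    (subst (_∈ map composition members) (bits≡ T) (∈-map⁺ composition T∈))

  Occurs⇒length : ∀ {β} → Occurs β → length β ≡ n ∸ 1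
  Occurs⇒length (T , _ , refl) = length≡ T

  0<⇒Occurs : ∀ {α} → 0ℤ ℤ.< multiplicity α → ∃[ β ] Occurs β × α ≡ compositionOfBits n β
  0<⇒Occurs {α} 0<m with ∈-map⁻ composition (0<count⇒∈ (List.≡-dec _≟_) (map composition members) 0<m)
  ... | T , T∈ , refl = descents′ T , (T , T∈ , refl) , bits≡ T

  1≤⇒Occurs : ∀ {β} → length β ≡ n ∸ 1 → 1ℤ ℤ.≤ multiplicity (compositionOfBits n β) → Occurs β
  1≤⇒Occurs {β} lβ 1≤m with 0<⇒Occurs (ℤ.<-≤-trans (ℤ.+<+ (s≤s z≤n)) 1≤m)
  ... | γ , r , eq = subst Occurs (sym (compositionOfBits-injective n lβ (Occurs⇒length r) eq)) r

  -- Multiplicities count tableaux, and by uniqueness of the expansion they are the coefficients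
  -- known to be 0 or 1; two tableaux with equal descents would give 2.
  Free⇒injective : Free → ∀ {T T′} → T ∈ members → T′ ∈ members → descents′ T ≡ descents′ T′ → T ≡ T′
  Free⇒injective (c , c-exp , c01) {T} {T′} T∈ T′∈ eq with T ≟ₘ T′
  ... | yes T≡T′ = T≡T′
  ... | no  T≢T′ = contradiction (subst (ℤ.+ 2 ℤ.≤_) mult≡c 2≤) (2≰ (c01 (composition T) (composition-⊨ T)))
    where
    mult≡c : multiplicity (composition T) ≡ c (composition T)
    mult≡c = FExpansion-unique multiplicity c expansion c-exp (composition-⊨ T)
    2≤ : ℤ.+ 2 ℤ.≤ multiplicity (composition T)
    2≤ = collision⇒2≤count (List.≡-dec _≟_) composition members T∈ T′∈ T≢T′ refl
      (trans (bits≡ T′) (trans (cong (compositionOfBits n) (sym eq)) (sym (bits≡ T))))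
    2≰ : ∀ {x} → x ≡ 0ℤ ⊎ x ≡ 1ℤ → ¬ ℤ.+ 2 ℤ.≤ x
    2≰ (inj₁ refl) (ℤ.+≤+ ())
    2≰ (inj₂ refl) (ℤ.+≤+ (s≤s ()))

  Free⇒≤1 : Free → ∀ {α} → α ⊨ n → multiplicity α ℤ.≤ 1ℤ
  Free⇒≤1 (c , c-exp , c01) {α} α⊨ =
    subst (ℤ._≤ 1ℤ) (sym (FExpansion-unique multiplicity c expansion c-exp α⊨)) (≤1 (c01 α α⊨))
    where
    ≤1 : ∀ {x} → x ≡ 0ℤ ⊎ x ≡ 1ℤ → x ℤ.≤ 1ℤ
    ≤1 (inj₁ refl) = ℤ.+≤+ z≤n
    ≤1 (inj₂ refl) = ℤ.≤-refl

  Support⇒Occurs : ∀ {α} → Support α → ∃[ β ] Occurs β × α ≡ compositionOfBits n β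
  Support⇒Occurs (α⊨ , c , c-exp , 0<c) =
    0<⇒Occurs (subst (0ℤ ℤ.<_) (FExpansion-unique c multiplicity c-exp expansion α⊨) 0<c)

  Occurs⇒Support : ∀ {β} → Occurs β → Support (compositionOfBits n β)
  Occurs⇒Support r = compositionOfBits-⊨ n (Occurs⇒length r) ,
    multiplicity , expansion , ℤ.<-≤-trans (ℤ.+<+ (s≤s z≤n)) (Occurs⇒1≤ r)

module _ {n : ℕ} (𝒜 ℬ : Family n) where

  private
    module A = Family 𝒜
    module B = Family ℬ

  Contained : Set
  Contained = ∀ β → B.Occurs β → A.Occurs β

  Support-⊇⇔ : (∀ {α} → B.Support α → A.Support α) ⇔ Contained
  Support-⊇⇔ = mk⇔ to from
    where
    to : (∀ {α} → B.Support α → A.Support α) → Contained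
    to B⊆A β r with A.Support⇒Occurs (B⊆A (B.Occurs⇒Support r))
    ... | γ , r′ , eq = subst A.Occurs
      (sym (compositionOfBits-injective n (B.Occurs⇒length r) (A.Occurs⇒length r′) eq)) r′
    from : Contained → ∀ {α} → B.Support α → A.Support α
    from B⊆A supp with B.Support⇒Occurs supp
    ... | β , r , refl = A.Occurs⇒Support (B⊆A β r)

  -- Where ℬ has a positive multiplicity it is 1, and there 𝒜 has at least 1. This is what reduces
  -- positivity of a difference to inclusion of supports.
  multiplicity-≤ : B.Free → Contained → ∀ α → α ⊨ n → B.multiplicity α ℤ.≤ A.multiplicity α
  multiplicity-≤ free B⊆A α α⊨ with 0ℤ ℤ.<? B.multiplicity α
  ... | no ≮ = ℤ.≤-trans (ℤ.≮⇒≥ ≮) (count-nonneg (List.≡-dec _≟_) α (map A.composition A.members))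
  ... | yes 0<B with B.0<⇒Occurs 0<B
  ...   | β , r , refl = ℤ.≤-trans (B.Free⇒≤1 free α⊨) (A.Occurs⇒1≤ (B⊆A β r))

  series-determines : A.series ≐ B.series → Contained
  series-determines A≐B β r = A.1≤⇒Occurs lβ (subst (1ℤ ℤ.≤_)
    (FExpansion-unique B.multiplicity A.multiplicity (λ e → trans (A≐B e) (B.expansion e)) A.expansion (compositionOfBits-⊨ n lβ))
    (B.Occurs⇒1≤ r))
    where lβ = B.Occurs⇒length r

  private
    difference : List ℕ → ℤ
    difference α = A.multiplicity α ℤ.- B.multiplicity α

    difference-expansion : FExpansion n (A.series ⊖ B.series) difference
    difference-expansion e = begin
      A.series e ℤ.- B.series e
        ≡⟨ cong₂ ℤ._-_ (trans (A.expansion e) (∑-map (λ α → A.multiplicity α · F α) L e))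
                       (trans (B.expansion e) (∑-map (λ α → B.multiplicity α · F α) L e)) ⟩
      sumℤ (λ α → A.multiplicity α ℤ.* F α e) L ℤ.- sumℤ (λ α → B.multiplicity α ℤ.* F α e) L
        ≡⟨ sumℤ-- (λ α → A.multiplicity α ℤ.* F α e) (λ α → B.multiplicity α ℤ.* F α e) L ⟨
      sumℤ (λ α → A.multiplicity α ℤ.* F α e ℤ.- B.multiplicity α ℤ.* F α e) L
        ≡⟨ sumℤ-cong L (λ α _ → factor α) ⟩
      sumℤ (λ α → (difference α · F α) e) L
        ≡⟨ ∑-map (λ α → difference α · F α) L e ⟨
      ∑ (map (λ α → difference α · F α) L) e ∎
      where
      open ≡-Reasoning
      L = compositions n
      factor : ∀ α → A.multiplicity α ℤ.* F α e ℤ.- B.multiplicity α ℤ.* F α e ≡ difference α ℤ.* F α e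
      factor α = sym (trans (ℤ.*-distribʳ-+ (F α e) (A.multiplicity α) (ℤ.- B.multiplicity α))
        (cong (λ t → A.multiplicity α ℤ.* F α e ℤ.+ t) (sym (ℤ.neg-distribˡ-* (B.multiplicity α) (F α e)))))

  FPositive⇔ : B.Free → FPositive n (A.series ⊖ B.series) ⇔ Contained
  FPositive⇔ free = mk⇔ to from
    where
    to : FPositive n (A.series ⊖ B.series) → Contained
    to (c , c-exp , 0≤c) β r =
      A.1≤⇒Occurs lβ (ℤ.≤-trans (B.Occurs⇒1≤ r) (ℤ.0≤i-j⇒j≤i {A.multiplicity (compositionOfBits n β)} {B.multiplicity (compositionOfBits n β)} 0≤d))
      where
      lβ : length β ≡ n ∸ 1
      lβ = B.Occurs⇒length r
      0≤d : 0ℤ ℤ.≤ difference (compositionOfBits n β)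
      0≤d = subst (0ℤ ℤ.≤_) (FExpansion-unique c difference c-exp difference-expansion (compositionOfBits-⊨ n lβ))
                  (0≤c (compositionOfBits n β) (compositionOfBits-⊨ n lβ))
    from : Contained → FPositive n (A.series ⊖ B.series)
    from B⊆A = difference , difference-expansion , λ α α⊨ → ℤ.i≤j⇒0≤j-i (multiplicity-≤ free B⊆A α α⊨)

Contained⇒≐ : ∀ {n} (𝒜 ℬ : Family n) → Family.Free 𝒜 → Family.Free ℬ → Contained 𝒜 ℬ → Contained ℬ 𝒜 →
              Family.series 𝒜 ≐ Family.series ℬ
Contained⇒≐ {n} 𝒜 ℬ free-A free-B B⊆A A⊆B e = begin
  A.series e                                            ≡⟨ trans (A.expansion e) (∑-map (λ α → A.multiplicity α · F α) L e) ⟩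
  sumℤ (λ α → A.multiplicity α ℤ.* F α e) L             ≡⟨ sumℤ-cong L (λ α α∈ → cong (ℤ._* F α e) (mult≡ α (∈-compositions⇒⊨ n α∈))) ⟩
  sumℤ (λ α → B.multiplicity α ℤ.* F α e) L             ≡⟨ trans (B.expansion e) (∑-map (λ α → B.multiplicity α · F α) L e) ⟨
  B.series e                                            ∎
  where
  open ≡-Reasoning
  module A = Family 𝒜
  module B = Family ℬ
  L = compositions n
  mult≡ : ∀ α → α ⊨ n → A.multiplicity α ≡ B.multiplicity α
  mult≡ α α⊨ = ℤ.≤-antisym (multiplicity-≤ ℬ 𝒜 free-A A⊆B α α⊨) (multiplicity-≤ 𝒜 ℬ free-B B⊆A α α⊨)

tableaux : ∀ A n → size A ≡ n → Family n
tableaux A n eq = record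
  { Member      = Filling A
  ; _≟ₘ_        = Vec.≡-dec Fin._≟_
  ; members     = SYTs A
  ; composition = comp A
  ; descents′   = descentBits A
  ; length≡     = λ T → trans (length-descentBits A T) (cong (_∸ 1) eq)
  ; bits≡       = λ T → trans (comp-bits A T) (cong (λ m → compositionOfBits m (descentBits A T)) eq)
  }

Realises : SkewShape → List Bool → Set
Realises A β = Σ[ T ∈ Filling A ] IsSYT A T × descentBits A T ≡ β

IsSYT⇒∈ : ∀ A {T} → IsSYT A T → T ∈ SYTs A
IsSYT⇒∈ A {T} = ∈-filter⁺ (isSYT? A) (∈-vectors T ∈-allFin)

∈⇒IsSYT : ∀ A {T} → T ∈ SYTs A → IsSYT A T
∈⇒IsSYT A T∈ = proj₂ (∈-filter⁻ (isSYT? A) {xs = vectors (allFin (size A)) (size A)} T∈)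

Realises⇒Occurs : ∀ A n eq β → Realises A β → Family.Occurs (tableaux A n eq) β
Realises⇒Occurs A n eq β (T , syt , e) = T , IsSYT⇒∈ A {T} syt , e

Occurs⇒Realises : ∀ A n eq β → Family.Occurs (tableaux A n eq) β → Realises A β
Occurs⇒Realises A n eq β (T , T∈ , e) = T , ∈⇒IsSYT A T∈ , e

-- Words of rows

-- A standard filling of the rows [p₁,q₁), [p₂,q₂), … (top to bottom) is recorded by the word of the
-- rows of its entries 1, 2, …, that is by a path of row ends from ps to qs; b bounds the top row end.
data Step : ℕ → List ℕ → ℕ → List ℕ → Set where
  here  : ∀ {b x ps} → x < b → Step b (x ∷ ps) 0 (suc x ∷ ps)
  there : ∀ {b x ps i qs} → Step x ps i qs → Step b (x ∷ ps) (suc i) (x ∷ qs)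

infixr 5 _∷_
data Path (b : ℕ) : List ℕ → List ℕ → List ℕ → Set where
  []  : ∀ {ps} → Path b ps [] ps
  _∷_ : ∀ {ps i ps′ w qs} → Step b ps i ps′ → Path b ps′ w qs → Path b ps (i ∷ w) qs

infixr 5 _▷_
_▷_ : ∀ {b ps u qs v rs} → Path b ps u qs → Path b qs v rs → Path b ps (u ++ v) rs
[]      ▷ σ = σ
(s ∷ π) ▷ σ = s ∷ (π ▷ σ)

below : ∀ {b x ps w qs} → Path x ps w qs → Path b (x ∷ ps) (map suc w) (x ∷ qs)
below []      = []
below (s ∷ π) = there s ∷ below π

step-≤ : ∀ {b b′ ps i qs} → b ≤ b′ → Step b ps i qs → Step b′ ps i qs
step-≤ b≤b′ (here x<b) = here (≤-trans x<b b≤b′)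
step-≤ b≤b′ (there s)  = there s

path-≤ : ∀ {b b′ ps w qs} → b ≤ b′ → Path b ps w qs → Path b′ ps w qs
path-≤ b≤b′ []      = []
path-≤ b≤b′ (s ∷ π) = step-≤ b≤b′ s ∷ path-≤ b≤b′ π

step-++ : ∀ {b ps i qs} rs → Step b ps i qs → Step b (ps ++ rs) i (qs ++ rs)
step-++ rs (here x<b) = here x<b
step-++ rs (there s)  = there (step-++ rs s)

path-++ : ∀ {b ps w qs} rs → Path b ps w qs → Path b (ps ++ rs) w (qs ++ rs)
path-++ rs []      = []
path-++ rs (s ∷ π) = step-++ rs s ∷ path-++ rs π

step-sum : ∀ {b ps i qs} → Step b ps i qs → suc (sum ps) ≡ sum qs
step-sum (here _)          = refl
step-sum (there {x = x} s) = trans (sym (+-suc x _)) (cong (x +_) (step-sum s))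

path-sum : ∀ {b ps w qs} → Path b ps w qs → length w + sum ps ≡ sum qs
path-sum []                 = refl
path-sum (_∷_ {w = w} s π) = trans (sym (+-suc (length w) _)) (trans (cong (length w +_) (step-sum s)) (path-sum π))

path-length : ∀ {b b′ ps w w′ qs} → Path b ps w qs → Path b′ ps w′ qs → length w ≡ length w′
path-length {ps = ps} {w} {w′} π π′ = ℕ.+-cancelʳ-≡ (sum ps) (length w) (length w′) (trans (path-sum π) (sym (path-sum π′)))

lastFrom : ℕ → List ℕ → ℕ
lastFrom x []      = x
lastFrom x (y ∷ w) = lastFrom y w

-- The first argument is the preceding letter. Letters are rows counted downwards, so an ascent of
-- the word is a descent of the tableau.
ascentsFrom : ℕ → List ℕ → List Bool
ascentsFrom x []      = []
ascentsFrom x (y ∷ w) = (x <ᵇ y) ∷ ascentsFrom y w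

ascents : List ℕ → List Bool
ascents []      = []
ascents (x ∷ w) = ascentsFrom x w

ascentsFrom-++ : ∀ x u v → ascentsFrom x (u ++ v) ≡ ascentsFrom x u ++ ascentsFrom (lastFrom x u) v
ascentsFrom-++ x []      v = refl
ascentsFrom-++ x (y ∷ u) v = cong ((x <ᵇ y) ∷_) (ascentsFrom-++ y u v)

ascentsFrom-suc : ∀ x w → ascentsFrom (suc x) (map suc w) ≡ ascentsFrom x w
ascentsFrom-suc x []      = refl
ascentsFrom-suc x (y ∷ w) = cong ((x <ᵇ y) ∷_) (ascentsFrom-suc y w)

ascentsFrom-0-suc : ∀ {w w′} → length w ≡ length w′ → ascents w ≡ ascents w′ →
                    ascentsFrom 0 (map suc w) ≡ ascentsFrom 0 (map suc w′)
ascentsFrom-0-suc {[]}    {[]}     _ _  = refl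
ascentsFrom-0-suc {x ∷ w} {y ∷ w′} _ eq =
  cong (true ∷_) (trans (ascentsFrom-suc x w) (trans eq (sym (ascentsFrom-suc y w′))))

n≮ᵇn : ∀ n → (n <ᵇ n) ≡ false
n≮ᵇn zero    = refl
n≮ᵇn (suc n) = n≮ᵇn n

n<ᵇ1+m+n : ∀ m n → (n <ᵇ suc (m + n)) ≡ true
n<ᵇ1+m+n m zero    = refl
n<ᵇ1+m+n m (suc n) rewrite +-suc m n = n<ᵇ1+m+n m n

ascentsFrom-replicate : ∀ x k w → ascentsFrom x (replicate k x ++ w) ≡ replicate k false ++ ascentsFrom x w
ascentsFrom-replicate x zero    w = refl
ascentsFrom-replicate x (suc k) w = cong₂ _∷_ (n≮ᵇn x) (ascentsFrom-replicate x k w)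

ascents-drop : ∀ w → ascents w ≡ drop 1 (ascentsFrom 0 w)
ascents-drop []      = refl
ascents-drop (x ∷ w) = refl

ascents-++ : ∀ {w w′ v} → length w ≡ length w′ → ascents w ≡ ascents w′ →
             (∀ {z v′} → v ≡ z ∷ v′ → (lastFrom 0 w <ᵇ z) ≡ (lastFrom 0 w′ <ᵇ z)) → ascents (w ++ v) ≡ ascents (w′ ++ v)
ascents-++ {[]}    {[]}     {v}     _ _  _     = refl
ascents-++ {x ∷ w} {y ∷ w′} {[]}    _ eq _     rewrite List.++-identityʳ w | List.++-identityʳ w′ = eq
ascents-++ {x ∷ w} {y ∷ w′} {z ∷ v} _ eq same  = begin
  ascentsFrom x (w ++ z ∷ v)                             ≡⟨ ascentsFrom-++ x w (z ∷ v) ⟩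
  ascentsFrom x w ++ (lastFrom x w <ᵇ z) ∷ ascentsFrom z v    ≡⟨ cong₂ (λ β t → β ++ t ∷ ascentsFrom z v) eq (same refl) ⟩
  ascentsFrom y w′ ++ (lastFrom y w′ <ᵇ z) ∷ ascentsFrom z v  ≡⟨ ascentsFrom-++ y w′ (z ∷ v) ⟨
  ascentsFrom y (w′ ++ z ∷ v)                            ∎
  where open ≡-Reasoning

-- Filling row by row

data Skew : ℕ → List ℕ → List ℕ → Set where
  []  : ∀ {b} → Skew b [] []
  _∷_ : ∀ {b p q ps qs} → p ≤ q × q ≤ b → Skew q ps qs → Skew b (p ∷ ps) (q ∷ qs)

rowwise : List ℕ → List ℕ → List ℕ
rowwise (p ∷ ps) (q ∷ qs) = replicate (q ∸ p) 0 ++ map suc (rowwise ps qs)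
rowwise _        _        = []

run₀ : ∀ {b x y ps} t → t + x ≡ y → y ≤ b → Path b (x ∷ ps) (replicate t 0) (y ∷ ps)
run₀ zero    refl y≤b = []
run₀ {x = x} (suc t) refl y≤b = here (≤-trans (s≤s (ℕ.m≤n+m x t)) y≤b) ∷ run₀ t (+-suc t x) y≤b

run₁ : ∀ {b x y z ps} t → t + y ≡ z → z ≤ x → Path b (x ∷ y ∷ ps) (replicate t 1) (x ∷ z ∷ ps)
run₁ zero    refl z≤x = []
run₁ {y = y} (suc t) refl z≤x = there (here (≤-trans (s≤s (ℕ.m≤n+m y t)) z≤x)) ∷ run₁ t (+-suc t y) z≤x

rowwise-path : ∀ {b ps qs} → Skew b ps qs → Path b ps (rowwise ps qs) qs
rowwise-path []                  = []
rowwise-path ((p≤q , q≤b) ∷ sk) = run₀ _ (ℕ.m∸n+n≡m p≤q) q≤b ▷ below (rowwise-path sk)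

-- Words with distinct ascents

Good : ℕ → List ℕ → List ℕ → Set
Good b ps qs = ∀ {w w′} → Path b ps w qs → Path b ps w′ qs → ascents w ≡ ascents w′ → w ≡ w′

-- Fill the top row first: whatever letter of a lower row comes next, it is an ascent after 0, so
-- equal ascents below stay equal.
Good-tail : ∀ {b p q ps qs} → p < q → q ≤ b → Good b (p ∷ ps) (q ∷ qs) → Good q ps qs
Good-tail {b} {p} {q} {ps} {qs} p<q q≤b good {w} {w′} π π′ eq =
  List.map-injective ℕ.suc-injective (List.++-cancelˡ (replicate (suc t) 0) _ _ (good (extend π) (extend π′) eqs))
  where
  t : ℕ
  t = q ∸ suc p
  extend : ∀ {w} → Path q ps w qs → Path b (p ∷ ps) (replicate (suc t) 0 ++ map suc w) (q ∷ qs)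
  extend π = run₀ (suc t) (trans (sym (+-suc t p)) (ℕ.m∸n+n≡m p<q)) q≤b ▷ below π
  eqs : ascents (replicate (suc t) 0 ++ map suc w) ≡ ascents (replicate (suc t) 0 ++ map suc w′)
  eqs = begin
    ascentsFrom 0 (replicate t 0 ++ map suc w)       ≡⟨ ascentsFrom-replicate 0 t (map suc w) ⟩
    replicate t false ++ ascentsFrom 0 (map suc w)   ≡⟨ cong (replicate t false ++_) (ascentsFrom-0-suc (path-length π π′) eq) ⟩
    replicate t false ++ ascentsFrom 0 (map suc w′)  ≡⟨ ascentsFrom-replicate 0 t (map suc w′) ⟨
    ascentsFrom 0 (replicate t 0 ++ map suc w′)      ∎
    where open ≡-Reasoning

Good-≤ : ∀ {b b′ ps qs} → b ≤ b′ → Good b′ ps qs → Good b ps qs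
Good-≤ b≤b′ good π π′ = good (path-≤ b≤b′ π) (path-≤ b≤b′ π′)

step-row : ∀ {b ps i qs} → Step b ps i qs → i < length ps
step-row (here _)  = s≤s z≤n
step-row (there s) = s≤s (step-row s)

step-rows : ∀ {b ps i qs} → Step b ps i qs → length ps ≡ length qs
step-rows (here _)  = refl
step-rows (there s) = cong suc (step-rows s)

path-rows : ∀ {b ps w qs} → Path b ps w qs → length ps ≡ length qs
path-rows []      = refl
path-rows (s ∷ π) = trans (step-rows s) (path-rows π)

path-last : ∀ {b ps w qs x} → Path b ps w qs → x < length ps → lastFrom x w < length ps
path-last []      x< = x<
path-last (s ∷ π) _  rewrite step-rows s = path-last π (subst (_ <_) (step-rows s) (step-row s))

<⇒<ᵇ-true : ∀ {m n} → m < n → (m <ᵇ n) ≡ true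
<⇒<ᵇ-true m<n = Equivalence.to Bool.T-≡ (ℕ.<⇒<ᵇ m<n)

≥⇒<ᵇ-false : ∀ {m n} → n ≤ m → (m <ᵇ n) ≡ false
≥⇒<ᵇ-false {m} {n} n≤m with m <ᵇ n in eq
... | false = refl
... | true  = contradiction (ℕ.<ᵇ⇒< m n (subst T (sym eq) tt)) (ℕ.≤⇒≯ n≤m)

-- Since `u` ends in the bottom row `z`, the letter after it is never an ascent. Boxes may therefore
-- be removed at the beginning whenever their filling ends in the bottom row; the default `z` in
-- `lastFrom` admits an empty `u`.
Good-prefix : ∀ {b ps u νs qs z} → length ps ≡ suc z → Path b ps u νs → lastFrom z u ≡ z →
              Good b ps qs → Good b νs qs
Good-prefix {b} {u = u} {z = z} rows σ last good {w} {w′} π π′ eq =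
  List.++-cancelˡ u w w′ (good (σ ▷ π) (σ ▷ π′) (extend u last))
  where
  same : ∀ {w w′} → Path b _ w _ → Path b _ w′ _ → ascents w ≡ ascents w′ → length w ≡ length w′ →
         ascentsFrom z w ≡ ascentsFrom z w′
  same []      []        _  _ = refl
  same (s ∷ _) (s′ ∷ _)  eq _ = cong₂ _∷_
    (trans (≥⇒<ᵇ-false (bound s)) (sym (≥⇒<ᵇ-false (bound s′)))) eq
    where
    bound : ∀ {i τ} → Step b _ i τ → i ≤ z
    bound s = ℕ.≤-pred (subst (_ <_) (trans (sym (path-rows σ)) rows) (step-row s))
  extend : ∀ u → lastFrom z u ≡ z → ascents (u ++ w) ≡ ascents (u ++ w′)
  extend []      _    = eq
  extend (y ∷ u) refl = trans (ascentsFrom-++ y u w)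
    (trans (cong (ascentsFrom y u ++_) (same π π′ eq (path-length π π′))) (sym (ascentsFrom-++ y u w′)))

-- The path `v` that is cut off starts with 0, which is never an ascent, or below all rows of `ps`,
-- which always is one; so the ascent at the junction does not depend on the word before it.
Good-suffix : ∀ {b ps qs v κ} → Path b κ v qs → (∀ {z v′} → v ≡ z ∷ v′ → z ≡ 0 ⊎ length ps ≤ z) →
              Good b ps qs → Good b ps κ
Good-suffix σ first good {[]}    {[]}    π π′ eq = refl
Good-suffix σ first good {[]}    {_ ∷ _} π π′ eq with () ← path-length π π′
Good-suffix σ first good {_ ∷ _} {[]}    π π′ eq with () ← path-length π π′
Good-suffix {b} {ps} {v = v} {κ} σ first good {x ∷ w} {y ∷ w′} π π′ eq =
  List.++-cancelʳ v (x ∷ w) (y ∷ w′) (good (π ▷ σ) (π′ ▷ σ) (ascents-++ (path-length π π′) eq same))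
  where
  high : ∀ {x w z} → Path b ps (x ∷ w) κ → length ps ≤ z → (lastFrom x w <ᵇ z) ≡ true
  high (s ∷ π) low = <⇒<ᵇ-true (ℕ.<-≤-trans (subst (_ <_) (sym (step-rows s))
    (path-last π (subst (_ <_) (step-rows s) (step-row s)))) low)
  same : ∀ {z v′} → v ≡ z ∷ v′ → (lastFrom x w <ᵇ z) ≡ (lastFrom y w′ <ᵇ z)
  same v≡ with first v≡
  ... | inj₁ refl = refl
  ... | inj₂ low  = trans (high π low) (sym (high π′ low))

rowwise-below : ∀ {b ps qs} κ → Skew b (κ ++ ps) (κ ++ qs) →
                Path b (κ ++ ps) (map (length κ +_) (rowwise ps qs)) (κ ++ qs)
rowwise-below []      sk       = subst (λ v → Path _ _ v _) (sym (List.map-id _)) (rowwise-path sk)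
rowwise-below {ps = ps} {qs} (x ∷ κ) (_ ∷ sk) =
  subst (λ v → Path _ _ v _) (sym (List.map-∘ (rowwise ps qs))) (below (rowwise-below κ sk))

Skew-full : ∀ {b} ps qs {rs us} → length ps ≡ length qs → Skew b (ps ++ rs) (qs ++ us) → Skew b (qs ++ rs) (qs ++ us)
Skew-full []       []       _  sk                = sk
Skew-full (p ∷ ps) (q ∷ qs) le ((_ , q≤b) ∷ sk) = (≤-refl , q≤b) ∷ Skew-full ps qs (ℕ.suc-injective le) sk

-- Prolong each word by the rowwise filling of the lower rows; the junction is an ascent whatever
-- the last letter of the upper rows.
Good-upper : ∀ {b} ps qs {rs us} → length ps ≡ length qs → Skew b (ps ++ rs) (qs ++ us) →
             Good b (ps ++ rs) (qs ++ us) → Good b ps qs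
Good-upper {b} ps qs {rs} {us} le sk good {w} {w′} π π′ eq = lower-first (map (length qs +_) (rowwise rs us)) refl
  where
  σ : Path b (qs ++ rs) (map (length qs +_) (rowwise rs us)) (qs ++ us)
  σ = rowwise-below qs (Skew-full ps qs le sk)
  lower-first : ∀ v → v ≡ map (length qs +_) (rowwise rs us) → w ≡ w′
  lower-first v refl = List.++-cancelʳ v w w′ (good (path-++ rs π ▷ σ) (path-++ rs π′ ▷ σ) (goal (rowwise rs us) π π′ eq))
    where
    last-< : ∀ {w x κ} → Path b ps (x ∷ w) κ → ∀ k → (lastFrom x w <ᵇ length qs + k) ≡ true
    last-< (s ∷ π) k = <⇒<ᵇ-true (ℕ.<-≤-trans (subst (_ <_) (trans (sym (step-rows s)) le)
      (path-last π (subst (_ <_) (step-rows s) (step-row s)))) (ℕ.m≤m+n (length qs) k))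
    goal : ∀ u {w w′} → Path b ps w qs → Path b ps w′ qs → ascents w ≡ ascents w′ →
           ascents (w ++ map (length qs +_) u) ≡ ascents (w′ ++ map (length qs +_) u)
    goal u {[]}    {[]}     π π′ eq = refl
    goal u {[]}    {_ ∷ _}  π π′ eq with () ← path-length π π′
    goal u {_ ∷ _} {[]}     π π′ eq with () ← path-length π π′
    goal u {x ∷ w} {y ∷ w′} π π′ eq = ascents-++ (path-length π π′) eq
      (λ v≡ → same u v≡)
      where
      same : ∀ u {z v′} → map (length qs +_) u ≡ z ∷ v′ → (lastFrom x w <ᵇ z) ≡ (lastFrom y w′ <ᵇ z)
      same (k ∷ u) refl = trans (last-< π k) (sym (last-< π′ k))

-- Unless the top row is complete, the rowwise filling starts in it.
Good-partial : ∀ {b ps x κ q qs} → Skew b (x ∷ κ) (q ∷ qs) → x < q → Good b ps (q ∷ qs) → Good b ps (x ∷ κ)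
Good-partial {ps = ps} {x} {κ} {q} {qs} sk x<q = Good-suffix (rowwise-path sk) (first-0 (q ∸ x) (ℕ.m<n⇒0<n∸m x<q))
  where
  first-0 : ∀ t → 0 < t → ∀ {z v′ v} → replicate t 0 ++ v ≡ z ∷ v′ → z ≡ 0 ⊎ length ps ≤ z
  first-0 (suc t) _ refl = inj₁ refl

record Clash (b : ℕ) (ps qs : List ℕ) : Set where
  constructor clash
  field
    {word word′} : List ℕ
    path         : Path b ps word qs
    path′        : Path b ps word′ qs
    distinct     : word ≢ word′
    same         : ascents word ≡ ascents word′

Clash⇒¬Good : ∀ {b ps qs} → Clash b ps qs → ¬ Good b ps qs
Clash⇒¬Good (clash π π′ w≢w′ eq) good = w≢w′ (good π π′ eq)

-- Widening the gaps between the rows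

-- Shifts decrease weakly downwards. A step needs its row end to be smaller than the one above, and
-- adding a larger amount to the upper end keeps this true.
data Shifts : ℕ → List ℕ → Set where
  []  : ∀ {s} → Shifts s []
  _∷_ : ∀ {s t ts} → t ≤ s → Shifts t ts → Shifts s (t ∷ ts)

step-shift : ∀ {b s ps i qs ts} → Shifts s ts → length ts ≡ length ps → Step b ps i qs →
             Step (b + s) (zipWith _+_ ps ts) i (zipWith _+_ qs ts)
step-shift (t≤s ∷ ts) _  (here x<b) = here (ℕ.+-mono-≤ x<b t≤s)
step-shift (t≤s ∷ ts) le (there s)  = there (step-shift ts (ℕ.suc-injective le) s)

path-shift : ∀ {b s ps w qs ts} → Shifts s ts → length ts ≡ length ps → Path b ps w qs →
             Path (b + s) (zipWith _+_ ps ts) w (zipWith _+_ qs ts)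
path-shift ts le []      = []
path-shift ts le (s ∷ π) = step-shift ts le s ∷ path-shift ts (trans le (step-rows s)) π

clash-shift : ∀ {b s ps qs ts} → Shifts s ts → length ts ≡ length ps → Clash b ps qs →
              Clash (b + s) (zipWith _+_ ps ts) (zipWith _+_ qs ts)
clash-shift sh le (clash π π′ w≢w′ eq) = clash (path-shift sh le π) (path-shift sh le π′) w≢w′ eq

-- Evaluating words on numerals

stepᵇ : ℕ → List ℕ → ℕ → List ℕ × Bool
stepᵇ b []       i       = [] , false
stepᵇ b (x ∷ ps) zero    = (suc x ∷ ps) , (x <ᵇ b)
stepᵇ b (x ∷ ps) (suc i) = (x ∷ proj₁ (stepᵇ x ps i)) , proj₂ (stepᵇ x ps i)

step-sound : ∀ b ps i → T (proj₂ (stepᵇ b ps i)) → Step b ps i (proj₁ (stepᵇ b ps i))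
step-sound b (x ∷ ps) zero    ok = here (ℕ.<ᵇ⇒< x b ok)
step-sound b (x ∷ ps) (suc i) ok = there (step-sound x ps i ok)

-- The bound 0 is a dummy: `stepᵇ` computes the new row ends whether or not the step is allowed, and
-- `validᵇ` checks the bounds separately.
run : List ℕ → List ℕ → List ℕ
run ps []      = ps
run ps (i ∷ w) = run (proj₁ (stepᵇ 0 ps i)) w

validᵇ : ℕ → List ℕ → List ℕ → Bool
validᵇ b ps []      = true
validᵇ b ps (i ∷ w) = proj₂ (stepᵇ b ps i) ∧ validᵇ b (proj₁ (stepᵇ b ps i)) w

step-state : ∀ b b′ ps i → proj₁ (stepᵇ b ps i) ≡ proj₁ (stepᵇ b′ ps i)
step-state b b′ []       i       = refl
step-state b b′ (x ∷ ps) zero    = refl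
step-state b b′ (x ∷ ps) (suc i) = refl

path-sound : ∀ b ps w → T (validᵇ b ps w) → Path b ps w (run ps w)
path-sound b ps []      _  = []
path-sound b ps (i ∷ w) ok =
  let ok₁ , ok₂ = Equivalence.to Bool.T-∧ ok in
  subst (λ σ → Path b ps (i ∷ w) (run σ w)) (step-state b 0 ps i)
    (step-sound b ps i ok₁ ∷ path-sound b _ w ok₂)

clash-on-numerals : ∀ b ps w w′ → T (validᵇ b ps w) → T (validᵇ b ps w′) → run ps w′ ≡ run ps w →
                    w ≢ w′ → ascents w ≡ ascents w′ → Clash b ps (run ps w)
clash-on-numerals b ps w w′ ok ok′ eq w≢w′ same =
  clash (path-sound b ps w ok) (subst (Path b ps w′) eq (path-sound b ps w′ ok′)) w≢w′ same

-- Rows of a shape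

Row : Set
Row = ℕ × ℕ

starts ends : List Row → List ℕ
starts = map proj₁
ends   = map proj₂

-- A row [a,e) is the pair (a , e); α and β bound the starts and the ends.
data Rows : ℕ → ℕ → List Row → Set where
  []  : ∀ {α β} → Rows α β []
  cons : ∀ {α β a e rs} → a < e → a ≤ α → e ≤ β → Rows a e rs → Rows α β ((a , e) ∷ rs)

rows-skew : ∀ {α β rs} → Rows α β rs → Skew β (starts rs) (ends rs)
rows-skew []                    = []
rows-skew (cons a<e _ e≤β rows) = (ℕ.<⇒≤ a<e , e≤β) ∷ rows-skew rows

GoodRows : List Row → Set
GoodRows []       = ⊤
GoodRows (r ∷ rs) = Good (proj₂ r) (proj₁ r ∷ starts rs) (proj₂ r ∷ ends rs)

GoodRows-tail : ∀ {α β r rs} → Rows α β (r ∷ rs) → GoodRows (r ∷ rs) → GoodRows rs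
GoodRows-tail {rs = []}     _                              _    = tt
GoodRows-tail {rs = r ∷ rs} (cons a<e _ _ (cons _ _ d≤e _)) good = Good-≤ d≤e (Good-tail a<e ≤-refl good)

GoodRows-upper : ∀ {α β} r rs {us} → Rows α β (r ∷ rs ++ us) → GoodRows (r ∷ rs ++ us) → GoodRows (r ∷ rs)
GoodRows-upper r rs {us} rows good =
  Good-upper (starts (r ∷ rs)) (ends (r ∷ rs)) (trans (List.length-map proj₁ (r ∷ rs)) (sym (List.length-map proj₂ (r ∷ rs))))
    (subst₂ (Skew _) (List.map-++ proj₁ (r ∷ rs) us) (List.map-++ proj₂ (r ∷ rs) us) (skew rows))
    (subst₂ (Good _) (List.map-++ proj₁ (r ∷ rs) us) (List.map-++ proj₂ (r ∷ rs) us) good)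
  where
  skew : ∀ {α β rs} → Rows α β (r ∷ rs) → Skew (proj₂ r) (starts (r ∷ rs)) (ends (r ∷ rs))
  skew (cons a<e _ _ rows) = (ℕ.<⇒≤ a<e , ≤-refl) ∷ rows-skew rows

bar : ℕ → ℕ → Row
bar c m = c , suc (m + c)

cells : ℕ → ℕ → List Row
cells c k = replicate k (c , suc c)

-- Reduction of a good shape to one of finitely many clashes

refute : ∀ {b s ps qs ts} → Clash b ps qs → Shifts s ts → length ts ≡ length ps →
         ¬ Good (b + s) (zipWith _+_ ps ts) (zipWith _+_ qs ts)
refute cl sh le = Clash⇒¬Good (clash-shift sh le cl)

-- Cuts the outer boundary down to `x ∷ κ`. The top row must lose a box, so that the filling of what
-- is cut off can begin with the letter 0.
Good-top : ∀ {ps x κ q qs} → Skew q κ qs → x < q → Good q ps (q ∷ qs) → Good x ps (x ∷ κ)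
Good-top sk x<q good = Good-≤ (ℕ.<⇒≤ x<q) (Good-partial ((ℕ.<⇒≤ x<q , ≤-refl) ∷ sk) x<q good)

-- In these names the digits are row lengths from the top, with `⊕` as for shapes. Several clashes
-- share the length of the top row, since `Good-top` cannot shorten lower rows alone.
clash-43 : Clash 4 (0 ∷ 0 ∷ []) (4 ∷ 3 ∷ [])
clash-43 = clash-on-numerals 4 _
  (0 ∷ 0 ∷ 1 ∷ 0 ∷ 0 ∷ 1 ∷ 1 ∷ [])
  (0 ∷ 0 ∷ 1 ∷ 1 ∷ 0 ∷ 1 ∷ 0 ∷ []) tt tt refl (λ ()) refl

clash-34 : Clash 4 (1 ∷ 0 ∷ []) (4 ∷ 4 ∷ [])
clash-34 = clash-on-numerals 4 _
  (0 ∷ 0 ∷ 1 ∷ 1 ∷ 0 ∷ 1 ∷ 1 ∷ [])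
  (1 ∷ 0 ∷ 1 ∷ 0 ∷ 0 ∷ 1 ∷ 1 ∷ []) tt tt refl (λ ()) refl

clash-55 : Clash 5 (0 ∷ 0 ∷ []) (5 ∷ 5 ∷ [])
clash-55 = clash-on-numerals 5 _
  (0 ∷ 0 ∷ 1 ∷ 0 ∷ 0 ∷ 1 ∷ 1 ∷ 0 ∷ 1 ∷ 1 ∷ [])
  (0 ∷ 0 ∷ 1 ∷ 1 ∷ 0 ∷ 1 ∷ 0 ∷ 0 ∷ 1 ∷ 1 ∷ []) tt tt refl (λ ()) refl

clash-321 : Clash 3 (0 ∷ 0 ∷ 0 ∷ []) (3 ∷ 2 ∷ 1 ∷ [])
clash-321 = clash-on-numerals 3 _
  (0 ∷ 0 ∷ 1 ∷ 0 ∷ 2 ∷ 1 ∷ [])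
  (0 ∷ 0 ∷ 1 ∷ 1 ∷ 2 ∷ 0 ∷ []) tt tt refl (λ ()) refl

clash-331 : Clash 3 (0 ∷ 0 ∷ 0 ∷ []) (3 ∷ 3 ∷ 1 ∷ [])
clash-331 = clash-on-numerals 3 _
  (0 ∷ 0 ∷ 1 ∷ 0 ∷ 1 ∷ 1 ∷ 2 ∷ [])
  (0 ∷ 0 ∷ 1 ∷ 1 ∷ 2 ∷ 0 ∷ 1 ∷ []) tt tt refl (λ ()) refl

clash-322 : Clash 3 (0 ∷ 0 ∷ 0 ∷ []) (3 ∷ 2 ∷ 2 ∷ [])
clash-322 = clash-on-numerals 3 _
  (0 ∷ 0 ∷ 1 ∷ 0 ∷ 2 ∷ 1 ∷ 2 ∷ [])
  (0 ∷ 0 ∷ 1 ∷ 1 ∷ 2 ∷ 0 ∷ 2 ∷ []) tt tt refl (λ ()) refl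

clash-332 : Clash 3 (0 ∷ 0 ∷ 0 ∷ []) (3 ∷ 3 ∷ 2 ∷ [])
clash-332 = clash-on-numerals 3 _
  (0 ∷ 0 ∷ 1 ∷ 0 ∷ 1 ∷ 1 ∷ 2 ∷ 2 ∷ [])
  (0 ∷ 0 ∷ 1 ∷ 0 ∷ 2 ∷ 1 ∷ 2 ∷ 1 ∷ []) tt tt refl (λ ()) refl

clash-333 : Clash 3 (0 ∷ 0 ∷ 0 ∷ []) (3 ∷ 3 ∷ 3 ∷ [])
clash-333 = clash-on-numerals 3 _
  (0 ∷ 0 ∷ 1 ∷ 0 ∷ 2 ∷ 1 ∷ 2 ∷ 1 ∷ 2 ∷ [])
  (0 ∷ 0 ∷ 1 ∷ 1 ∷ 2 ∷ 0 ∷ 2 ∷ 1 ∷ 2 ∷ []) tt tt refl (λ ()) refl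

clash-1⊕1⊕1 : Clash 3 (2 ∷ 1 ∷ 0 ∷ []) (3 ∷ 2 ∷ 1 ∷ [])
clash-1⊕1⊕1 = clash-on-numerals 3 _
  (0 ∷ 2 ∷ 1 ∷ [])
  (1 ∷ 2 ∷ 0 ∷ []) tt tt refl (λ ()) refl

clash-1⊕21 : Clash 3 (1 ∷ 1 ∷ 0 ∷ []) (3 ∷ 2 ∷ 1 ∷ [])
clash-1⊕21 = clash-on-numerals 3 _
  (0 ∷ 1 ∷ 0 ∷ 2 ∷ [])
  (0 ∷ 2 ∷ 0 ∷ 1 ∷ []) tt tt refl (λ ()) refl

clash-1⊕22 : Clash 3 (1 ∷ 1 ∷ 0 ∷ []) (3 ∷ 3 ∷ 1 ∷ [])
clash-1⊕22 = clash-on-numerals 3 _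
  (0 ∷ 1 ∷ 0 ∷ 2 ∷ 1 ∷ [])
  (0 ∷ 2 ∷ 0 ∷ 1 ∷ 1 ∷ []) tt tt refl (λ ()) refl

clash-11⊕11 : Clash 2 (1 ∷ 1 ∷ 0 ∷ 0 ∷ []) (2 ∷ 2 ∷ 1 ∷ 1 ∷ [])
clash-11⊕11 = clash-on-numerals 2 _
  (0 ∷ 2 ∷ 1 ∷ 3 ∷ [])
  (2 ∷ 3 ∷ 0 ∷ 1 ∷ []) tt tt refl (λ ()) refl

clash-232 : Clash 3 (1 ∷ 0 ∷ 0 ∷ []) (3 ∷ 3 ∷ 2 ∷ [])
clash-232 = clash-on-numerals 3 _
  (0 ∷ 1 ∷ 0 ∷ 1 ∷ 1 ∷ 2 ∷ 2 ∷ [])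
  (0 ∷ 1 ∷ 0 ∷ 2 ∷ 1 ∷ 2 ∷ 1 ∷ []) tt tt refl (λ ()) refl

clash-22⊕1 : Clash 3 (2 ∷ 0 ∷ 0 ∷ []) (3 ∷ 2 ∷ 2 ∷ [])
clash-22⊕1 = clash-on-numerals 3 _
  (1 ∷ 0 ∷ 2 ∷ 1 ∷ 2 ∷ [])
  (1 ∷ 1 ∷ 2 ∷ 0 ∷ 2 ∷ []) tt tt refl (λ ()) refl

clash-123 : Clash 3 (2 ∷ 1 ∷ 0 ∷ []) (3 ∷ 3 ∷ 3 ∷ [])
clash-123 = clash-on-numerals 3 _
  (0 ∷ 2 ∷ 1 ∷ 2 ∷ 1 ∷ 2 ∷ [])
  (1 ∷ 2 ∷ 0 ∷ 2 ∷ 1 ∷ 2 ∷ []) tt tt refl (λ ()) refl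

clash-223 : Clash 3 (1 ∷ 1 ∷ 0 ∷ []) (3 ∷ 3 ∷ 3 ∷ [])
clash-223 = clash-on-numerals 3 _
  (0 ∷ 1 ∷ 0 ∷ 2 ∷ 1 ∷ 2 ∷ 2 ∷ [])
  (0 ∷ 2 ∷ 0 ∷ 1 ∷ 1 ∷ 2 ∷ 2 ∷ []) tt tt refl (λ ()) refl

clash-2221 : Clash 2 (0 ∷ 0 ∷ 0 ∷ 0 ∷ []) (2 ∷ 2 ∷ 2 ∷ 1 ∷ [])
clash-2221 = clash-on-numerals 2 _
  (0 ∷ 1 ∷ 0 ∷ 1 ∷ 2 ∷ 2 ∷ 3 ∷ [])
  (0 ∷ 1 ∷ 0 ∷ 2 ∷ 3 ∷ 1 ∷ 2 ∷ []) tt tt refl (λ ()) refl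

clash-1221 : Clash 2 (1 ∷ 0 ∷ 0 ∷ 0 ∷ []) (2 ∷ 2 ∷ 2 ∷ 1 ∷ [])
clash-1221 = clash-on-numerals 2 _
  (1 ∷ 0 ∷ 1 ∷ 2 ∷ 2 ∷ 3 ∷ [])
  (1 ∷ 0 ∷ 2 ∷ 3 ∷ 1 ∷ 2 ∷ []) tt tt refl (λ ()) refl

clash-133 : Clash 3 (2 ∷ 0 ∷ 0 ∷ []) (3 ∷ 3 ∷ 3 ∷ [])
clash-133 = clash-on-numerals 3 _
  (1 ∷ 0 ∷ 2 ∷ 1 ∷ 2 ∷ 1 ∷ 2 ∷ [])
  (1 ∷ 1 ∷ 2 ∷ 0 ∷ 2 ∷ 1 ∷ 2 ∷ []) tt tt refl (λ ()) refl

clash-144 : Clash 4 (3 ∷ 0 ∷ 0 ∷ []) (4 ∷ 4 ∷ 4 ∷ [])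
clash-144 = clash-on-numerals 4 _
  (1 ∷ 0 ∷ 1 ∷ 1 ∷ 2 ∷ 2 ∷ 1 ∷ 2 ∷ 2 ∷ [])
  (1 ∷ 0 ∷ 2 ∷ 1 ∷ 2 ∷ 1 ∷ 1 ∷ 2 ∷ 2 ∷ []) tt tt refl (λ ()) refl

clash-233 : Clash 3 (1 ∷ 0 ∷ 0 ∷ []) (3 ∷ 3 ∷ 3 ∷ [])
clash-233 = clash-on-numerals 3 _
  (0 ∷ 1 ∷ 0 ∷ 2 ∷ 1 ∷ 2 ∷ 1 ∷ 2 ∷ [])
  (0 ∷ 1 ∷ 1 ∷ 2 ∷ 0 ∷ 2 ∷ 1 ∷ 2 ∷ []) tt tt refl (λ ()) refl

clash-244 : Clash 4 (2 ∷ 0 ∷ 0 ∷ []) (4 ∷ 4 ∷ 4 ∷ [])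
clash-244 = clash-on-numerals 4 _
  (0 ∷ 1 ∷ 0 ∷ 1 ∷ 1 ∷ 2 ∷ 2 ∷ 1 ∷ 2 ∷ 2 ∷ [])
  (0 ∷ 1 ∷ 0 ∷ 2 ∷ 1 ∷ 2 ∷ 1 ∷ 1 ∷ 2 ∷ 2 ∷ []) tt tt refl (λ ()) refl

clash-1222 : Clash 2 (1 ∷ 0 ∷ 0 ∷ 0 ∷ []) (2 ∷ 2 ∷ 2 ∷ 2 ∷ [])
clash-1222 = clash-on-numerals 2 _
  (0 ∷ 1 ∷ 1 ∷ 2 ∷ 3 ∷ 2 ∷ 3 ∷ [])
  (1 ∷ 2 ∷ 0 ∷ 1 ∷ 3 ∷ 2 ∷ 3 ∷ []) tt tt refl (λ ()) refl

clash-22222 : Clash 2 (0 ∷ 0 ∷ 0 ∷ 0 ∷ 0 ∷ []) (2 ∷ 2 ∷ 2 ∷ 2 ∷ 2 ∷ [])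
clash-22222 = clash-on-numerals 2 _
  (0 ∷ 1 ∷ 0 ∷ 1 ∷ 2 ∷ 2 ∷ 3 ∷ 4 ∷ 3 ∷ 4 ∷ [])
  (0 ∷ 1 ∷ 0 ∷ 2 ∷ 3 ∷ 1 ∷ 2 ∷ 4 ∷ 3 ∷ 4 ∷ []) tt tt refl (λ ()) refl

-- Parametric clashes

ascentsFrom-fall : ∀ {x y z} k v → x ≤ y → (y <ᵇ z) ≡ (x <ᵇ z) →
                   ascentsFrom y (replicate k x ++ z ∷ v) ≡ replicate k false ++ (x <ᵇ z) ∷ ascentsFrom z v
ascentsFrom-fall {x} {y} {z} zero    v x≤y eq = cong (_∷ ascentsFrom z v) eq
ascentsFrom-fall {x} {y} {z} (suc k) v x≤y eq =
  cong₂ _∷_ (≥⇒<ᵇ-false x≤y) (ascentsFrom-replicate x k (z ∷ v))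

replicate-∷ : ∀ {X : Set} k {x : X} v → replicate k x ++ x ∷ v ≡ x ∷ replicate k x ++ v
replicate-∷ zero    v = refl
replicate-∷ (suc k) v = cong (_ ∷_) (replicate-∷ k v)

-- The words 0^(p+2) 1^(q+2) and 1 0^(p+1) 1^(q+1) 0 both have one ascent, after p + 2 letters. The
-- second is a path because the lower row starts further left and ends before the last box of the
-- upper one.
¬GoodRows-crossing : ∀ a c p q → c < a → suc (suc (q + c)) < suc (suc (p + a)) →
                     ¬ GoodRows (bar a (suc p) ∷ bar c (suc q) ∷ [])
¬GoodRows-crossing a c p q c<a d<e good = distinct (good π π′ same)
  where
  w w′ : List ℕ
  w  = replicate (2 + p) 0 ++ replicate (2 + q) 1
  w′ = 1 ∷ replicate (1 + p) 0 ++ replicate (1 + q) 1 ++ 0 ∷ []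
  π : Path (2 + (p + a)) (a ∷ c ∷ []) w (2 + (p + a) ∷ 2 + (q + c) ∷ [])
  π = run₀ (2 + p) refl ≤-refl ▷ run₁ (2 + q) refl (ℕ.<⇒≤ d<e)
  π′ : Path (2 + (p + a)) (a ∷ c ∷ []) w′ (2 + (p + a) ∷ 2 + (q + c) ∷ [])
  π′ = there (here c<a) ∷ (run₀ (1 + p) refl (ℕ.n≤1+n _) ▷
       (run₁ (1 + q) (cong suc (+-suc q c)) (ℕ.≤-pred d<e) ▷ here ≤-refl ∷ []))
  distinct : w ≢ w′
  distinct ()
  same : ascents w ≡ ascents w′
  same = begin
    ascentsFrom 0 (replicate (1 + p) 0 ++ 1 ∷ replicate (1 + q) 1)
      ≡⟨ ascentsFrom-replicate 0 (1 + p) _ ⟩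
    replicate (1 + p) false ++ true ∷ ascentsFrom 1 (replicate (1 + q) 1)
      ≡⟨ cong (λ v → replicate (1 + p) false ++ true ∷ ascentsFrom 1 v) (List.++-identityʳ (replicate (1 + q) 1)) ⟨
    replicate (1 + p) false ++ true ∷ ascentsFrom 1 (replicate (1 + q) 1 ++ [])
      ≡⟨ cong (λ v → replicate (1 + p) false ++ true ∷ v) (ascentsFrom-replicate 1 (1 + q) []) ⟩
    replicate (1 + p) false ++ true ∷ false ∷ replicate q false ++ []
      ≡⟨ cong (λ v → replicate (1 + p) false ++ true ∷ v) (replicate-∷ q []) ⟨
    replicate (1 + p) false ++ true ∷ replicate q false ++ false ∷ []
      ≡⟨ cong (λ v → replicate (1 + p) false ++ true ∷ v) (ascentsFrom-replicate 1 q (0 ∷ [])) ⟨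
    replicate (1 + p) false ++ true ∷ ascentsFrom 1 (replicate q 1 ++ 0 ∷ [])
      ≡⟨ cong (false ∷_) (ascentsFrom-replicate 0 p (1 ∷ replicate q 1 ++ 0 ∷ [])) ⟨
    ascentsFrom 1 (replicate (1 + p) 0 ++ 1 ∷ replicate q 1 ++ 0 ∷ []) ∎
    where open ≡-Reasoning

-- The words 0^(p+1) 1^(q+2) 2 and 1 0^p 2 1^q 0 1 both have their ascents after p + 1 and after p +
-- q + 3 letters.
¬GoodRows-zigzag : ∀ a c g p q → c < a → g ≤ c → suc q + c ≤ p + a →
                   ¬ GoodRows (bar a p ∷ bar c (suc q) ∷ bar g 0 ∷ [])
¬GoodRows-zigzag a c g p q c<a g≤c d≤e good = distinct (good π π′ same)
  where
  w w′ : List ℕ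
  w  = replicate (1 + p) 0 ++ replicate (2 + q) 1 ++ 2 ∷ []
  w′ = 1 ∷ replicate p 0 ++ 2 ∷ replicate q 1 ++ 0 ∷ 1 ∷ []
  π : Path (1 + (p + a)) (a ∷ c ∷ g ∷ []) w (1 + (p + a) ∷ 2 + (q + c) ∷ 1 + g ∷ [])
  π = run₀ (1 + p) refl ≤-refl ▷ (run₁ (2 + q) refl (s≤s d≤e) ▷
      there (there (here (s≤s (≤-trans g≤c (ℕ.m≤n+m c (suc q)))))) ∷ [])
  π′ : Path (1 + (p + a)) (a ∷ c ∷ g ∷ []) w′ (1 + (p + a) ∷ 2 + (q + c) ∷ 1 + g ∷ [])
  π′ = there (here c<a) ∷ (run₀ p refl (ℕ.n≤1+n _) ▷
       there (there (here (s≤s g≤c))) ∷ (run₁ q (+-suc q c) d≤e ▷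
       here ≤-refl ∷ there (here (s≤s d≤e)) ∷ []))
  distinct : w ≢ w′
  distinct ()
  same : ascents w ≡ ascents w′
  same = begin
    ascentsFrom 0 (replicate p 0 ++ 1 ∷ replicate (1 + q) 1 ++ 2 ∷ [])
      ≡⟨ ascentsFrom-replicate 0 p _ ⟩
    replicate p false ++ true ∷ ascentsFrom 1 (replicate (1 + q) 1 ++ 2 ∷ [])
      ≡⟨ cong (λ v → replicate p false ++ true ∷ v) (ascentsFrom-replicate 1 (1 + q) (2 ∷ [])) ⟩
    replicate p false ++ true ∷ false ∷ replicate q false ++ true ∷ []
      ≡⟨ cong (λ v → replicate p false ++ true ∷ v) (replicate-∷ q (true ∷ [])) ⟨
    replicate p false ++ true ∷ replicate q false ++ false ∷ true ∷ []
      ≡⟨ cong (λ v → replicate p false ++ true ∷ v) (ascentsFrom-fall {y = 2} q (1 ∷ []) (s≤s z≤n) refl) ⟨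
    replicate p false ++ true ∷ ascentsFrom 2 (replicate q 1 ++ 0 ∷ 1 ∷ [])
      ≡⟨ ascentsFrom-fall {y = 1} p (replicate q 1 ++ 0 ∷ 1 ∷ []) z≤n refl ⟨
    ascentsFrom 1 (replicate p 0 ++ 2 ∷ replicate q 1 ++ 0 ∷ 1 ∷ []) ∎
    where open ≡-Reasoning

-- Words that run down a column of single boxes

seq : ℕ → ℕ → List ℕ
seq j zero    = []
seq j (suc k) = j ∷ seq (suc j) k

map-suc-seq : ∀ j k → map suc (seq j k) ≡ seq (suc j) k
map-suc-seq j zero    = refl
map-suc-seq j (suc k) = cong (suc j ∷_) (map-suc-seq (suc j) k)

ascentsFrom-seq : ∀ j k v → ascentsFrom j (seq (suc j) k ++ v) ≡ replicate k true ++ ascentsFrom (k + j) v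
ascentsFrom-seq j zero    v = refl
ascentsFrom-seq j (suc k) v =
  cong₂ _∷_ (n<ᵇ1+m+n 0 j) (trans (ascentsFrom-seq (suc j) k v) (cong (λ i → replicate k true ++ ascentsFrom i v) (+-suc k j)))

column-path : ∀ {b c σ} k → c < b → Path b (replicate k c ++ σ) (seq 0 k) (replicate k (suc c) ++ σ)
column-path         zero    c<b = []
column-path {b} {c} {σ} (suc k) c<b = here c<b ∷
  subst (λ w → Path b (suc c ∷ replicate k c ++ σ) w (suc c ∷ replicate k (suc c) ++ σ)) (map-suc-seq 0 k)
    (below (column-path k ≤-refl))

below-column : ∀ {b c σ w τ} k → c ≤ b → Path c σ w τ → Path b (replicate k c ++ σ) (map (_+ k) w) (replicate k c ++ τ)
below-column {b} {c} {σ} {w} {τ} zero c≤b π =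
  subst (λ v → Path b σ v τ) (sym (trans (List.map-cong +-identityʳ w) (List.map-id w))) (path-≤ c≤b π)
below-column {b} {c} {σ} {w} {τ} (suc k) c≤b π =
  subst (λ v → Path b (replicate (suc k) c ++ σ) v (replicate (suc k) c ++ τ))
    (trans (sym (List.map-∘ w)) (List.map-cong (λ i → sym (+-suc i k)) w))
    (below (below-column k ≤-refl π))

n<ᵇ1+n : ∀ n → (n <ᵇ suc n) ≡ true
n<ᵇ1+n = n<ᵇ1+m+n 0

n<ᵇ2+n : ∀ n → (n <ᵇ suc (suc n)) ≡ true
n<ᵇ2+n = n<ᵇ1+m+n 1

1+n≮ᵇn : ∀ n → (suc n <ᵇ n) ≡ false
1+n≮ᵇn zero    = refl
1+n≮ᵇn (suc n) = 1+n≮ᵇn n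

-- A row [a,e), a column of k + 1 cells below its left end or further left, and a last row [g,f)
-- that starts left of the column and reaches at most below it.
module _ (a c g f e k : ℕ) (c≤a : c ≤ a) (g<c : g < c) (g<f : g < f) (f≤1+c : f ≤ suc c) (a<e : a < e)
         (good : Good e (a ∷ replicate (suc k) c ++ g ∷ []) (e ∷ replicate (suc k) (suc c) ++ f ∷ [])) where

  private
    -- With the first row numbered 0, `K` is the row of the lowest cell of the column and `X` is the
    -- last row.
    X K : ℕ
    X = suc (suc k)
    K = suc k

    -- The lowest cell of the column is kept apart from the `k` cells above it, because the clashing
    -- words differ in how `K`, `X` and 0 are placed around the run 1 ... k.
    state : ℕ → ℕ → ℕ → ℕ → List ℕ
    state x y z t = x ∷ replicate k y ++ z ∷ t ∷ []

    column : ∀ {b x z t} → c < x → Path b (state x c z t) (seq 1 k) (state x (suc c) z t)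
    column {b} {x} {z} {t} c<x = subst (λ w → Path b (state x c z t) w (state x (suc c) z t)) (map-suc-seq 0 k)
      (below (column-path k c<x))

    last-two : ∀ {b x y z t w z′ t′} → y ≤ x → Path y (z ∷ t ∷ []) w (z′ ∷ t′ ∷ []) →
               Path b (state x y z t) (map suc (map (_+ k) w)) (state x y z′ t′)
    last-two y≤x π = below (below-column k y≤x π)

    -- The last row shortened to at most two boxes and the first row to at most h boxes.
    good′ : ∀ g′ {x} → suc c ≤ x → x ≤ e → g ≤ g′ → g′ < c → g′ < f → Good x (state a c c g′) (state x (suc c) (suc c) f)
    good′ g′ {x} c<x x≤e g≤g′ g′<c g′<f = shorten (ℕ.m≤n⇒m<n∨m≡n x≤e)
      where
      rows≡ : length (state a c c g) ≡ suc X
      rows≡ = cong suc (trans (List.length-++ (replicate k c)) (trans (cong (_+ 2) (List.length-replicate k)) (+-comm k 2)))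
      states≡ : ∀ {y z} → replicate (suc k) z ++ y ∷ [] ≡ replicate k z ++ z ∷ y ∷ []
      states≡ {y} {z} = sym (replicate-∷ k (y ∷ []))
      good-g : Good e (state a c c g) (state e (suc c) (suc c) f)
      good-g = subst₂ (λ ps qs → Good e (a ∷ ps) (e ∷ qs)) states≡ states≡ good
      last-X : ∀ t → lastFrom X (map suc (map (_+ k) (replicate t 1))) ≡ X
      last-X zero    = refl
      last-X (suc t) = last-X t
      good-g′ : Good e (state a c c g′) (state e (suc c) (suc c) f)
      good-g′ = Good-prefix rows≡
        (last-two c≤a (run₁ (g′ ∸ g) (ℕ.m∸n+n≡m g≤g′) (ℕ.<⇒≤ g′<c))) (last-X (g′ ∸ g)) good-g
      skew : ∀ k → Skew e (replicate k (suc c) ++ suc c ∷ f ∷ []) (replicate k (suc c) ++ suc c ∷ f ∷ [])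
      skew k = go e k (≤-trans c<x x≤e)
        where
        go : ∀ b k → suc c ≤ b → Skew b (replicate k (suc c) ++ suc c ∷ f ∷ []) (replicate k (suc c) ++ suc c ∷ f ∷ [])
        go b zero    c<b = (≤-refl , c<b) ∷ (≤-refl , f≤1+c) ∷ []
        go b (suc k) c<b = (≤-refl , c<b) ∷ go (suc c) k ≤-refl
      shorten : x < e ⊎ x ≡ e → Good x (state a c c g′) (state x (suc c) (suc c) f)
      shorten (inj₂ refl) = good-g′
      shorten (inj₁ x<e)  = Good-top (skew k) x<e good-g′

    ascents-column : ∀ v → ascentsFrom 0 (seq 1 k ++ v) ≡ replicate k true ++ ascentsFrom k v
    ascents-column v = trans (ascentsFrom-seq 0 k v) (cong (λ i → replicate k true ++ ascentsFrom i v) (+-identityʳ k))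

    up : ∀ β → replicate k true ++ true ∷ β ≡ true ∷ replicate k true ++ β
    up = replicate-∷ k

    KX0 : ∀ v → ascents (seq 1 k ++ K ∷ X ∷ 0 ∷ v) ≡ replicate k true ++ true ∷ false ∷ ascentsFrom 0 v
    KX0 v rewrite ascents-drop (seq 1 k ++ K ∷ X ∷ 0 ∷ v) | ascents-column (K ∷ X ∷ 0 ∷ v) | n<ᵇ1+n k =
      cong (drop 1) (up (true ∷ false ∷ ascentsFrom 0 v))

    0XK : ∀ v → ascents (0 ∷ seq 1 k ++ X ∷ K ∷ v) ≡ replicate k true ++ true ∷ false ∷ ascentsFrom K v
    0XK v rewrite ascents-column (X ∷ K ∷ v) | n<ᵇ2+n k | 1+n≮ᵇn k = refl

    K0 : ∀ v → ascentsFrom 0 (seq 1 k ++ K ∷ 0 ∷ v) ≡ replicate k true ++ true ∷ false ∷ ascentsFrom 0 v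
    K0 v rewrite ascents-column (K ∷ 0 ∷ v) | n<ᵇ1+n k = refl

    X0 : ∀ v → ascentsFrom 0 (seq 1 k ++ X ∷ 0 ∷ v) ≡ replicate k true ++ true ∷ false ∷ ascentsFrom 0 v
    X0 v rewrite ascents-column (X ∷ 0 ∷ v) | n<ᵇ2+n k = refl

    KX≡0K : ascentsFrom K (X ∷ []) ≡ ascentsFrom 0 (X ∷ [])
    KX≡0K = cong (_∷ []) (n<ᵇ1+n k)

    differ : ∀ {x y u v} k → x ≢ y → seq 1 k ++ x ∷ u ≢ seq 1 k ++ y ∷ v
    differ {x} {y} k x≢y eq = x≢y (List.∷-injectiveˡ (List.++-cancelˡ (seq 1 k) _ _ eq))

    0-differ : ∀ {x u v} k → 0 ∷ u ≢ seq 1 k ++ suc x ∷ v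
    0-differ zero    ()
    0-differ (suc k) ()

    -- The words 1 ... k K X 0 and 0 1 ... k X K: k + 1 ascents and then a non-ascent in both. The
    -- column can be read before the first row because it lies strictly left of it.
    right₁ : c < a → ¬ Good (suc a) (state a c c g) (state (suc a) (suc c) (suc c) (suc g))
    right₁ c<a good₁ = 0-differ k (sym (good₁ π π′ (trans (KX0 []) (sym (0XK [])))))
      where
      π  = column c<a ▷ last-two {w = 0 ∷ 1 ∷ []} c<a (here ≤-refl ∷ there (here (ℕ.m<n⇒m<1+n g<c)) ∷ []) ▷ here ≤-refl ∷ []
      π′ = here ≤-refl ∷ (column (s≤s c≤a) ▷ last-two {w = 1 ∷ 0 ∷ []} (s≤s c≤a) (there (here g<c) ∷ here ≤-refl ∷ []))

    -- The words of `right₁` with `X` appended for the second box of the last row; it is an ascent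
    -- both after 0 and after `K`.
    right₂ : ∀ g′ → g′ < c → c < a → ¬ Good (suc a) (state a c c g′) (state (suc a) (suc c) (suc c) (2 + g′))
    right₂ g′ g′<c c<a good₂ = 0-differ k (sym (good₂ π π′ (trans (KX0 (X ∷ [])) (trans
        (cong (λ β → replicate k true ++ true ∷ false ∷ β) (sym KX≡0K)) (sym (0XK (X ∷ [])))))))
      where
      π  = column c<a ▷ last-two {w = 0 ∷ 1 ∷ []} c<a (here ≤-refl ∷ there (here (ℕ.m<n⇒m<1+n g′<c)) ∷ []) ▷
           here ≤-refl ∷ last-two {w = 1 ∷ []} (s≤s c≤a) (there (here (s≤s g′<c)) ∷ [])
      π′ = here ≤-refl ∷ (column (s≤s c≤a) ▷ last-two {w = 1 ∷ 0 ∷ 1 ∷ []} (s≤s c≤a)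
           (there (here g′<c) ∷ here ≤-refl ∷ there (here (s≤s g′<c)) ∷ []))

    -- The words 0 1 ... k K 0 X and 0 1 ... k X 0 K; the second box of the first row supplies the 0
    -- that separates `K` from `X`.
    corner₁ : ¬ Good (2 + a) (state a c c g) (state (2 + a) (suc c) (suc c) (suc g))
    corner₁ good₁ = differ k ℕ.1+n≢n (List.∷-injectiveʳ (good₁ π′ π (trans (X0 (K ∷ [])) (sym (K0 (X ∷ []))))))
      where
      c<2+a = ℕ.m<n⇒m<1+n (s≤s c≤a)
      π  = here (ℕ.n≤1+n _) ∷ (column (s≤s c≤a) ▷ last-two {w = 0 ∷ []} (s≤s c≤a) (here ≤-refl ∷ []) ▷
           here ≤-refl ∷ last-two {w = 1 ∷ []} c<2+a (there (here (ℕ.m<n⇒m<1+n g<c)) ∷ []))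
      π′ = here (ℕ.n≤1+n _) ∷ (column (s≤s c≤a) ▷ last-two {w = 1 ∷ []} (s≤s c≤a) (there (here g<c) ∷ []) ▷
           here ≤-refl ∷ last-two {w = 0 ∷ []} c<2+a (here ≤-refl ∷ []))

    -- The words X 0 1 ... k K 0 X and 0 0 1 ... k X K X: a non-ascent, k + 1 ascents, a non-ascent
    -- and an ascent in both.
    corner₂ : ∀ g′ → g′ < c → ¬ Good (2 + a) (state a c c g′) (state (2 + a) (suc c) (suc c) (2 + g′))
    corner₂ g′ g′<c good₂ = ℕ.1+n≢0 (List.∷-injectiveˡ (good₂ π π′ (cong (false ∷_) (trans (K0 (X ∷ []))
        (trans (cong (λ β → replicate k true ++ true ∷ false ∷ β) (sym KX≡0K)) (sym (0XK (X ∷ []))))))))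
      where
      c<2+a = ℕ.m<n⇒m<1+n (s≤s c≤a)
      π  = last-two {w = 1 ∷ []} c≤a (there (here g′<c) ∷ []) ▷ here (ℕ.n≤1+n _) ∷ (column (s≤s c≤a) ▷
           last-two {w = 0 ∷ []} (s≤s c≤a) (here ≤-refl ∷ []) ▷ here ≤-refl ∷
           last-two {w = 1 ∷ []} c<2+a (there (here (s≤s g′<c)) ∷ []))
      π′ = here (ℕ.n≤1+n _) ∷ here ≤-refl ∷ (column c<2+a ▷ last-two {w = 1 ∷ 0 ∷ 1 ∷ []} c<2+a
           (there (here g′<c) ∷ here ≤-refl ∷ there (here (s≤s g′<c)) ∷ []))

    last-row : suc g ≡ f ⊎ ∃[ g′ ] 2 + g′ ≡ f × g ≤ g′ × g′ < c
    last-row with ℕ.m≤n⇒m<n∨m≡n g<f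
    ... | inj₂ eq  = inj₁ eq
    ... | inj₁ g<f = inj₂ (f ∸ 2 , f≡ , ℕ.∸-monoˡ-≤ 2 g<f , ℕ.≤-pred (ℕ.≤-trans (ℕ.≤-reflexive f≡) f≤1+c))
      where
      f≡ : 2 + (f ∸ 2) ≡ f
      f≡ = ℕ.m+[n∸m]≡n (ℕ.≤-trans (s≤s (s≤s z≤n)) g<f)

  ¬bend-right : ¬ c < a
  ¬bend-right c<a with last-row
  ... | inj₁ eq = right₁ c<a (subst (λ t → Good (suc a) (state a c c g) (state (suc a) (suc c) (suc c) t)) (sym eq)
                    (good′ g (s≤s c≤a) a<e ≤-refl g<c g<f))
  ... | inj₂ (g′ , eq , g≤g′ , g′<c) = right₂ g′ g′<c c<a
    (subst (λ t → Good (suc a) (state a c c g′) (state (suc a) (suc c) (suc c) t)) (sym eq)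
      (good′ g′ (s≤s c≤a) a<e g≤g′ g′<c (ℕ.≤-trans (ℕ.n≤1+n _) (ℕ.≤-reflexive eq))))

  ¬bend-corner : ¬ suc a < e
  ¬bend-corner a+2≤e with last-row
  ... | inj₁ eq = corner₁ (subst (λ t → Good (2 + a) (state a c c g) (state (2 + a) (suc c) (suc c) t)) (sym eq)
                    (good′ g (ℕ.m<n⇒m<1+n (s≤s c≤a)) a+2≤e ≤-refl g<c g<f))
  ... | inj₂ (g′ , eq , g≤g′ , g′<c) = corner₂ g′ g′<c
    (subst (λ t → Good (2 + a) (state a c c g′) (state (2 + a) (suc c) (suc c) t)) (sym eq)
      (good′ g′ (ℕ.m<n⇒m<1+n (s≤s c≤a)) a+2≤e g≤g′ g′<c (ℕ.≤-trans (ℕ.n≤1+n _) (ℕ.≤-reflexive eq))))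

-- The good shapes, without empty rows; c is the first column of the bottom row

data Pattern : List Row → Set where
  hook    : ∀ c m k → Pattern (bar c m ∷ cells c k)
  hook°   : ∀ c m k → Pattern (cells (suc m + c) (suc k) ++ bar c (suc m) ∷ [])
  disjoint  : ∀ c a m k → c < a → Pattern (bar a m ∷ cells c (suc k))
  disjoint° : ∀ c a m k → m + c < a → Pattern (cells a (suc k) ++ bar c m ∷ [])
  2-row   : ∀ c m → Pattern (bar c (suc m) ∷ bar c 1 ∷ [])
  2-row°  : ∀ c m → Pattern (bar (suc m + c) 1 ∷ bar c (2 + m) ∷ [])
  2-col   : ∀ c k → Pattern (bar c 1 ∷ bar c 1 ∷ cells c (suc k))
  2-col°  : ∀ c k → Pattern (cells (suc c) (suc k) ++ bar c 1 ∷ bar c 1 ∷ [])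
  3-3     : ∀ c → Pattern (bar c 2 ∷ bar c 2 ∷ [])
  4-4     : ∀ c → Pattern (bar c 3 ∷ bar c 3 ∷ [])
  2-2-2   : ∀ c → Pattern (bar c 1 ∷ bar c 1 ∷ bar c 1 ∷ [])
  2-2-2-2 : ∀ c → Pattern (bar c 1 ∷ bar c 1 ∷ bar c 1 ∷ bar c 1 ∷ [])

offset : ∀ {α β a e c d rs} → Rows α β ((a , e) ∷ (c , d) ∷ rs) →
         ∃₂ λ x p → a ≡ x + c × e ≡ suc (p + a) × d ≤ e
offset {a = a} {e} {c} (cons a<e _ _ (cons _ c≤a d≤e _)) =
  a ∸ c , e ∸ suc a , sym (ℕ.m∸n+n≡m c≤a) , sym (trans (sym (+-suc _ a)) (ℕ.m∸n+n≡m a<e)) , d≤e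

-- The pair is (4,3) itself or has a longer first row, in which case both rows can be cut down to
-- (4,3).
¬left-aligned : ∀ c m p → m < p → ¬ GoodRows (bar c (2 + p) ∷ bar c (2 + m) ∷ [])
¬left-aligned c zero    (suc zero)    _         good = refute {ts = c ∷ c ∷ []} clash-43 (≤-refl ∷ ≤-refl ∷ []) refl good
¬left-aligned c (suc m) (suc zero)    (s≤s ()) good
¬left-aligned c m       (suc (suc p)) m<p       good = refute {ts = c ∷ c ∷ []} clash-43 (≤-refl ∷ ≤-refl ∷ []) refl
  (Good-top ((ℕ.+-monoʳ-≤ 3 (ℕ.m≤n+m c m) , ℕ.+-monoʳ-≤ 3 (ℕ.+-monoˡ-≤ c (ℕ.<⇒≤ m<p))) ∷ [])
            (ℕ.+-monoʳ-≤ 5 (ℕ.m≤n+m c p)) good)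

¬5-5 : ∀ c m → ¬ GoodRows (bar c (4 + m) ∷ bar c (4 + m) ∷ [])
¬5-5 c zero    good = refute {ts = c ∷ c ∷ []} clash-55 (≤-refl ∷ ≤-refl ∷ []) refl good
¬5-5 c (suc m) good = refute {ts = c ∷ c ∷ []} clash-55 (≤-refl ∷ ≤-refl ∷ []) refl
  (Good-top ((ℕ.+-monoʳ-≤ 5 (ℕ.m≤n+m c (suc m)) , ≤-refl) ∷ []) (ℕ.+-monoʳ-≤ 6 (ℕ.m≤n+m c m)) good)

lastFrom-replicate : ∀ x k → lastFrom x (replicate k x) ≡ x
lastFrom-replicate x zero    = refl
lastFrom-replicate x (suc k) = lastFrom-replicate x k

-- The first `x` boxes of the lower row are removed as a prefix ending in the bottom row, which
-- leaves an overhang of one column; then both right ends are cut to reach `clash-34`.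
¬right-aligned : ∀ c x p → let e = suc (2 + p + (suc x + c)) in ¬ Good e (suc x + c ∷ c ∷ []) (e ∷ e ∷ [])
¬right-aligned c x p good = narrow p (Good-prefix {z = 1} refl (run₁ x refl (ℕ.n≤1+n _)) (lastFrom-replicate 1 x) good)
  where
  narrow : ∀ p → let e = suc (2 + p + (suc x + c)) in ¬ Good e (suc x + c ∷ x + c ∷ []) (e ∷ e ∷ [])
  narrow zero    good = refute {ts = x + c ∷ x + c ∷ []} clash-34 (≤-refl ∷ ≤-refl ∷ []) refl good
  narrow (suc p) good = refute {ts = x + c ∷ x + c ∷ []} clash-34 (≤-refl ∷ ≤-refl ∷ []) refl
    (Good-top ((ℕ.≤-trans (ℕ.n≤1+n _) 5+x+c≤e , ≤-refl) ∷ []) 5+x+c≤e good)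
    where
    5+x+c≤e : 5 + (x + c) ≤ suc (2 + suc p + (suc x + c))
    5+x+c≤e = ℕ.+-monoʳ-≤ 4 (ℕ.m≤n+m (suc (x + c)) p)

two-rows-left : ∀ c m p → m ≤ p → GoodRows (bar c p ∷ bar c m ∷ []) → Pattern (bar c p ∷ bar c m ∷ [])
two-rows-left c zero                 p                   _    _    = hook c p 1
two-rows-left c (suc zero)           (suc p)             _    _    = 2-row c p
two-rows-left c (suc (suc m))        (suc (suc p))       (s≤s (s≤s m≤p)) good with ℕ.m≤n⇒m<n∨m≡n m≤p
... | inj₁ m<p = ⊥-elim (¬left-aligned c m p m<p good)
two-rows-left c (suc (suc zero))           _ _ good | inj₂ refl = 3-3 c
two-rows-left c (suc (suc (suc zero)))     _ _ good | inj₂ refl = 4-4 c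
two-rows-left c (suc (suc (suc (suc m))))  _ _ good | inj₂ refl = ⊥-elim (¬5-5 c m good)

-- A second row that starts further left and ends no further right than the first.
crossing : ∀ c m x p → suc m + c ≤ p + (suc x + c) → GoodRows (bar (suc x + c) p ∷ bar c (suc m) ∷ []) →
           p ≡ 0 ⊎ ∃[ p′ ] p ≡ suc p′ × m ≡ p′ + suc x
crossing c m x zero    _   good = inj₁ refl
crossing c m x (suc p) d≤e good with ℕ.m≤n⇒m<n∨m≡n d≤e
... | inj₁ d<e = ⊥-elim (¬GoodRows-crossing (suc x + c) c p m (s≤s (ℕ.m≤n+m c x)) (s≤s d<e) good)
... | inj₂ d≡e = inj₂ (p , refl , ℕ.+-cancelʳ-≡ c m (p + suc x) (trans (ℕ.suc-injective d≡e) (sym (+-assoc p (suc x) c))))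

¬aligned-ends : ∀ c x p → ¬ GoodRows (bar (suc x + c) (2 + p) ∷ bar c (suc (suc p + suc x)) ∷ [])
¬aligned-ends c x p good = ¬right-aligned c x p
  (subst (λ d → Good (suc (2 + p + (suc x + c))) (suc x + c ∷ c ∷ []) (suc (2 + p + (suc x + c)) ∷ d ∷ []))
    (cong (3 +_) (+-assoc p (suc x) c)) good)

two-rows : ∀ c m x p → m + c ≤ p + (x + c) → GoodRows (bar (x + c) p ∷ bar c m ∷ []) →
           Pattern (bar (x + c) p ∷ bar c m ∷ [])
two-rows c m       zero    p d≤e good = two-rows-left c m p (ℕ.+-cancelʳ-≤ c m p d≤e) good
two-rows c zero    (suc x) p d≤e good = disjoint c (suc x + c) p 0 (s≤s (ℕ.m≤n+m c x))
two-rows c (suc m) (suc x) p d≤e good with crossing c m x p d≤e good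
... | inj₂ (zero  , refl , refl) = 2-row° c x
... | inj₂ (suc p , refl , refl) = ⊥-elim (¬aligned-ends c x p good)
... | inj₁ refl with ℕ.m≤n⇒m<n∨m≡n d≤e
...   | inj₁ d<e = disjoint° c (suc x + c) (suc m) 0 d<e
...   | inj₂ d≡e with ℕ.+-cancelʳ-≡ c m x (ℕ.suc-injective d≡e)
...     | refl = hook° c m 0

-- A top row of more than three boxes can be cut together with the others to (3,2,1). A top row of
-- exactly three boxes cannot be cut, so the five possibilities for the rows below it have clashes
-- of their own.
¬three-left : ∀ c p q s → q ≤ suc p → s ≤ suc q → ¬ GoodRows (bar c (2 + p) ∷ bar c (suc q) ∷ bar c s ∷ [])
¬three-left c zero    zero          zero          _ _ good = refute {ts = c ∷ c ∷ c ∷ []} clash-321 (≤-refl ∷ ≤-refl ∷ ≤-refl ∷ []) refl good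
¬three-left c zero    zero          (suc zero)    _ _ good = refute {ts = c ∷ c ∷ c ∷ []} clash-322 (≤-refl ∷ ≤-refl ∷ ≤-refl ∷ []) refl good
¬three-left c zero    (suc zero)    zero          _ _ good = refute {ts = c ∷ c ∷ c ∷ []} clash-331 (≤-refl ∷ ≤-refl ∷ ≤-refl ∷ []) refl good
¬three-left c zero    (suc zero)    (suc zero)    _ _ good = refute {ts = c ∷ c ∷ c ∷ []} clash-332 (≤-refl ∷ ≤-refl ∷ ≤-refl ∷ []) refl good
¬three-left c zero    (suc zero)    (suc (suc zero)) _ _ good = refute {ts = c ∷ c ∷ c ∷ []} clash-333 (≤-refl ∷ ≤-refl ∷ ≤-refl ∷ []) refl good
¬three-left c zero    zero          (suc (suc s)) _ (s≤s ()) good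
¬three-left c zero    (suc zero)    (suc (suc (suc s))) _ (s≤s (s≤s ())) good
¬three-left c zero    (suc (suc q)) s             (s≤s ()) _ good
¬three-left c (suc p) q             s             q≤ s≤ good =
  refute {ts = c ∷ c ∷ c ∷ []} clash-321 (≤-refl ∷ ≤-refl ∷ ≤-refl ∷ []) refl
    (Good-top ((ℕ.+-monoʳ-≤ 2 (ℕ.m≤n+m c q) , ℕ.+-monoʳ-≤ 2 (ℕ.+-monoˡ-≤ c q≤))
              ∷ (ℕ.+-monoʳ-≤ 1 (ℕ.m≤n+m c s) , ℕ.+-monoʳ-≤ 1 (ℕ.+-monoˡ-≤ c s≤)) ∷ [])
              (ℕ.+-monoʳ-≤ 4 (ℕ.m≤n+m c p)) good)

cells-++ : ∀ {a e} y k g f → GoodRows ((a , e) ∷ cells y k ++ (g , f) ∷ []) →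
           Good e (a ∷ replicate k y ++ g ∷ []) (e ∷ replicate k (suc y) ++ f ∷ [])
cells-++ {a} {e} y k g f = subst₂ (λ ps qs → Good e (a ∷ ps) (e ∷ qs)) (coordinates proj₁) (coordinates proj₂)
  where
  coordinates : (h : Row → ℕ) → map h (cells y k ++ (g , f) ∷ []) ≡ replicate k (h (y , suc y)) ++ h (g , f) ∷ []
  coordinates h = trans (List.map-++ h (cells y k) ((g , f) ∷ [])) (cong (_++ h (g , f) ∷ []) (List.map-replicate h k (y , suc y)))

bend : ∀ {a e y k g f} → y ≤ a → a < e → g < y → g < f → f ≤ suc y →
       GoodRows ((a , e) ∷ cells y (suc k) ++ (g , f) ∷ []) → a ≡ y × e ≡ suc y
bend {a} {e} {y} {k} {g} {f} y≤a a<e g<y g<f f≤1+y good with ℕ.m≤n⇒m<n∨m≡n y≤a | ℕ.m≤n⇒m<n∨m≡n a<e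
... | inj₁ y<a  | _          = contradiction y<a (¬bend-right a y g f e k y≤a g<y g<f f≤1+y a<e (cells-++ y (suc k) g f good))
... | inj₂ refl | inj₁ 1+a<e = contradiction 1+a<e (¬bend-corner a y g f e k y≤a g<y g<f f≤1+y a<e (cells-++ y (suc k) g f good))
... | inj₂ refl | inj₂ 1+a≡e = refl , sym 1+a≡e

run₂ : ∀ {b x y z z′ ps} t → t + z ≡ z′ → z′ ≤ y → Path b (x ∷ y ∷ z ∷ ps) (replicate t 2) (x ∷ y ∷ z′ ∷ ps)
run₂ zero    refl z≤y = []
run₂ {z = z} (suc t) refl z≤y = there (there (here (≤-trans (s≤s (ℕ.m≤n+m z t)) z≤y))) ∷ run₂ t (+-suc t z) z≤y

-- Adding a top row to a good shape

module _ {α β : ℕ} where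

  -- The new row starts `x` columns right of the hook and has p + 1 boxes. A hook with both an arm
  -- and a leg is very restrictive: an offset row gives a zigzag and a left-aligned row of three or
  -- more boxes is excluded by `¬three-left`, which leaves two rows of two boxes above the leg.
  add-to-hook : ∀ c m k x p → Rows α β (bar (x + c) p ∷ bar c m ∷ cells c k) → m + c ≤ p + (x + c) →
                GoodRows (bar (x + c) p ∷ bar c m ∷ cells c k) → Pattern (bar (x + c) p ∷ bar c m ∷ cells c k)
  add-to-hook c m       zero    x       p       rows d≤e good = two-rows c m x p d≤e good
  add-to-hook c zero    (suc k) zero    p       rows d≤e good = hook c p (2 + k)
  add-to-hook c zero    (suc k) (suc x) p       rows d≤e good = disjoint c (suc x + c) p (suc k) (s≤s (ℕ.m≤n+m c x))
  add-to-hook c (suc m) (suc k) (suc x) p       rows d≤e good =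
    ⊥-elim (¬GoodRows-zigzag (suc x + c) c c p m (s≤s (ℕ.m≤n+m c x)) ≤-refl d≤e
      (GoodRows-upper _ (bar c (suc m) ∷ bar c 0 ∷ []) {cells c k} rows good))
  add-to-hook c (suc m) (suc k) zero    p       rows d≤e good with ℕ.+-cancelʳ-≤ c (suc m) p d≤e
  add-to-hook c (suc m) (suc k) zero    (suc (suc p)) rows d≤e good | s≤s m≤1+p =
    ⊥-elim (¬three-left c p m 0 m≤1+p z≤n (GoodRows-upper _ (bar c (suc m) ∷ bar c 0 ∷ []) {cells c k} rows good))
  add-to-hook c (suc zero) (suc k) zero (suc zero)    rows d≤e good | s≤s z≤n = 2-col c k

  ¬three-disjoint : ∀ c b a p → c < b → b < a → ¬ GoodRows (bar a p ∷ bar b 0 ∷ bar c 0 ∷ [])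
  ¬three-disjoint c (suc b) (suc (suc a)) zero    (s≤s c≤b) (s≤s (s≤s b≤a)) good =
    refute {ts = a ∷ b ∷ c ∷ []} clash-1⊕1⊕1 (≤-refl ∷ b≤a ∷ c≤b ∷ []) refl good
  ¬three-disjoint c (suc b) (suc (suc a)) (suc p) (s≤s c≤b) (s≤s (s≤s b≤a)) good =
    refute {ts = a ∷ b ∷ c ∷ []} clash-1⊕1⊕1 (≤-refl ∷ b≤a ∷ c≤b ∷ []) refl
      (Good-top ((≤-refl , ℕ.≤-trans (s≤s (s≤s b≤a)) (ℕ.m≤n+m (2 + a) (2 + p))) ∷ (≤-refl , s≤s (ℕ.m≤n⇒m≤1+n c≤b)) ∷ [])
                (s≤s (s≤s (ℕ.m≤n+m (2 + a) p))) good)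

  ¬two-left-disjoint : ∀ c b p m → c ≤ b → m ≤ suc p → ¬ GoodRows (bar (suc b) (suc p) ∷ bar (suc b) m ∷ bar c 0 ∷ [])
  ¬two-left-disjoint c b zero    zero          c≤b _ good =
    refute {ts = b ∷ b ∷ c ∷ []} clash-1⊕21 (≤-refl ∷ ≤-refl ∷ c≤b ∷ []) refl good
  ¬two-left-disjoint c b zero    (suc zero)    c≤b _ good =
    refute {ts = b ∷ b ∷ c ∷ []} clash-1⊕22 (≤-refl ∷ ≤-refl ∷ c≤b ∷ []) refl good
  ¬two-left-disjoint c b zero    (suc (suc m)) c≤b (s≤s ()) good
  ¬two-left-disjoint c b (suc p) m             c≤b m≤ good =
    refute {ts = b ∷ b ∷ c ∷ []} clash-1⊕21 (≤-refl ∷ ≤-refl ∷ c≤b ∷ []) refl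
      (Good-top ((s≤s (ℕ.m≤n+m (suc b) m) , s≤s (ℕ.+-monoˡ-≤ (suc b) m≤)) ∷ (≤-refl , s≤s (≤-trans c≤b (≤-trans (ℕ.n≤1+n b) (ℕ.m≤n+m (suc b) m)))) ∷ [])
                (ℕ.+-monoʳ-≤ 3 (ℕ.m≤n+m (suc b) p)) good)

  -- An offset row makes three components or a zigzag, and a left-aligned one of at least two boxes
  -- clashes with the column. What remains is a box placed on a box, which is good only if the
  -- column has a single cell.
  add-to-disjoint : ∀ c b m k x p → c < b → Rows α β (bar (x + b) p ∷ bar b m ∷ cells c (suc k)) → m + b ≤ p + (x + b) →
                    GoodRows (bar (x + b) p ∷ bar b m ∷ cells c (suc k)) → Pattern (bar (x + b) p ∷ bar b m ∷ cells c (suc k))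
  add-to-disjoint c b zero    k (suc x) p c<b rows d≤e good =
    ⊥-elim (¬three-disjoint c b (suc x + b) p c<b (s≤s (ℕ.m≤n+m b x)) (GoodRows-upper _ (bar b 0 ∷ bar c 0 ∷ []) {cells c k} rows good))
  add-to-disjoint c b (suc m) k (suc x) p c<b rows d≤e good =
    ⊥-elim (¬GoodRows-zigzag (suc x + b) b c p m (s≤s (ℕ.m≤n+m b x)) (ℕ.<⇒≤ c<b) d≤e
      (GoodRows-upper _ (bar b (suc m) ∷ bar c 0 ∷ []) {cells c k} rows good))
  add-to-disjoint c (suc b) m k zero (suc p) (s≤s c≤b) rows d≤e good =
    ⊥-elim (¬two-left-disjoint c b p m c≤b (ℕ.+-cancelʳ-≤ (suc b) m (suc p) d≤e)
      (GoodRows-upper _ (bar (suc b) m ∷ bar c 0 ∷ []) {cells c k} rows good))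
  add-to-disjoint c b m k zero zero c<b rows d≤e good with ℕ.+-cancelʳ-≤ b m 0 d≤e
  add-to-disjoint c b       zero zero    zero zero c<b       rows d≤e good | z≤n = disjoint° c b 0 1 c<b
  add-to-disjoint c (suc b) zero (suc k) zero zero (s≤s c≤b) rows d≤e good | z≤n =
    ⊥-elim (refute {ts = b ∷ b ∷ c ∷ c ∷ []} clash-11⊕11 (≤-refl ∷ ≤-refl ∷ c≤b ∷ ≤-refl ∷ []) refl
      (GoodRows-upper _ (bar (suc b) 0 ∷ bar c 0 ∷ bar c 0 ∷ []) {cells c k} rows good))

  -- Removing the first box of each of the two lower rows, a prefix ending in the bottom row, leaves
  -- a zigzag.
  ¬2-row-gap : ∀ c m x p → 2 + m + c ≤ p + (2 + x + c) → ¬ GoodRows (bar (2 + x + c) p ∷ bar c (2 + m) ∷ bar c 1 ∷ [])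
  ¬2-row-gap c m x p d≤e good = ¬GoodRows-zigzag (2 + x + c) (suc c) (suc c) p m (s≤s (s≤s (ℕ.m≤n+m c x))) ≤-refl
    (≤-trans (ℕ.≤-reflexive d≡) d≤e)
    (subst (λ d → Good (suc (p + (2 + x + c))) (2 + x + c ∷ suc c ∷ suc c ∷ []) (suc (p + (2 + x + c)) ∷ d ∷ 2 + c ∷ [])) (cong suc (sym d≡))
      (Good-prefix {u = 1 ∷ 2 ∷ []} {z = 2} refl
        (there (here (s≤s (ℕ.m≤n⇒m≤1+n (ℕ.m≤n+m c x)))) ∷ there (there (here ≤-refl)) ∷ []) refl good))
    where
    d≡ : suc m + suc c ≡ 2 + m + c
    d≡ = cong suc (+-suc m c)

  add-to-2-row : ∀ c m x p → Rows α β (bar (x + c) p ∷ bar c (suc m) ∷ bar c 1 ∷ []) → suc m + c ≤ p + (x + c) →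
                 GoodRows (bar (x + c) p ∷ bar c (suc m) ∷ bar c 1 ∷ []) → Pattern (bar (x + c) p ∷ bar c (suc m) ∷ bar c 1 ∷ [])
  add-to-2-row c m zero p rows d≤e good with ℕ.+-cancelʳ-≤ c (suc m) p d≤e
  add-to-2-row c zero zero (suc zero) rows d≤e good | s≤s z≤n = 2-2-2 c
  add-to-2-row c m zero (suc (suc p)) rows d≤e good | s≤s m≤ = ⊥-elim (¬three-left c p m 1 m≤ (s≤s z≤n) good)
  add-to-2-row c m (suc x) p rows d≤e good
    with crossing c m x p d≤e (GoodRows-upper _ (bar c (suc m) ∷ []) {bar c 1 ∷ []} rows good)
  add-to-2-row c .1 (suc zero) .1 rows d≤e good | inj₂ (zero , refl , refl) =
    ⊥-elim (refute {ts = c ∷ c ∷ c ∷ []} clash-232 (≤-refl ∷ ≤-refl ∷ ≤-refl ∷ []) refl good)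
  add-to-2-row c _ (suc zero) _ rows d≤e good | inj₂ (suc p , refl , refl) =
    ⊥-elim (¬aligned-ends c 0 p (GoodRows-upper _ (bar c (suc (suc p + 1)) ∷ []) {bar c 1 ∷ []} rows good))
  add-to-2-row c zero (suc zero) _ rows d≤e good | inj₁ refl = 2-col° c 0
  add-to-2-row c (suc m) (suc zero) _ rows d≤e good | inj₁ refl = contradiction (ℕ.+-cancelʳ-≤ c (suc m) 0 (ℕ.≤-pred d≤e)) λ ()
  add-to-2-row c zero (suc (suc x)) _ rows d≤e good | inj₁ refl =
    ⊥-elim (refute {ts = x + c ∷ c ∷ c ∷ []} clash-22⊕1 (≤-refl ∷ ℕ.m≤n+m c x ∷ ≤-refl ∷ []) refl good)
  add-to-2-row c (suc m) (suc (suc x)) p rows d≤e good | inj₁ _ = ⊥-elim (¬2-row-gap c m x p d≤e good)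
  add-to-2-row c zero (suc (suc x)) _ rows d≤e good | inj₂ (p , _ , m≡) = contradiction (sym m≡) (ℕ.m+1+n≢0 p)
  add-to-2-row c (suc m) (suc (suc x)) p rows d≤e good | inj₂ _ = ⊥-elim (¬2-row-gap c m x p d≤e good)

  ¬1-2-3 : ∀ c a → 2 + c ≤ a → ¬ Good (suc a) (a ∷ suc c ∷ c ∷ []) (suc a ∷ 3 + c ∷ 3 + c ∷ [])
  ¬1-2-3 c (suc (suc a)) (s≤s (s≤s c≤a)) = refute {ts = a ∷ c ∷ c ∷ []} clash-123 (≤-refl ∷ c≤a ∷ ≤-refl ∷ []) refl

  add-to-2-row° : ∀ c m x p → let b = suc m + c in Rows α β (bar (x + b) p ∷ bar b 1 ∷ bar c (2 + m) ∷ []) →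
                  1 + b ≤ p + (x + b) → ¬ GoodRows (bar (x + b) p ∷ bar b 1 ∷ bar c (2 + m) ∷ [])
  add-to-2-row° c m x p rows d≤e good = go x p rows d≤e good
    -- The first `m` boxes of the bottom row are removed, so that it protrudes by exactly one
    -- column, as in the clashes.
    (Good-prefix {z = 2} refl (run₂ m refl (ℕ.n≤1+n _)) (lastFrom-replicate 2 m) good)
    where
    go : ∀ x p → let b = suc m + c ; a = x + b in Rows α β (bar a p ∷ bar b 1 ∷ bar c (2 + m) ∷ []) → 1 + b ≤ p + a →
         GoodRows (bar a p ∷ bar b 1 ∷ bar c (2 + m) ∷ []) →
         ¬ Good (suc (p + a)) (a ∷ b ∷ m + c ∷ []) (suc (p + a) ∷ 2 + b ∷ 3 + (m + c) ∷ [])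
    go zero zero          rows d≤e good _     = ℕ.1+n≰n d≤e
    go zero (suc zero)    rows d≤e good good′ =
      refute {ts = m + c ∷ m + c ∷ m + c ∷ []} clash-223 (≤-refl ∷ ≤-refl ∷ ≤-refl ∷ []) refl good′
    go zero (suc (suc p)) rows d≤e good good′ =
      refute {ts = m + c ∷ m + c ∷ m + c ∷ []} clash-223 (≤-refl ∷ ≤-refl ∷ ≤-refl ∷ []) refl
        (Good-top ((≤-refl , ℕ.≤-trans (ℕ.n≤1+n _) 4≤) ∷ (≤-refl , ≤-refl) ∷ []) 4≤ good′)
      where
      4≤ : 4 + (m + c) ≤ suc (2 + p + (suc m + c))
      4≤ = ℕ.+-monoʳ-≤ 3 (ℕ.m≤n+m (suc m + c) p)
    go (suc x) p rows d≤e good good′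
      with crossing (suc m + c) 0 x p d≤e (GoodRows-upper _ (bar (suc m + c) 1 ∷ []) {bar c (2 + m) ∷ []} rows good)
    ... | inj₂ (p′ , _ , eq) = ℕ.m+1+n≢0 p′ (sym eq)
    ... | inj₁ refl          = ¬1-2-3 (m + c) (suc x + (suc m + c)) (s≤s (ℕ.m≤n+m (suc m + c) x)) good′

  -- Here the second row has two boxes, so the first row has only one unless it starts in the same column.
  one-box : ∀ c x p {rs} → Rows α β (bar (suc x + c) p ∷ bar c 1 ∷ rs) → 1 + c ≤ p + (suc x + c) →
            GoodRows (bar (suc x + c) p ∷ bar c 1 ∷ rs) → p ≡ 0
  one-box c x p rows d≤e good with crossing c 0 x p d≤e (GoodRows-upper _ (bar c 1 ∷ []) rows good)
  ... | inj₁ p≡0           = p≡0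
  ... | inj₂ (p′ , _ , eq) = contradiction (sym eq) (ℕ.m+1+n≢0 p′)

  add-to-2-col : ∀ c k x p → Rows α β (bar (x + c) p ∷ bar c 1 ∷ bar c 1 ∷ cells c (suc k)) → 1 + c ≤ p + (x + c) →
                 ¬ GoodRows (bar (x + c) p ∷ bar c 1 ∷ bar c 1 ∷ cells c (suc k))
  add-to-2-col c k (suc x) p rows d≤e good with one-box c x p rows d≤e good
  ... | refl = refute {ts = x + c ∷ c ∷ c ∷ c ∷ []} clash-1221 (≤-refl ∷ ℕ.m≤n+m c x ∷ ≤-refl ∷ ≤-refl ∷ []) refl
    (GoodRows-upper _ (bar c 1 ∷ bar c 1 ∷ bar c 0 ∷ []) {cells c k} rows good)
  add-to-2-col c k zero zero          rows d≤e good = ℕ.1+n≰n d≤e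
  add-to-2-col c k zero (suc zero)    rows d≤e good =
    refute {ts = c ∷ c ∷ c ∷ c ∷ []} clash-2221 (≤-refl ∷ ≤-refl ∷ ≤-refl ∷ ≤-refl ∷ []) refl
      (GoodRows-upper _ (bar c 1 ∷ bar c 1 ∷ bar c 0 ∷ []) {cells c k} rows good)
  add-to-2-col c k zero (suc (suc p)) rows d≤e good =
    refute {ts = c ∷ c ∷ c ∷ c ∷ []} clash-2221 (≤-refl ∷ ≤-refl ∷ ≤-refl ∷ ≤-refl ∷ []) refl
      (Good-top ((≤-refl , ℕ.+-monoʳ-≤ 2 (ℕ.m≤n+m c (suc p))) ∷ (≤-refl , ≤-refl) ∷ (≤-refl , s≤s (ℕ.n≤1+n c)) ∷ [])
                (ℕ.+-monoʳ-≤ 3 (ℕ.m≤n+m c p))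
        (GoodRows-upper _ (bar c 1 ∷ bar c 1 ∷ bar c 0 ∷ []) {cells c k} rows good))

  add-to-3-3 : ∀ c x p → 2 + c ≤ p + (x + c) → Rows α β (bar (x + c) p ∷ bar c 2 ∷ bar c 2 ∷ []) →
               ¬ GoodRows (bar (x + c) p ∷ bar c 2 ∷ bar c 2 ∷ [])
  add-to-3-3 c zero p d≤e rows good with ℕ.+-cancelʳ-≤ c 2 p d≤e
  ... | s≤s (s≤s {n = p} z≤n) = ¬three-left c p 1 2 (s≤s z≤n) ≤-refl good
  add-to-3-3 c (suc x) p d≤e rows good
    with crossing c 1 x p d≤e (GoodRows-upper _ (bar c 2 ∷ []) {bar c 2 ∷ []} rows good)
  add-to-3-3 c (suc zero)    _ d≤e rows good | inj₁ refl = ℕ.1+n≰n d≤e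
  add-to-3-3 c (suc (suc x)) _ d≤e rows good | inj₁ refl =
    refute {ts = x + c ∷ c ∷ c ∷ []} clash-133 (≤-refl ∷ ℕ.m≤n+m c x ∷ ≤-refl ∷ []) refl good
  add-to-3-3 c (suc zero)    _ d≤e rows good | inj₂ (zero , refl , refl) =
    refute {ts = c ∷ c ∷ c ∷ []} clash-233 (≤-refl ∷ ≤-refl ∷ ≤-refl ∷ []) refl good
  add-to-3-3 c (suc x)       _ d≤e rows good | inj₂ (suc p , _ , eq) = ℕ.m+1+n≢0 p (sym (ℕ.suc-injective eq))

  add-to-4-4 : ∀ c x p → 3 + c ≤ p + (x + c) → Rows α β (bar (x + c) p ∷ bar c 3 ∷ bar c 3 ∷ []) →
               ¬ GoodRows (bar (x + c) p ∷ bar c 3 ∷ bar c 3 ∷ [])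
  add-to-4-4 c zero p d≤e rows good with ℕ.+-cancelʳ-≤ c 3 p d≤e
  ... | s≤s (s≤s {n = p} 1≤p) = ¬three-left c p 2 3 (s≤s 1≤p) ≤-refl good
  add-to-4-4 c (suc x) p d≤e rows good
    with crossing c 2 x p d≤e (GoodRows-upper _ (bar c 3 ∷ []) {bar c 3 ∷ []} rows good)
  add-to-4-4 c (suc zero)          _ d≤e rows good | inj₁ refl = ℕ.1+n≰n (ℕ.≤-trans (ℕ.n≤1+n _) d≤e)
  add-to-4-4 c (suc (suc zero))    _ d≤e rows good | inj₁ refl = ℕ.1+n≰n d≤e
  add-to-4-4 c (suc (suc (suc x))) _ d≤e rows good | inj₁ refl =
    refute {ts = x + c ∷ c ∷ c ∷ []} clash-144 (≤-refl ∷ ℕ.m≤n+m c x ∷ ≤-refl ∷ []) refl good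
  add-to-4-4 c (suc (suc zero))    _ d≤e rows good | inj₂ (zero , refl , refl) =
    refute {ts = c ∷ c ∷ c ∷ []} clash-244 (≤-refl ∷ ≤-refl ∷ ≤-refl ∷ []) refl good
  add-to-4-4 c (suc zero)          _ d≤e rows good | inj₂ (suc zero , refl , refl) =
    ¬aligned-ends c 0 0 (GoodRows-upper _ (bar c 3 ∷ []) {bar c 3 ∷ []} rows good)
  add-to-4-4 c (suc x)             _ d≤e rows good | inj₂ (suc (suc p) , _ , eq) =
    ℕ.m+1+n≢0 p (sym (ℕ.suc-injective (ℕ.suc-injective eq)))

  ¬over-2-2-2 : ∀ c x p {rs} → Rows α β (bar (suc x + c) p ∷ bar c 1 ∷ bar c 1 ∷ bar c 1 ∷ rs) → 1 + c ≤ p + (suc x + c) →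
                ¬ GoodRows (bar (suc x + c) p ∷ bar c 1 ∷ bar c 1 ∷ bar c 1 ∷ rs)
  ¬over-2-2-2 c x p rows d≤e good with one-box c x p rows d≤e good
  ... | refl = refute {ts = x + c ∷ c ∷ c ∷ c ∷ []} clash-1222 (≤-refl ∷ ℕ.m≤n+m c x ∷ ≤-refl ∷ ≤-refl ∷ []) refl
    (GoodRows-upper _ (bar c 1 ∷ bar c 1 ∷ bar c 1 ∷ []) rows good)

  add-to-2-2-2 : ∀ c x p → Rows α β (bar (x + c) p ∷ bar c 1 ∷ bar c 1 ∷ bar c 1 ∷ []) → 1 + c ≤ p + (x + c) →
                 GoodRows (bar (x + c) p ∷ bar c 1 ∷ bar c 1 ∷ bar c 1 ∷ []) →
                 Pattern (bar (x + c) p ∷ bar c 1 ∷ bar c 1 ∷ bar c 1 ∷ [])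
  add-to-2-2-2 c (suc x) p             rows d≤e good = ⊥-elim (¬over-2-2-2 c x p rows d≤e good)
  add-to-2-2-2 c zero    zero          rows d≤e good = contradiction d≤e ℕ.1+n≰n
  add-to-2-2-2 c zero    (suc zero)    rows d≤e good = 2-2-2-2 c
  add-to-2-2-2 c zero    (suc (suc p)) rows d≤e good =
    ⊥-elim (¬three-left c p 0 1 z≤n ≤-refl (GoodRows-upper _ (bar c 1 ∷ bar c 1 ∷ []) {bar c 1 ∷ []} rows good))

  add-to-2-2-2-2 : ∀ c x p → Rows α β (bar (x + c) p ∷ bar c 1 ∷ bar c 1 ∷ bar c 1 ∷ bar c 1 ∷ []) → 1 + c ≤ p + (x + c) →
                   ¬ GoodRows (bar (x + c) p ∷ bar c 1 ∷ bar c 1 ∷ bar c 1 ∷ bar c 1 ∷ [])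
  add-to-2-2-2-2 c (suc x) p             rows d≤e good = ¬over-2-2-2 c x p rows d≤e good
  add-to-2-2-2-2 c zero    zero          rows d≤e good = ℕ.1+n≰n d≤e
  add-to-2-2-2-2 c zero    (suc zero)    rows d≤e good =
    refute {ts = c ∷ c ∷ c ∷ c ∷ c ∷ []} clash-22222 (≤-refl ∷ ≤-refl ∷ ≤-refl ∷ ≤-refl ∷ ≤-refl ∷ []) refl good
  add-to-2-2-2-2 c zero    (suc (suc p)) rows d≤e good =
    ¬three-left c p 0 1 z≤n ≤-refl (GoodRows-upper _ (bar c 1 ∷ bar c 1 ∷ []) {bar c 1 ∷ bar c 1 ∷ []} rows good)

  bend′ : ∀ {a e y k g f us} → Rows α β ((a , e) ∷ cells y (suc k) ++ (g , f) ∷ us) → g < y → g < f → f ≤ suc y →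
          GoodRows ((a , e) ∷ cells y (suc k) ++ (g , f) ∷ us) → a ≡ y × e ≡ suc y
  bend′ {a} {e} {y} {k} {g} {f} {us} rows@(cons a<e _ _ (cons _ y≤a _ _)) g<y g<f f≤1+y good =
    bend y≤a a<e g<y g<f f≤1+y
      (GoodRows-upper (a , e) (cells y (suc k) ++ (g , f) ∷ []) {us} (subst (λ rs → Rows α β ((a , e) ∷ rs)) assoc rows)
        (subst (λ rs → GoodRows ((a , e) ∷ rs)) assoc good))
    where
    assoc : cells y (suc k) ++ (g , f) ∷ us ≡ (cells y (suc k) ++ (g , f) ∷ []) ++ us
    assoc = sym (List.++-assoc (cells y (suc k)) ((g , f) ∷ []) us)

  add-row : ∀ {a e rs} → Rows α β ((a , e) ∷ rs) → GoodRows ((a , e) ∷ rs) → Pattern rs → Pattern ((a , e) ∷ rs)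
  add-row rows good (hook c m k) with offset rows
  ... | x , p , refl , refl , s≤s d≤e = add-to-hook c m k x p rows d≤e good
  add-row rows good (hook° c m k) with bend′ {us = []} rows (s≤s (ℕ.m≤n+m c m)) (s≤s (ℕ.m≤n+m c (suc m))) ≤-refl good
  ... | refl , refl = hook° c m (suc k)
  add-row rows good (disjoint c b m k c<b) with offset rows
  ... | x , p , refl , refl , s≤s d≤e = add-to-disjoint c b m k x p c<b rows d≤e good
  add-row rows good (disjoint° c b m k m+c<b)
    with bend′ {us = []} rows (ℕ.≤-<-trans (ℕ.m≤n+m c m) m+c<b) (s≤s (ℕ.m≤n+m c m)) (ℕ.m<n⇒m<1+n m+c<b) good
  ... | refl , refl = disjoint° c b m (suc k) m+c<b
  add-row rows good (2-row c m) with offset rows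
  ... | x , p , refl , refl , s≤s d≤e = add-to-2-row c m x p rows d≤e good
  add-row rows good (2-row° c m) with offset rows
  ... | x , p , refl , refl , s≤s d≤e = ⊥-elim (add-to-2-row° c m x p rows d≤e good)
  add-row rows good (2-col c k) with offset rows
  ... | x , p , refl , refl , s≤s d≤e = ⊥-elim (add-to-2-col c k x p rows d≤e good)
  add-row rows good (2-col° c k) with bend′ rows ≤-refl (s≤s (ℕ.n≤1+n c)) ≤-refl good
  ... | refl , refl = 2-col° c (suc k)
  add-row rows good (3-3 c) with offset rows
  ... | x , p , refl , refl , s≤s d≤e = ⊥-elim (add-to-3-3 c x p d≤e rows good)
  add-row rows good (4-4 c) with offset rows
  ... | x , p , refl , refl , s≤s d≤e = ⊥-elim (add-to-4-4 c x p d≤e rows good)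
  add-row rows good (2-2-2 c) with offset rows
  ... | x , p , refl , refl , s≤s d≤e = add-to-2-2-2 c x p rows d≤e good
  add-row rows good (2-2-2-2 c) with offset rows
  ... | x , p , refl , refl , s≤s d≤e = ⊥-elim (add-to-2-2-2-2 c x p rows d≤e good)

classification : ∀ {α β rs} → Rows α β rs → GoodRows rs → rs ≡ [] ⊎ Pattern rs
classification []                                         _    = inj₁ refl
classification (cons {a = a} {e} {rs = []} a<e _ _ [])    _    =
  inj₂ (subst (λ t → Pattern ((a , t) ∷ [])) (trans (sym (+-suc _ a)) (ℕ.m∸n+n≡m a<e)) (hook a (e ∸ suc a) 0))
classification rows@(cons {rs = _ ∷ _} _ _ _ rows′)       good with classification rows′ (GoodRows-tail rows good)
... | inj₂ pattern′ = inj₂ (add-row rows good pattern′)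

-- Tableaux on a family of boxes

module _ {n : ℕ} (f : Fin n → Box) where

  -- `IsSYT` for any family of boxes indexed by `Fin n`. Reindexed families allow passing between
  -- box lists whose lengths agree only propositionally.
  IsTableau : Vec (Fin n) n → Set
  IsTableau T =
    (∀ p q → Vec.lookup T p ≡ Vec.lookup T q → p ≡ q) ×
    (∀ p q → row (f p) ≡ row (f q) → col (f p) < col (f q) → Vec.lookup T p Fin.< Vec.lookup T q) ×
    (∀ p q → col (f p) ≡ col (f q) → row (f p) < row (f q) → Vec.lookup T p Fin.< Vec.lookup T q)

  Descends : Vec (Fin n) n → ℕ → Set
  Descends T i = ∃[ p ] ∃[ q ]
    suc (toℕ (Vec.lookup T p)) ≡ i × suc (toℕ (Vec.lookup T q)) ≡ suc i × row (f p) < row (f q)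

  descends? : ∀ T i → Dec (Descends T i)
  descends? T i = Fin.any? λ p → Fin.any? λ q →
    (suc (toℕ (Vec.lookup T p)) ≟ i) ×-dec (suc (toℕ (Vec.lookup T q)) ≟ suc i) ×-dec (row (f p) <? row (f q))

  descentsOf : Vec (Fin n) n → List Bool
  descentsOf T = map (does ∘ descends? T) (applyUpTo suc (n ∸ 1))

  Has : List Bool → Set
  Has β = Σ[ T ∈ Vec (Fin n) n ] IsTableau T × descentsOf T ≡ β

  Distinguished : Set
  Distinguished = ∀ T T′ → IsTableau T → IsTableau T′ → descentsOf T ≡ descentsOf T′ → T ≡ T′

Realises⇒Has : ∀ A {β} → Realises A β → Has (lookup (boxes A)) β
Realises⇒Has A (T , syt , eq) = T , syt , eq

Has⇒Realises : ∀ A {β} → Has (lookup (boxes A)) β → Realises A β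
Has⇒Realises A (T , syt , eq) = T , syt , eq

-- Standardness and descents see only the relative order of the row numbers and that of the column
-- numbers, so they are invariant under such isomorphisms.
OrderIso : ∀ {X : Set} → (X → ℕ) → (X → ℕ) → Set
OrderIso {X} h k = ∀ (x y : X) → h x < h y ⇔ k x < k y

OrderIso-sym : ∀ {X : Set} {h k : X → ℕ} → OrderIso h k → OrderIso k h
OrderIso-sym iso x y = mk⇔ (Equivalence.from (iso x y)) (Equivalence.to (iso x y))

OrderIso-≡ : ∀ {X : Set} {h k : X → ℕ} → OrderIso h k → ∀ {x y} → k x ≡ k y → h x ≡ h y
OrderIso-≡ {h = h} {k} iso {x} {y} eq with ℕ.<-cmp (h x) (h y)
... | tri≈ _ h≡ _ = h≡
... | tri< h< _ _ = contradiction eq (ℕ.<⇒≢ (Equivalence.to (iso x y) h<))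
... | tri> _ _ h> = contradiction (sym eq) (ℕ.<⇒≢ (Equivalence.to (iso y x) h>))

module _ {n : ℕ} {f g : Fin n → Box} (rows : OrderIso (row ∘ f) (row ∘ g)) (cols : OrderIso (col ∘ f) (col ∘ g)) where

  IsTableau-resp : ∀ T → IsTableau f T → IsTableau g T
  IsTableau-resp T (inj , inc-rows , inc-cols) = inj
    , (λ p q r≡ c< → inc-rows p q (OrderIso-≡ rows r≡) (Equivalence.from (cols p q) c<))
    , (λ p q c≡ r< → inc-cols p q (OrderIso-≡ cols c≡) (Equivalence.from (rows p q) r<))

  descentsOf-resp : ∀ T → descentsOf f T ≡ descentsOf g T
  descentsOf-resp T = List.map-cong (λ i → does-⇔ (mk⇔
      (λ (p , q , e , e′ , r<) → p , q , e , e′ , Equivalence.to (rows p q) r<)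
      (λ (p , q , e , e′ , r<) → p , q , e , e′ , Equivalence.from (rows p q) r<))
    (descends? f T i) (descends? g T i)) (applyUpTo suc (n ∸ 1))

  Has-resp : ∀ {β} → Has f β → Has g β
  Has-resp (T , tab , eq) = T , IsTableau-resp T tab , trans (sym (descentsOf-resp T)) eq

Distinguished-resp : ∀ {n} {f g : Fin n → Box} → OrderIso (row ∘ f) (row ∘ g) → OrderIso (col ∘ f) (col ∘ g) →
                     Distinguished f → Distinguished g
Distinguished-resp {f = f} {g} rows cols dist T T′ tab tab′ eq = dist T T′
  (IsTableau-resp (OrderIso-sym rows) (OrderIso-sym cols) T tab)
  (IsTableau-resp (OrderIso-sym rows) (OrderIso-sym cols) T′ tab′)
  (trans (descentsOf-resp rows cols T) (trans eq (sym (descentsOf-resp rows cols T′))))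

≡⇒OrderIso : ∀ {X : Set} {h k : X → ℕ} → (∀ x → h x ≡ k x) → OrderIso h k
≡⇒OrderIso h≡k x y rewrite h≡k x | h≡k y = mk⇔ id id

module _ {n m : ℕ} (e : m ≡ n) {g : Fin m → Box} {f : Fin n → Box} (g≡f : ∀ i → g (Fin.cast (sym e) i) ≡ f i) where

  private
    reindex : ∀ {n m} (e : m ≡ n) {g : Fin m → Box} {f : Fin n → Box} → (∀ i → g (Fin.cast (sym e) i) ≡ f i) →
              (∀ {β} → Has g β ⇔ Has f β) × (Distinguished g ⇔ Distinguished f)
    reindex refl {g} {f} g≡f =
      mk⇔ (Has-resp (≡⇒OrderIso (cong row ∘ g≗f)) (≡⇒OrderIso (cong col ∘ g≗f)))
          (Has-resp (≡⇒OrderIso (sym ∘ cong row ∘ g≗f)) (≡⇒OrderIso (sym ∘ cong col ∘ g≗f)))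
      , mk⇔ (Distinguished-resp (≡⇒OrderIso (cong row ∘ g≗f)) (≡⇒OrderIso (cong col ∘ g≗f)))
            (Distinguished-resp (≡⇒OrderIso (sym ∘ cong row ∘ g≗f)) (≡⇒OrderIso (sym ∘ cong col ∘ g≗f)))
      where
      g≗f : ∀ i → g i ≡ f i
      g≗f i = trans (cong g (sym (Fin.cast-is-id refl i))) (g≡f i)

  Has-reindex : ∀ {β} → Has g β ⇔ Has f β
  Has-reindex = proj₁ (reindex e g≡f)

  Distinguished-reindex : Distinguished g ⇔ Distinguished f
  Distinguished-reindex = proj₂ (reindex e g≡f)

module _ {n : ℕ} (f : Fin n → Box) where

  Has-tabulate : ∀ {bs β} → bs ≡ tabulate f → Has (lookup bs) β ⇔ Has f β
  Has-tabulate refl = Has-reindex (List.length-tabulate f) (List.lookup-tabulate f)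

  Distinguished-tabulate : ∀ {bs} → bs ≡ tabulate f → Distinguished (lookup bs) ⇔ Distinguished f
  Distinguished-tabulate refl = Distinguished-reindex (List.length-tabulate f) (List.lookup-tabulate f)

map-via-lookup : ∀ {X Y : Set} (h : X → Y) xs → map h xs ≡ tabulate (h ∘ lookup xs)
map-via-lookup h xs = trans (cong (map h) (sym (List.tabulate-lookup xs))) (List.map-tabulate (lookup xs) h)

-- Corresponding entries of a list of pairs

Similar : List (ℕ × ℕ) → Set
Similar zs = ∀ {z z′} → z ∈ zs → z′ ∈ zs → proj₁ z < proj₁ z′ ⇔ proj₂ z < proj₂ z′

-- Two box lists given as one list of pairs, which keeps corresponding boxes together without casts
-- between index types.
record Matching (zs : List (Box × Box)) : Set where
  field
    rows-match : Similar (map (λ (x , y) → row x , row y) zs)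
    cols-match : Similar (map (λ (x , y) → col x , col y) zs)

module _ {zs : List (Box × Box)} (match : Matching zs) where
  open Matching match

  private
    left right : Fin (length zs) → Box
    left  = proj₁ ∘ lookup zs
    right = proj₂ ∘ lookup zs

    rows-iso : OrderIso (row ∘ left) (row ∘ right)
    rows-iso i j = rows-match (∈-map⁺ _ (∈-lookup {xs = zs} i)) (∈-map⁺ _ (∈-lookup {xs = zs} j))

    cols-iso : OrderIso (col ∘ left) (col ∘ right)
    cols-iso i j = cols-match (∈-map⁺ _ (∈-lookup {xs = zs} i)) (∈-map⁺ _ (∈-lookup {xs = zs} j))

  Has-matching : ∀ {β} → Has (lookup (map proj₁ zs)) β ⇔ Has (lookup (map proj₂ zs)) β
  Has-matching = mk⇔
    (Equivalence.from (Has-tabulate right (map-via-lookup proj₂ zs)) ∘ Has-resp rows-iso cols-iso ∘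
      Equivalence.to (Has-tabulate left (map-via-lookup proj₁ zs)))
    (Equivalence.from (Has-tabulate left (map-via-lookup proj₁ zs)) ∘ Has-resp (OrderIso-sym rows-iso) (OrderIso-sym cols-iso) ∘
      Equivalence.to (Has-tabulate right (map-via-lookup proj₂ zs)))

  Distinguished-matching : Distinguished (lookup (map proj₁ zs)) ⇔ Distinguished (lookup (map proj₂ zs))
  Distinguished-matching = mk⇔
    (Equivalence.from (Distinguished-tabulate right (map-via-lookup proj₂ zs)) ∘ Distinguished-resp rows-iso cols-iso ∘
      Equivalence.to (Distinguished-tabulate left (map-via-lookup proj₁ zs)))
    (Equivalence.from (Distinguished-tabulate left (map-via-lookup proj₁ zs)) ∘ Distinguished-resp (OrderIso-sym rows-iso) (OrderIso-sym cols-iso) ∘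
      Equivalence.to (Distinguished-tabulate right (map-via-lookup proj₂ zs)))

-- Ranks

rank : List ℕ → ℕ → ℕ
rank xs i = length (filter (λ j → _∈?_ _≟_ j xs) (upTo i))

rank-suc-++ : ∀ xs i → rank xs (suc i) ≡ rank xs i + length (filter (λ j → _∈?_ _≟_ j xs) (i ∷ []))
rank-suc-++ xs i = trans (cong (length ∘ filter (λ j → _∈?_ _≟_ j xs)) (sym (List.upTo-∷ʳ i)))
  (trans (cong length (List.filter-++ (λ j → _∈?_ _≟_ j xs) (upTo i) (i ∷ []))) (List.length-++ (filter _ (upTo i))))

rank-suc-∈ : ∀ {xs i} → i ∈ xs → rank xs (suc i) ≡ suc (rank xs i)
rank-suc-∈ {xs} {i} i∈ = trans (rank-suc-++ xs i)
  (trans (cong (λ t → rank xs i + length t) (List.filter-accept (λ j → _∈?_ _≟_ j xs) {xs = []} i∈)) (+-comm (rank xs i) 1))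

rank-suc-∉ : ∀ {xs i} → i ∉ xs → rank xs (suc i) ≡ rank xs i
rank-suc-∉ {xs} {i} i∉ = trans (rank-suc-++ xs i)
  (trans (cong (λ t → rank xs i + length t) (List.filter-reject (λ j → _∈?_ _≟_ j xs) {xs = []} i∉)) (+-identityʳ (rank xs i)))

rank-≤-suc : ∀ xs i → rank xs i ≤ rank xs (suc i)
rank-≤-suc xs i = ≤-trans (ℕ.m≤m+n (rank xs i) _) (ℕ.≤-reflexive (sym (rank-suc-++ xs i)))

rank-mono : ∀ xs {i j} → i ≤ j → rank xs i ≤ rank xs j
rank-mono xs {i} i≤j = go (ℕ.≤⇒≤′ i≤j)
  where
  go : ∀ {j} → i ≤′ j → rank xs i ≤ rank xs j
  go (≤′-reflexive refl) = ≤-refl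
  go (≤′-step {n} le)    = ≤-trans (go le) (rank-≤-suc xs n)

rank-< : ∀ {xs i j} → i ∈ xs → i < j → rank xs i < rank xs j
rank-< {xs} i∈ i<j = ≤-trans (ℕ.≤-reflexive (sym (rank-suc-∈ i∈))) (rank-mono xs i<j)

rank-<⁻ : ∀ {xs i j} → rank xs i < rank xs j → i < j
rank-<⁻ {xs} {i} {j} r< with ℕ.<-≤-connex i j
... | inj₁ i<j = i<j
... | inj₂ j≤i = contradiction (rank-mono xs j≤i) (ℕ.<⇒≱ r<)

-- The ranks of occurring values form an initial segment of ℕ; this rigidity is what forces an order
-- isomorphism to preserve them.
rank-gapless : ∀ xs i {m} → m < rank xs i → ∃[ j ] j ∈ xs × rank xs j ≡ m
rank-gapless xs (suc i) {m} m< with _∈?_ _≟_ i xs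
... | no  i∉ = rank-gapless xs i (ℕ.<-≤-trans m< (ℕ.≤-reflexive (rank-suc-∉ i∉)))
... | yes i∈ with ℕ.m≤n⇒m<n∨m≡n (ℕ.≤-pred (≤-trans m< (ℕ.≤-reflexive (rank-suc-∈ i∈))))
...   | inj₁ m<r = rank-gapless xs i m<r
...   | inj₂ m≡r = i , i∈ , sym m≡r

-- An order isomorphism matches the gapless values: by induction on the rank of the left component.
rank-similar : ∀ {zs} → Similar zs → ∀ {z} → z ∈ zs → rank (map proj₁ zs) (proj₁ z) ≡ rank (map proj₂ zs) (proj₂ z)
rank-similar {zs} sim {z} z∈ = <-rec P step (rank xs (proj₁ z)) z∈ refl
  where
  xs = map proj₁ zs
  ys = map proj₂ zs
  P : ℕ → Set
  P m = ∀ {z} → z ∈ zs → rank xs (proj₁ z) ≡ m → m ≡ rank ys (proj₂ z)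

  left : ∀ {i} → i ∈ xs → ∃[ z ] z ∈ zs × i ≡ proj₁ z
  left = ∈-map⁻ proj₁
  right : ∀ {i} → i ∈ ys → ∃[ z ] z ∈ zs × i ≡ proj₂ z
  right = ∈-map⁻ proj₂

  step : ∀ m → (∀ {k} → k < m → P k) → P m
  step m ih {z} z∈ refl = ℕ.≤-antisym (ℕ.≮⇒≥ ¬small) (ℕ.≮⇒≥ ¬big)
    where
    ¬small : ¬ rank ys (proj₂ z) < m
    ¬small r<m with rank-gapless xs (proj₁ z) r<m
    ... | i , i∈ , ri with left i∈
    ...   | z′ , z′∈ , refl = ℕ.<⇒≢ (rank-< (∈-map⁺ proj₂ z′∈)
            (Equivalence.to (sim z′∈ z∈) (rank-<⁻ {xs} (ℕ.≤-<-trans (ℕ.≤-reflexive ri) r<m))))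
            (sym (ih r<m z′∈ ri))
    ¬big : ¬ m < rank ys (proj₂ z)
    ¬big m<r with rank-gapless ys (proj₂ z) m<r
    ... | j , j∈ , rj with right j∈
    ...   | z′ , z′∈ , refl = ℕ.<⇒≢ lt (trans (ih lt z′∈ refl) rj)
      where
      lt : rank xs (proj₁ z′) < rank xs (proj₁ z)
      lt = rank-< (∈-map⁺ proj₁ z′∈) (Equivalence.from (sim z′∈ z∈)
             (rank-<⁻ {ys} (ℕ.≤-<-trans (ℕ.≤-reflexive rj) m<r)))

compressBox : List Box → Box → Box
compressBox bs b = rank (map row bs) (row b) , rank (map col bs) (col b)

compress-matching : ∀ {zs} → Matching zs → compress (map proj₁ zs) ≡ compress (map proj₂ zs)
compress-matching {zs} match = begin
  map (compressBox (map proj₁ zs)) (map proj₁ zs)    ≡⟨ List.map-∘ zs ⟨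
  map (compressBox (map proj₁ zs) ∘ proj₁) zs        ≡⟨ List.map-cong-local (All.tabulate λ {z} z∈ → cong₂ _,_ (same row z∈ rows-match) (same col z∈ cols-match)) ⟩
  map (compressBox (map proj₂ zs) ∘ proj₂) zs        ≡⟨ List.map-∘ zs ⟩
  map (compressBox (map proj₂ zs)) (map proj₂ zs)    ∎
  where
  open ≡-Reasoning
  open Matching match
  same : ∀ (h : Box → ℕ) {z} → z ∈ zs → Similar (map (λ (x , y) → h x , h y) zs) →
         rank (map h (map proj₁ zs)) (h (proj₁ z)) ≡ rank (map h (map proj₂ zs)) (h (proj₂ z))
  same h {z} z∈ sim = subst₂ (λ xs ys → rank xs (h (proj₁ z)) ≡ rank ys (h (proj₂ z)))
    (trans (sym (List.map-∘ zs)) (List.map-∘ zs)) (trans (sym (List.map-∘ zs)) (List.map-∘ zs))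
    (rank-similar sim (∈-map⁺ (λ (x , y) → h x , h y) z∈))

withCompressed : List Box → List (Box × Box)
withCompressed bs = map (λ b → b , compressBox bs b) bs

proj₁-withCompressed : ∀ bs → map proj₁ (withCompressed bs) ≡ bs
proj₁-withCompressed bs = trans (sym (List.map-∘ bs)) (List.map-id bs)

proj₂-withCompressed : ∀ bs → map proj₂ (withCompressed bs) ≡ compress bs
proj₂-withCompressed bs = sym (List.map-∘ bs)

-- Deleting empty rows and columns keeps the relative order of boxes, so whatever is invariant under
-- matchings descends to `compress`, hence to `_≋_`.
withCompressed-matching : ∀ bs → Matching (withCompressed bs)
withCompressed-matching bs = record { rows-match = similar row (λ _ → refl) ; cols-match = similar col (λ _ → refl) }
  where
  similar : ∀ (h : Box → ℕ) → (∀ b → h (compressBox bs b) ≡ rank (map h bs) (h b)) →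
            Similar (map (λ (x , y) → h x , h y) (withCompressed bs))
  similar h h-rank z∈ z′∈ with ∈-map⁻ _ z∈ | ∈-map⁻ _ z′∈
  ... | _ , w∈ , refl | _ , w′∈ , refl with ∈-map⁻ _ w∈ | ∈-map⁻ _ w′∈
  ...   | b , b∈ , refl | b′ , b′∈ , refl rewrite h-rank b | h-rank b′ = mk⇔ (rank-< (∈-map⁺ h b∈)) rank-<⁻

Has-compress : ∀ bs {β} → Has (lookup bs) β ⇔ Has (lookup (compress bs)) β
Has-compress bs {β} = subst₂ (λ xs ys → Has (lookup xs) β ⇔ Has (lookup ys) β)
  (proj₁-withCompressed bs) (proj₂-withCompressed bs) (Has-matching (withCompressed-matching bs))

Has-≡compress : ∀ {bs cs β} → compress bs ≡ compress cs → Has (lookup bs) β → Has (lookup cs) β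
Has-≡compress {bs} {cs} {β} eq has = Equivalence.from (Has-compress cs)
  (subst (λ ds → Has (lookup ds) β) eq (Equivalence.to (Has-compress bs) has))

Distinguished-compress : ∀ bs → Distinguished (lookup bs) ⇔ Distinguished (lookup (compress bs))
Distinguished-compress bs = subst₂ (λ xs ys → Distinguished (lookup xs) ⇔ Distinguished (lookup ys))
  (proj₁-withCompressed bs) (proj₂-withCompressed bs) (Distinguished-matching (withCompressed-matching bs))

Distinguished-≡compress : ∀ {bs cs} → compress bs ≡ compress cs → Distinguished (lookup bs) → Distinguished (lookup cs)
Distinguished-≡compress {bs} {cs} eq dist = Equivalence.from (Distinguished-compress cs)
  (subst (λ ds → Distinguished (lookup ds)) eq (Equivalence.to (Distinguished-compress bs) dist))

-- Rotation

applyUpTo-reflect : ∀ {X : Set} {h k : ℕ → X} m → (∀ i → i < m → h i ≡ k (m ∸ suc i)) → applyUpTo h m ≡ applyDownFrom k m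
applyUpTo-reflect zero    h≡k = refl
applyUpTo-reflect (suc m) h≡k = cong₂ _∷_ (h≡k 0 (s≤s z≤n)) (applyUpTo-reflect m (λ i i<m → h≡k (suc i) (s≤s i<m)))

module _ {n : ℕ} {f g : Fin n → Box}
         (rows : ∀ p q → row (f p) < row (f q) ⇔ row (g (Fin.opposite q)) < row (g (Fin.opposite p)))
         (cols : ∀ p q → col (f p) < col (f q) ⇔ col (g (Fin.opposite q)) < col (g (Fin.opposite p))) where

  private
    opp : Fin n → Fin n
    opp = Fin.opposite

    -- Entry t becomes n + 1 - t. Rotation reverses the reading order, so the box at position p
    -- moves to position `opp p`.
    rotate : Vec (Fin n) n → Vec (Fin n) n
    rotate T = Vec.tabulate λ p → opp (Vec.lookup T (opp p))

    lookup-rotate : ∀ T p → Vec.lookup (rotate T) p ≡ opp (Vec.lookup T (opp p))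
    lookup-rotate T = Vec.lookup∘tabulate (λ p → opp (Vec.lookup T (opp p)))

    opp-injective : ∀ {p q : Fin n} → opp p ≡ opp q → p ≡ q
    opp-injective eq = trans (sym (Fin.opposite-involutive _)) (trans (cong opp eq) (Fin.opposite-involutive _))

    opp-< : ∀ {p q : Fin n} → p Fin.< q → opp q Fin.< opp p
    opp-< {p} {q} p<q rewrite Fin.opposite-prop p | Fin.opposite-prop q = ℕ.∸-monoʳ-< (s≤s p<q) (Fin.toℕ<n q)

    module _ (h : Box → ℕ) (iso : ∀ p q → h (f p) < h (f q) ⇔ h (g (opp q)) < h (g (opp p))) where

      <-opp : ∀ {p q} → h (g p) < h (g q) → h (f (opp q)) < h (f (opp p))
      <-opp {p} {q} lt = Equivalence.from (iso (opp q) (opp p))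
        (subst₂ (λ i j → h (g i) < h (g j)) (sym (Fin.opposite-involutive p)) (sym (Fin.opposite-involutive q)) lt)

      ≡-opp : ∀ {p q} → h (g p) ≡ h (g q) → h (f (opp q)) ≡ h (f (opp p))
      ≡-opp {p} {q} eq with ℕ.<-cmp (h (f (opp q))) (h (f (opp p)))
      ... | tri≈ _ h≡ _ = h≡
      ... | tri< h< _ _ =
          contradiction eq (ℕ.<⇒≢ (subst₂ (λ i j → h (g i) < h (g j)) (Fin.opposite-involutive p) (Fin.opposite-involutive q) (Equivalence.to (iso (opp q) (opp p)) h<)))
      ... | tri> _ _ h> =
          contradiction (sym eq) (ℕ.<⇒≢ (subst₂ (λ i j → h (g i) < h (g j)) (Fin.opposite-involutive q) (Fin.opposite-involutive p) (Equivalence.to (iso (opp p) (opp q)) h>)))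

    rotate-tableau : ∀ T → IsTableau f T → IsTableau g (rotate T)
    rotate-tableau T (inj , inc-rows , inc-cols) = inj′ , inc row col rows cols inc-rows , inc col row cols rows inc-cols
      where
      inj′ : ∀ p q → Vec.lookup (rotate T) p ≡ Vec.lookup (rotate T) q → p ≡ q
      inj′ p q eq rewrite lookup-rotate T p | lookup-rotate T q = opp-injective (inj (opp p) (opp q) (opp-injective eq))
      inc : ∀ (h k : Box → ℕ) → (∀ p q → h (f p) < h (f q) ⇔ h (g (opp q)) < h (g (opp p))) →
            (∀ p q → k (f p) < k (f q) ⇔ k (g (opp q)) < k (g (opp p))) →
            (∀ p q → h (f p) ≡ h (f q) → k (f p) < k (f q) → Vec.lookup T p Fin.< Vec.lookup T q) →
            ∀ p q → h (g p) ≡ h (g q) → k (g p) < k (g q) → Vec.lookup (rotate T) p Fin.< Vec.lookup (rotate T) q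
      inc h k h-iso k-iso increasing p q h≡ k< rewrite lookup-rotate T p | lookup-rotate T q =
        opp-< (increasing (opp q) (opp p) (≡-opp h h-iso h≡) (<-opp k k-iso k<))

    opp-suc : ∀ (p : Fin n) {i} → suc (toℕ p) ≡ i → suc (toℕ (opp p)) ≡ suc n ∸ i
    opp-suc p refl rewrite Fin.opposite-prop p = sym (ℕ.+-∸-assoc 1 (Fin.toℕ<n p))

    -- The entries i and i + 1 come from n + 1 - i and n - i, and the rotation exchanges upper and
    -- lower; both reversals together move the descent to n - i.
    Descends-rotate : ∀ T {i} → i ≤ n → Descends g (rotate T) i → Descends f T (n ∸ i)
    Descends-rotate T {i} i≤n (p , q , ep , eq , r<)
      rewrite lookup-rotate T p | lookup-rotate T q =
      opp q , opp p ,
      trans (sym (cong (suc ∘ toℕ) (Fin.opposite-involutive (Vec.lookup T (opp q))))) (opp-suc (opp (Vec.lookup T (opp q))) eq) ,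
      trans (sym (cong (suc ∘ toℕ) (Fin.opposite-involutive (Vec.lookup T (opp p)))))
        (trans (opp-suc (opp (Vec.lookup T (opp p))) ep) (ℕ.+-∸-assoc 1 i≤n)) ,
      <-opp row rows r<

    Descends-rotate⁻ : ∀ T {i} → i ≤ n → Descends f T (n ∸ i) → Descends g (rotate T) i
    Descends-rotate⁻ T {i} i≤n (p , q , ep , eq , r<) = opp q , opp p ,
      trans (cong (suc ∘ toℕ) (at-opp q)) (trans (opp-suc (Vec.lookup T q) eq) (ℕ.m∸[m∸n]≡n i≤n)) ,
      trans (cong (suc ∘ toℕ) (at-opp p)) (trans (opp-suc (Vec.lookup T p) ep)
        (trans (ℕ.+-∸-assoc 1 (ℕ.m∸n≤m n i)) (cong suc (ℕ.m∸[m∸n]≡n i≤n)))) ,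
      Equivalence.to (rows p q) r<
      where
      at-opp : ∀ p → Vec.lookup (rotate T) (opp p) ≡ opp (Vec.lookup T p)
      at-opp p = trans (lookup-rotate T (opp p)) (cong (λ q → opp (Vec.lookup T q)) (Fin.opposite-involutive p))

    descentsOf-rotate : ∀ T → descentsOf g (rotate T) ≡ reverse (descentsOf f T)
    descentsOf-rotate T = begin
      map (does ∘ descends? g (rotate T)) (applyUpTo suc (n ∸ 1))    ≡⟨ List.map-applyUpTo suc _ (n ∸ 1) ⟩
      applyUpTo (does ∘ descends? g (rotate T) ∘ suc) (n ∸ 1)        ≡⟨ applyUpTo-reflect (n ∸ 1) same ⟩
      applyDownFrom (does ∘ descends? f T ∘ suc) (n ∸ 1)             ≡⟨ List.reverse-applyUpTo _ (n ∸ 1) ⟨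
      reverse (applyUpTo (does ∘ descends? f T ∘ suc) (n ∸ 1))       ≡⟨ cong reverse (List.map-applyUpTo suc _ (n ∸ 1)) ⟨
      reverse (map (does ∘ descends? f T) (applyUpTo suc (n ∸ 1)))   ∎
      where
      open ≡-Reasoning
      same : ∀ i → i < n ∸ 1 → does (descends? g (rotate T) (suc i)) ≡ does (descends? f T (suc (n ∸ 1 ∸ suc i)))
      same i i<n-1 = does-⇔ (mk⇔ (subst (Descends f T) index ∘ Descends-rotate T 1+i≤n)
                                 (Descends-rotate⁻ T 1+i≤n ∘ subst (Descends f T) (sym index)))
                            (descends? g (rotate T) (suc i)) (descends? f T (suc (n ∸ 1 ∸ suc i)))
        where
        1+i≤n : suc i ≤ n
        1+i≤n = ≤-trans i<n-1 (ℕ.m∸n≤m n 1)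
        index : n ∸ suc i ≡ suc (n ∸ 1 ∸ suc i)
        index = trans (cong (_∸ suc i) (sym (ℕ.m+[n∸m]≡n {1} (≤-trans (s≤s z≤n) 1+i≤n)))) (ℕ.+-∸-assoc 1 i<n-1)

  Has-rotate : ∀ {β} → Has f β → Has g (reverse β)
  Has-rotate (T , tab , refl) = rotate T , rotate-tableau T tab , descentsOf-rotate T

tabulate-∷ʳ : ∀ {X : Set} {n} (f : Fin (suc n) → X) → tabulate f ≡ tabulate (f ∘ Fin.inject₁) ∷ʳ f (Fin.fromℕ n)
tabulate-∷ʳ {n = zero}  f = refl
tabulate-∷ʳ {n = suc n} f = cong (f zero ∷_) (tabulate-∷ʳ (f ∘ suc))

reverse-tabulate : ∀ {X : Set} {n} (f : Fin n → X) → reverse (tabulate f) ≡ tabulate (f ∘ Fin.opposite)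
reverse-tabulate {n = zero}  f = refl
reverse-tabulate {n = suc n} f = begin
  reverse (f zero ∷ tabulate (f ∘ suc))              ≡⟨ List.unfold-reverse (f zero) (tabulate (f ∘ suc)) ⟩
  reverse (tabulate (f ∘ suc)) ∷ʳ f zero             ≡⟨ cong (_∷ʳ f zero) (reverse-tabulate (f ∘ suc)) ⟩
  tabulate (f ∘ suc ∘ Fin.opposite) ∷ʳ f zero        ≡⟨ cong₂ _∷ʳ_ (List.tabulate-cong (cong f ∘ sym ∘ opposite-inject₁)) (cong f (sym (opposite-fromℕ n))) ⟩
  tabulate (f ∘ Fin.opposite ∘ Fin.inject₁) ∷ʳ f (Fin.opposite (Fin.fromℕ n))  ≡⟨ tabulate-∷ʳ (f ∘ Fin.opposite) ⟨
  tabulate (f ∘ Fin.opposite)                        ∎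
  where
  open ≡-Reasoning
  opposite-inject₁ : ∀ {n} (i : Fin n) → Fin.opposite (Fin.inject₁ i) ≡ suc (Fin.opposite i)
  opposite-inject₁ zero    = refl
  opposite-inject₁ (suc i) = cong Fin.inject₁ (opposite-inject₁ i)
  opposite-fromℕ : ∀ n → Fin.opposite (Fin.fromℕ n) ≡ zero
  opposite-fromℕ zero    = refl
  opposite-fromℕ (suc n) = cong Fin.inject₁ (opposite-fromℕ n)

flip : ℕ → ℕ → Box → Box
flip H W (r , c) = H ∸ r , W ∸ c

rotateBoxes : ℕ → ℕ → List Box → List Box
rotateBoxes H W bs = reverse (map (flip H W) bs)

Inside : ℕ → ℕ → Box → Set
Inside H W b = row b ≤ H × col b ≤ W

∸-reverses-< : ∀ {H x y} → y ≤ H → x ≤ H → x < y ⇔ H ∸ y < H ∸ x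
∸-reverses-< {H} {x} {y} y≤H x≤H = mk⇔ (λ x<y → ℕ.∸-monoʳ-< x<y y≤H)
  (λ lt → ℕ.≰⇒> λ y≤x → ℕ.<⇒≱ lt (ℕ.∸-monoʳ-≤ H y≤x))

Has-rotateBoxes : ∀ {H W bs β} → All (Inside H W) bs → Has (lookup bs) β → Has (lookup (rotateBoxes H W bs)) (reverse β)
Has-rotateBoxes {H} {W} {bs} inside has = Equivalence.from (Has-tabulate (flip H W ∘ lookup bs ∘ Fin.opposite) rotated≡)
  (Has-rotate (iso row proj₁ (λ _ → refl)) (iso col proj₂ (λ _ → refl)) has)
  where
  rotated≡ : rotateBoxes H W bs ≡ tabulate (flip H W ∘ lookup bs ∘ Fin.opposite)
  rotated≡ = trans (cong reverse (map-via-lookup (flip H W) bs)) (reverse-tabulate (flip H W ∘ lookup bs))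
  iso : ∀ (h : Box → ℕ) {X} → (∀ {b} → Inside H W b → h b ≤ X) → (∀ b → h (flip H W b) ≡ X ∸ h b) →
        ∀ p q → h (lookup bs p) < h (lookup bs q) ⇔
                h (flip H W (lookup bs (Fin.opposite (Fin.opposite q)))) < h (flip H W (lookup bs (Fin.opposite (Fin.opposite p))))
  iso h bound h-flip p q rewrite Fin.opposite-involutive p | Fin.opposite-involutive q
    | h-flip (lookup bs p) | h-flip (lookup bs q) =
    ∸-reverses-< (bound (All.lookup inside (∈-lookup q))) (bound (All.lookup inside (∈-lookup p)))

-- Rotation respects compression, since both lists are matched with their rotated compressions.
rotateBoxes-matching : ∀ {zs H W H′ W′} → Matching zs → All (Inside H W ∘ proj₁) zs → All (Inside H′ W′ ∘ proj₂) zs →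
                       compress (rotateBoxes H W (map proj₁ zs)) ≡ compress (rotateBoxes H′ W′ (map proj₂ zs))
rotateBoxes-matching {zs} {H} {W} {H′} {W′} match in₁ in₂ =
  subst₂ (λ xs ys → compress xs ≡ compress ys) (side proj₁ (flip H W) (λ _ → refl)) (side proj₂ (flip H′ W′) (λ _ → refl))
    (compress-matching flipped)
  where
  open Matching match
  flipPair : Box × Box → Box × Box
  flipPair (x , y) = flip H W x , flip H′ W′ y
  side : ∀ (π : Box × Box → Box) (φ : Box → Box) → (∀ z → π (flipPair z) ≡ φ (π z)) →
         map π (reverse (map flipPair zs)) ≡ reverse (map φ (map π zs))
  side π φ eq = trans (List.reverse-map π (map flipPair zs))
    (cong reverse (trans (sym (List.map-∘ zs)) (trans (List.map-cong eq zs) (List.map-∘ zs))))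
  similar : ∀ (h : Box → ℕ) {X X′} → (∀ {b} → Inside H W b → h b ≤ X) → (∀ {b} → Inside H′ W′ b → h b ≤ X′) →
            (∀ b → h (flip H W b) ≡ X ∸ h b) → (∀ b → h (flip H′ W′ b) ≡ X′ ∸ h b) →
            Similar (map (λ (x , y) → h x , h y) zs) →
            Similar (map (λ (x , y) → h x , h y) (reverse (map flipPair zs)))
  similar h b₁ b₂ e₁ e₂ sim z∈ z′∈ with ∈-map⁻ _ z∈ | ∈-map⁻ _ z′∈
  ... | w , w∈ , refl | w′ , w′∈ , refl with ∈-map⁻ flipPair (unreverse w∈) | ∈-map⁻ flipPair (unreverse w′∈)
    where
    unreverse : ∀ {w} → w ∈ reverse (map flipPair zs) → w ∈ map flipPair zs
    unreverse = Any.reverse⁻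
  ...   | (x , y) , v∈ , refl | (x′ , y′) , v′∈ , refl
    rewrite e₁ x | e₁ x′ | e₂ y | e₂ y′ = mk⇔
      (Equivalence.to (∸-reverses-< (b₂ (All.lookup in₂ v∈)) (b₂ (All.lookup in₂ v′∈))) ∘
        Equivalence.to (sim (∈-map⁺ _ v′∈) (∈-map⁺ _ v∈)) ∘
        Equivalence.from (∸-reverses-< (b₁ (All.lookup in₁ v∈)) (b₁ (All.lookup in₁ v′∈))))
      (Equivalence.to (∸-reverses-< (b₁ (All.lookup in₁ v∈)) (b₁ (All.lookup in₁ v′∈))) ∘
        Equivalence.from (sim (∈-map⁺ _ v′∈) (∈-map⁺ _ v∈)) ∘
        Equivalence.from (∸-reverses-< (b₂ (All.lookup in₂ v∈)) (b₂ (All.lookup in₂ v′∈))))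
  flipped : Matching (reverse (map flipPair zs))
  flipped = record
    { rows-match = similar row proj₁ proj₁ (λ _ → refl) (λ _ → refl) rows-match
    ; cols-match = similar col proj₂ proj₂ (λ _ → refl) (λ _ → refl) cols-match }

-- Linear orders on the boxes

-- The condition under which `x` may be listed before `y` when the boxes are listed by increasing
-- entries.
NotAfter : Box → Box → Set
NotAfter x y = ¬ (row x ≡ row y × col y < col x) × ¬ (col x ≡ col y × row y < row x)

AllPairs-tabulate⁻ : ∀ {X : Set} {R : X → X → Set} {n} {f : Fin n → X} → AllPairs R (tabulate f) →
                     ∀ {i j} → i Fin.< j → R (f i) (f j)
AllPairs-tabulate⁻ (rs ∷ _) {zero}  {suc j} _         = All.tabulate⁻ rs j
AllPairs-tabulate⁻ (_ ∷ rs) {suc i} {suc j} (s≤s i<j) = AllPairs-tabulate⁻ rs i<j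

ascents-tabulate : ∀ n (h : Fin n → ℕ) (d : ℕ → Bool) →
                   (∀ i j → toℕ j ≡ suc (toℕ i) → d (toℕ i) ≡ (h i <ᵇ h j)) → applyUpTo d (n ∸ 1) ≡ ascents (tabulate h)
ascents-tabulate zero          h d d≡ = refl
ascents-tabulate (suc zero)    h d d≡ = refl
ascents-tabulate (suc (suc n)) h d d≡ = cong₂ _∷_ (d≡ zero (suc zero) refl)
  (ascents-tabulate (suc n) (h ∘ suc) (d ∘ suc) (λ i j j≡ → d≡ (suc i) (suc j) (cong suc j≡)))

-- A missed value could be punched out of the codomain, giving an injection into a smaller finite
-- set.
injective⇒surjective : ∀ {n} (t : Fin n → Fin n) → (∀ p q → t p ≡ t q → p ≡ q) → ∀ m → ∃[ p ] t p ≡ m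
injective⇒surjective {suc n} t inj m with Fin.any? (λ p → t p Fin.≟ m)
... | yes hit = hit
... | no miss =
    contradiction (Fin.injective⇒≤ {f = avoid} (λ {p} {q} eq → inj p q (Fin.punchOut-injective (λ eq → miss (p , sym eq)) (λ eq → miss (q , sym eq)) eq))) ℕ.1+n≰n
  where
  avoid : Fin (suc n) → Fin n
  avoid p = Fin.punchOut {i = m} {j = t p} (λ eq → miss (p , sym eq))

module _ {n : ℕ} {f g : Fin n → Box} (f-injective : ∀ p q → f p ≡ f q → p ≡ q)
         (T : Vec (Fin n) n) (link : ∀ p → g (Vec.lookup T p) ≡ f p) (onto : ∀ m → ∃[ p ] Vec.lookup T p ≡ m) where

  private
    box : ∀ {p m} → Vec.lookup T p ≡ m → f p ≡ g m
    box {p} refl = sym (link p)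

  -- By `link` and `onto`, `g` lists the boxes in the order of their entries, so consecutive boxes
  -- of `g` carry consecutive entries.
  descentsOf-linear : descentsOf f T ≡ ascents (map row (tabulate g))
  descentsOf-linear = begin
    map (does ∘ descends? f T) (applyUpTo suc (n ∸ 1))   ≡⟨ List.map-applyUpTo suc _ (n ∸ 1) ⟩
    applyUpTo (does ∘ descends? f T ∘ suc) (n ∸ 1)       ≡⟨ ascents-tabulate n (row ∘ g) _ same ⟩
    ascents (tabulate (row ∘ g))                         ≡⟨ cong ascents (List.map-tabulate g row) ⟨
    ascents (map row (tabulate g))                       ∎
    where
    open ≡-Reasoning
    same : ∀ i j → toℕ j ≡ suc (toℕ i) → does (descends? f T (suc (toℕ i))) ≡ (row (g i) <ᵇ row (g j))
    same i j j≡ = does-⇔ (mk⇔ to from) (descends? f T (suc (toℕ i))) (row (g i) <? row (g j))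
      where
      to : Descends f T (suc (toℕ i)) → row (g i) < row (g j)
      to (p , q , ep , eq , r<) = subst₂ (λ x y → row x < row y)
        (box (Fin.toℕ-injective (ℕ.suc-injective ep)))
        (box (Fin.toℕ-injective (trans (ℕ.suc-injective eq) (sym j≡)))) r<
      from : row (g i) < row (g j) → Descends f T (suc (toℕ i))
      from r< with onto i | onto j
      ... | p , ep | q , eq = p , q , cong (suc ∘ toℕ) ep , trans (cong (suc ∘ toℕ) eq) (cong suc j≡) ,
        subst₂ (λ x y → row x < row y) (sym (box ep)) (sym (box eq)) r<

  tableau⇒linear : IsTableau f T → AllPairs NotAfter (tabulate g)
  tableau⇒linear (_ , inc-rows , inc-cols) = AllPairs.tabulate⁺-< before
    where
    before : ∀ {i j} → i Fin.< j → NotAfter (g i) (g j)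
    before {i} {j} i<j with onto i | onto j
    ... | p , refl | q , refl rewrite link p | link q =
      (λ (r≡ , c<) → ℕ.<-asym i<j (inc-rows q p (sym r≡) c<)) , (λ (c≡ , r<) → ℕ.<-asym i<j (inc-cols q p (sym c≡) r<))

  linear⇒tableau : AllPairs NotAfter (tabulate g) → IsTableau f T
  linear⇒tableau linear = (λ p q eq → f-injective p q (trans (box eq) (link q))) , inc-rows , inc-cols
    where
    order : ∀ p q → (f p ≢ f q) → ¬ NotAfter (f q) (f p) → Vec.lookup T p Fin.< Vec.lookup T q
    order p q p≢q after with Fin.<-cmp (Vec.lookup T p) (Vec.lookup T q)
    ... | tri< lt _ _ = lt
    ... | tri≈ _ eq _ = contradiction (trans (box eq) (link q)) p≢q
    ... | tri> _ _ gt = contradiction (subst₂ NotAfter (link q) (link p) (AllPairs-tabulate⁻ linear gt)) after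
    inc-rows : ∀ p q → row (f p) ≡ row (f q) → col (f p) < col (f q) → Vec.lookup T p Fin.< Vec.lookup T q
    inc-rows p q r≡ c< = order p q (λ eq → ℕ.<⇒≢ c< (cong col eq)) (λ (na , _) → na (sym r≡ , c<))
    inc-cols : ∀ p q → col (f p) ≡ col (f q) → row (f p) < row (f q) → Vec.lookup T p Fin.< Vec.lookup T q
    inc-cols p q c≡ r< = order p q (λ eq → ℕ.<⇒≢ r< (cong row eq)) (λ (_ , na) → na (sym c≡ , r<))

-- The boxes of a path

data Between : List ℕ → List ℕ → Box → Set where
  here  : ∀ {p q ps qs c} → p ≤ c → c < q → Between (p ∷ ps) (q ∷ qs) (0 , c)
  there : ∀ {p q ps qs i c} → Between ps qs (i , c) → Between (p ∷ ps) (q ∷ qs) (suc i , c)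

step-box : ∀ {b ps i qs} → Step b ps i qs → Box
step-box (here {x = x} _) = 0 , x
step-box (there s)        = suc (row (step-box s)) , col (step-box s)

step-box-row : ∀ {b ps i qs} (s : Step b ps i qs) → row (step-box s) ≡ i
step-box-row (here _)  = refl
step-box-row (there s) = cong suc (step-box-row s)

trace : ∀ {b ps w qs} → Path b ps w qs → List Box
trace []      = []
trace (s ∷ π) = step-box s ∷ trace π

map-row-trace : ∀ {b ps w qs} (π : Path b ps w qs) → map row (trace π) ≡ w
map-row-trace []      = refl
map-row-trace (s ∷ π) = cong₂ _∷_ (step-box-row s) (map-row-trace π)

data _≤*_ : List ℕ → List ℕ → Set where
  []  : [] ≤* []
  _∷_ : ∀ {p q ps qs} → p ≤ q → ps ≤* qs → (p ∷ ps) ≤* (q ∷ qs)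

≤*-refl : ∀ {ps} → ps ≤* ps
≤*-refl {[]}     = []
≤*-refl {p ∷ ps} = ≤-refl ∷ ≤*-refl

step-≤* : ∀ {b ps i ps′ qs} → Step b ps i ps′ → ps′ ≤* qs → ps ≤* qs
step-≤* (here _)  (le ∷ les) = ℕ.<⇒≤ le ∷ les
step-≤* (there s) (le ∷ les) = le ∷ step-≤* s les

path-≤* : ∀ {b ps w qs} → Path b ps w qs → ps ≤* qs
path-≤* []      = ≤*-refl
path-≤* (s ∷ π) = step-≤* s (path-≤* π)

step-between : ∀ {b ps i ps′ qs} (s : Step b ps i ps′) → ps′ ≤* qs → Between ps qs (step-box s)
step-between (here _)  (le ∷ _)   = here ≤-refl le
step-between (there s) (_ ∷ les)  = there (step-between s les)

between-step⁺ : ∀ {b ps i ps′ qs y} → Step b ps i ps′ → Between ps′ qs y → Between ps qs y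
between-step⁺ (here _)  (here p≤c c<q) = here (ℕ.<⇒≤ p≤c) c<q
between-step⁺ (here _)  (there y)      = there y
between-step⁺ (there s) (here p≤c c<q) = here p≤c c<q
between-step⁺ (there s) (there y)      = there (between-step⁺ s y)

between-step⁻ : ∀ {b ps i ps′ qs y} (s : Step b ps i ps′) → Between ps qs y → y ≡ step-box s ⊎ Between ps′ qs y
between-step⁻ (here _)  (here p≤c c<q) with ℕ.m≤n⇒m<n∨m≡n p≤c
... | inj₁ p<c  = inj₂ (here p<c c<q)
... | inj₂ refl = inj₁ refl
between-step⁻ (here _)  (there y)      = inj₂ (there y)
between-step⁻ (there s) (here p≤c c<q) = inj₂ (here p≤c c<q)
between-step⁻ (there s) (there y) with between-step⁻ s y
... | inj₁ eq   = inj₁ (cong (λ (r , c) → suc r , c) eq)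
... | inj₂ y′   = inj₂ (there y′)

¬between-step : ∀ {b ps i ps′ qs} (s : Step b ps i ps′) → ¬ Between ps′ qs (step-box s)
¬between-step (here _)  (here lt _) = ℕ.1+n≰n lt
¬between-step (there s) (there y)   = ¬between-step s y

step-col : ∀ {b ps i ps′} (s : Step b ps i ps′) → Skew b ps ps → col (step-box s) < b
step-col (here x<b) _                   = x<b
step-col (there s)  ((_ , x≤b) ∷ decr) = ℕ.<-≤-trans (step-col s decr) x≤b

step-skew : ∀ {b ps i ps′} → Step b ps i ps′ → Skew b ps ps → Skew b ps′ ps′
step-skew (here x<b) (_ ∷ decr)  = (≤-refl , x<b) ∷ raise decr
  where
  raise : ∀ {x ps} → Skew x ps ps → Skew (suc x) ps ps
  raise []               = []
  raise ((_ , q≤) ∷ sk) = (≤-refl , ℕ.m≤n⇒m≤1+n q≤) ∷ sk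
step-skew (there s)  (le ∷ decr) = le ∷ step-skew s decr

-- A box added later in a higher row lies at or beyond the present end of that row, while a step
-- stays strictly left of that end; so the later box is not above the earlier one.
step-first : ∀ {b ps i ps′ qs y} (s : Step b ps i ps′) → Skew b ps ps → Between ps′ qs y → NotAfter (step-box s) y
step-first (here _)  decr        (here p<c _) = (λ (_ , c<) → ℕ.<-asym p<c c<) , (λ ())
step-first (here _)  decr        (there y)    = (λ ()) , (λ ())
step-first (there s) (_ ∷ decr) (here p≤c _) =
  (λ ()) , (λ (c≡ , _) → ℕ.<⇒≱ (step-col s decr) (ℕ.≤-trans p≤c (ℕ.≤-reflexive (sym c≡))))
step-first (there s) (_ ∷ decr) (there y) with step-first s decr y
... | na , na′ = (λ (r≡ , c<) → na (ℕ.suc-injective r≡ , c<)) , (λ (c≡ , r<) → na′ (c≡ , ℕ.≤-pred r<))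

trace-∈⁻ : ∀ {b ps w qs y} (π : Path b ps w qs) → y ∈ trace π → Between ps qs y
trace-∈⁻ (s ∷ π) (here refl) = step-between s (path-≤* π)
trace-∈⁻ (s ∷ π) (there y∈)  = between-step⁺ s (trace-∈⁻ π y∈)

¬between-self : ∀ {ps y} → ¬ Between ps ps y
¬between-self (here p≤c c<p) = ℕ.<⇒≱ c<p p≤c
¬between-self (there y)      = ¬between-self y

trace-∈⁺ : ∀ {b ps w qs y} (π : Path b ps w qs) → Between ps qs y → y ∈ trace π
trace-∈⁺ []      y = contradiction y ¬between-self
trace-∈⁺ (s ∷ π) y with between-step⁻ s y
... | inj₁ refl = here refl
... | inj₂ y′   = there (trace-∈⁺ π y′)

trace-unique : ∀ {b ps w qs} (π : Path b ps w qs) → Unique (trace π)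
trace-unique []      = []
trace-unique (s ∷ π) = All.tabulate (λ { y∈ refl → ¬between-step s (trace-∈⁻ π y∈) }) ∷ trace-unique π

trace-linear : ∀ {b ps w qs} (π : Path b ps w qs) → Skew b ps ps → AllPairs NotAfter (trace π)
trace-linear []      _    = []
trace-linear (s ∷ π) decr = All.tabulate (λ y∈ → step-first s decr (trace-∈⁻ π y∈)) ∷ trace-linear π (step-skew s decr)

between-< : ∀ {e ps qs c} → Skew e ps qs → Between ps qs (0 , c) → c < e
between-< ((_ , q≤e) ∷ _) (here _ c<q) = ℕ.<-≤-trans c<q q≤e

-- A minimal box of the remaining shape is addable. `bound` is needed for the top row only and is
-- replaced, in the recursive call, by the end of the row just passed.
first-step : ∀ {b e ps qs x} → Skew b ps ps → Skew e ps qs → Between ps qs x → (row x ≡ 0 → col x < b) →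
             (∀ {y} → Between ps qs y → NotAfter x y) → ∃[ ps′ ] Σ[ s ∈ Step b ps (row x) ps′ ] step-box s ≡ x × Skew e ps′ qs
first-step (_ ∷ decr) ((_ , q≤e) ∷ skew) (here {p = p} {c = c} p≤c c<q) bound minimal with ℕ.m≤n⇒m<n∨m≡n p≤c
-- Otherwise the first open box of this row would have to come earlier.
... | inj₁ p<c  = contradiction (refl , p<c) (proj₁ (minimal (here ≤-refl (ℕ.<-trans p<c c<q))))
... | inj₂ refl = _ , here (bound refl) , refl , (c<q , q≤e) ∷ skew
first-step {x = suc i , c} ((_ , p≤b) ∷ decr) ((p≤q , q≤e) ∷ skew) (there {p = p} y) bound minimal
  with first-step decr skew y bound′ (λ z → let na , na′ = minimal (there z) in
         (λ (r≡ , c<) → na (cong suc r≡ , c<)) , (λ (c≡ , r<) → na′ (c≡ , s≤s r<)))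
  where
  bound′ : i ≡ 0 → c < p
  -- If the row above were filled only up to p ≤ c, its box in column c would still be open by
  -- `between-<` and would have to come earlier.
  bound′ refl = ℕ.≰⇒> λ p≤c → proj₂ (minimal (here p≤c (between-< skew y))) (refl , s≤s z≤n)
... | ps′ , s , eq , skew′ = _ , there s , cong (λ (r , c) → suc r , c) eq , (p≤q , q≤e) ∷ skew′

no-box⇒≡ : ∀ {b ps qs} → Skew b ps qs → (∀ {y} → ¬ Between ps qs y) → ps ≡ qs
no-box⇒≡ []                 _    = refl
no-box⇒≡ ((p≤q , _) ∷ skew) none with ℕ.m≤n⇒m<n∨m≡n p≤q
... | inj₁ p<q  = contradiction (here ≤-refl p<q) none
... | inj₂ refl = cong (_ ∷_) (no-box⇒≡ skew (none ∘ there))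

linear⇒path : ∀ {b ps qs} L → Skew b ps ps → Skew b ps qs → Unique L → AllPairs NotAfter L →
              (∀ {y} → y ∈ L → Between ps qs y) → (∀ {y} → Between ps qs y → y ∈ L) → Path b ps (map row L) qs
linear⇒path {b} {ps} [] decr skew _ _ _ complete =
  subst (Path b ps []) (no-box⇒≡ skew (λ y → case-[] (complete y))) []
  where
  case-[] : ∀ {y : Box} → ¬ y ∈ []
  case-[] ()
linear⇒path (x ∷ L) decr skew (x∉ ∷ unique) (first ∷ linear) sound complete
  with first-step decr skew (sound (here refl)) (λ { refl → between-< skew (sound (here refl)) }) minimal
  where
  minimal : ∀ {y} → Between _ _ y → NotAfter x y
  minimal y with complete y
  ... | here refl = (λ (_ , c<) → ℕ.<-irrefl refl c<) , (λ (_ , r<) → ℕ.<-irrefl refl r<)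
  ... | there y∈  = All.lookup first y∈
... | ps′ , s , eq , skew′ = s ∷ linear⇒path L (step-skew s decr) skew′ unique linear sound′ complete′
  where
  sound′ : ∀ {y} → y ∈ L → Between ps′ _ y
  sound′ y∈ with between-step⁻ s (sound (there y∈))
  ... | inj₁ y≡   = contradiction (sym (trans y≡ eq)) (All.lookup x∉ y∈)
  ... | inj₂ y    = y
  complete′ : ∀ {y} → Between ps′ _ y → y ∈ L
  complete′ y with complete (between-step⁺ s y)
  ... | here refl = contradiction (subst (Between ps′ _) (sym eq) y) (¬between-step s)
  ... | there y∈  = y∈

-- The boxes of rows, with k the number of the first row

boxesFrom : ℕ → List Row → List Box
boxesFrom k []             = []
boxesFrom k ((a , e) ∷ rs) = applyUpTo (λ j → k , a + j) (e ∸ a) ++ boxesFrom (suc k) rs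

∈-boxesFrom⁻ : ∀ k rs {y} → y ∈ boxesFrom k rs → ∃[ i ] row y ≡ k + i × Between (starts rs) (ends rs) (i , col y)
∈-boxesFrom⁻ k ((a , e) ∷ rs) y∈ with ∈-++⁻ (applyUpTo (λ j → k , a + j) (e ∸ a)) y∈
... | inj₂ y∈rs with ∈-boxesFrom⁻ (suc k) rs y∈rs
...   | i , eq , y = suc i , trans eq (sym (+-suc k i)) , there y
∈-boxesFrom⁻ k ((a , e) ∷ rs) y∈ | inj₁ y∈r with ∈-applyUpTo⁻ (λ j → k , a + j) y∈r
... | j , j< , refl = 0 , sym (+-identityʳ k) , here (ℕ.m≤m+n a j)
  (≤-trans (ℕ.≤-reflexive (sym (+-suc a j))) (≤-trans (ℕ.+-monoʳ-≤ a j<) (ℕ.≤-reflexive (ℕ.m+[n∸m]≡n (a≤e {j} j<)))))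
  where
  a≤e : ∀ {j} → j < e ∸ a → a ≤ e
  a≤e {j} j< = ℕ.<⇒≤ (ℕ.m∸n≢0⇒n<m (λ eq → ℕ.n≮0 (subst (j <_) eq j<)))

∈-boxesFrom⁺ : ∀ k rs {i c} → Between (starts rs) (ends rs) (i , c) → (k + i , c) ∈ boxesFrom k rs
∈-boxesFrom⁺ k ((a , e) ∷ rs) {c = c} (here a≤c c<e) = ∈-++⁺ˡ
  (subst (_∈ applyUpTo (λ j → k , a + j) (e ∸ a)) (cong₂ _,_ (sym (+-identityʳ k)) (ℕ.m+[n∸m]≡n a≤c))
    (∈-applyUpTo⁺ (λ j → k , a + j) (ℕ.∸-monoˡ-< c<e a≤c)))
∈-boxesFrom⁺ k ((a , e) ∷ rs) {suc i} {c} (there y) = ∈-++⁺ʳ (applyUpTo (λ j → k , a + j) (e ∸ a))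
  (subst (λ r → (r , c) ∈ boxesFrom (suc k) rs) (sym (+-suc k i)) (∈-boxesFrom⁺ (suc k) rs y))

boxesFrom-unique : ∀ k rs → Unique (boxesFrom k rs)
boxesFrom-unique k []             = []
boxesFrom-unique k ((a , e) ∷ rs) = Unique.++⁺
  (Unique.applyUpTo⁺₁ (λ j → k , a + j) (e ∸ a) (λ i<j _ eq → ℕ.<⇒≢ i<j (ℕ.+-cancelˡ-≡ a _ _ (cong col eq))))
  (boxesFrom-unique (suc k) rs)
  λ (y∈r , y∈rs) → disjoint-rows y∈r y∈rs
  where
  disjoint-rows : ∀ {y} → y ∈ applyUpTo (λ j → k , a + j) (e ∸ a) → ¬ y ∈ boxesFrom (suc k) rs
  disjoint-rows y∈r y∈rs with ∈-applyUpTo⁻ (λ j → k , a + j) y∈r | ∈-boxesFrom⁻ (suc k) rs y∈rs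
  ... | j , _ , refl | i , eq , _ = ℕ.m≢1+m+n k eq

lookup-injective : ∀ {X : Set} {xs : List X} → Unique xs → ∀ p q → lookup xs p ≡ lookup xs q → p ≡ q
lookup-injective (_ ∷ _)  zero    zero    _  = refl
lookup-injective {xs = _ ∷ xs} (x∉ ∷ _) zero    (suc q) eq = contradiction eq (All.lookup x∉ (∈-lookup q))
lookup-injective {xs = _ ∷ xs} (x∉ ∷ _) (suc p) zero    eq = contradiction (sym eq) (All.lookup x∉ (∈-lookup p))
lookup-injective (_ ∷ u)  (suc p) (suc q) eq = cong suc (lookup-injective u p q eq)

index-injective : ∀ {X : Set} {x y : X} {zs} (x∈ : x ∈ zs) (y∈ : y ∈ zs) → Any.index x∈ ≡ Any.index y∈ → x ≡ y
index-injective {zs = zs} x∈ y∈ eq = trans (Any.lookup-index x∈) (trans (cong (lookup zs) eq) (sym (Any.lookup-index y∈)))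

unique-same-length : ∀ {X : Set} {xs ys : List X} → Unique xs → Unique ys →
                     (∀ {x} → x ∈ xs → x ∈ ys) → (∀ {x} → x ∈ ys → x ∈ xs) → length xs ≡ length ys
unique-same-length u v xs⊆ ys⊆ = ℕ.≤-antisym (embed u xs⊆) (embed v ys⊆)
  where
  embed : ∀ {X : Set} {xs ys : List X} → Unique xs → (∀ {x} → x ∈ xs → x ∈ ys) → length xs ≤ length ys
  embed {xs = xs} u ⊆ = Fin.injective⇒≤ {f = λ p → Any.index (⊆ (∈-lookup {xs = xs} p))}
    (λ {p} {q} eq → lookup-injective u p q (index-injective (⊆ (∈-lookup p)) (⊆ (∈-lookup q)) eq))

as-tabulate : ∀ {X : Set} {n} (xs : List X) → length xs ≡ n → ∃[ g ] xs ≡ tabulate {n = n} g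
as-tabulate xs refl = lookup xs , sym (List.tabulate-lookup xs)

module _ {α b : ℕ} {rs : List Row} (rows : Rows α b rs) where

  private
    bs : List Box
    bs = boxesFrom 0 rs

    n : ℕ
    n = length bs

    f : Fin n → Box
    f = lookup bs

    f-injective : ∀ p q → f p ≡ f q → p ≡ q
    f-injective = lookup-injective (boxesFrom-unique 0 rs)

    sound : ∀ {y} → y ∈ bs → Between (starts rs) (ends rs) y
    sound y∈ with ∈-boxesFrom⁻ 0 rs y∈
    ... | i , refl , y = y

    complete : ∀ {y} → Between (starts rs) (ends rs) y → y ∈ bs
    complete = ∈-boxesFrom⁺ 0 rs

    decr : Skew b (starts rs) (starts rs)
    decr = go rows
      where
      chain : ∀ {α β rs} → Rows α β rs → Skew α (starts rs) (starts rs)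
      chain []                   = []
      chain (cons _ a≤α _ rows) = (≤-refl , a≤α) ∷ chain rows
      go : ∀ {rs} → Rows α b rs → Skew b (starts rs) (starts rs)
      go []                       = []
      go (cons a<e _ e≤b rows)   = (≤-refl , ℕ.<⇒≤ (ℕ.<-≤-trans a<e e≤b)) ∷ chain rows

  -- `g` lists the boxes by entries and `w` records their rows. Both translations produce it, so
  -- that a tableau determines its word through the same data in either direction.
  record Listing (T : Vec (Fin n) n) (w : List ℕ) : Set where
    field
      g       : Fin n → Box
      letters : w ≡ map row (tabulate g)
      link    : ∀ p → g (Vec.lookup T p) ≡ f p
      onto    : ∀ m → ∃[ p ] Vec.lookup T p ≡ m

    descents≡ascents : descentsOf f T ≡ ascents w
    descents≡ascents = trans (descentsOf-linear f-injective T link onto) (cong ascents (sym letters))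

  path⇒tableau : ∀ {w} → Path b (starts rs) w (ends rs) → ∃[ T ] IsTableau f T × Listing T w
  path⇒tableau {w} π with as-tabulate {n = n} (trace π) (sym (unique-same-length (boxesFrom-unique 0 rs) (trace-unique π)
                            (trace-∈⁺ π ∘ sound) (complete ∘ trace-∈⁻ π)))
  ... | g , trace≡ = U , linear⇒tableau f-injective U link onto (subst (AllPairs NotAfter) trace≡ (trace-linear π decr)) , record
      { g = g ; letters = trans (sym (map-row-trace π)) (cong (map row) trace≡) ; link = link ; onto = onto }
    where
    position : ∀ p → ∃[ m ] f p ≡ g m
    position p = ∈-tabulate⁻ (subst (f p ∈_) trace≡ (trace-∈⁺ π (sound (∈-lookup p))))
    U : Vec (Fin n) n
    U = Vec.tabulate (proj₁ ∘ position)
    link : ∀ p → g (Vec.lookup U p) ≡ f p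
    link p rewrite Vec.lookup∘tabulate (proj₁ ∘ position) p = sym (proj₂ (position p))
    onto : ∀ m → ∃[ p ] Vec.lookup U p ≡ m
    onto = injective⇒surjective (Vec.lookup U) λ p q eq → f-injective p q (trans (sym (link p)) (trans (cong g eq) (link q)))

  tableau⇒path : ∀ {T} → IsTableau f T → ∃[ w ] Path b (starts rs) w (ends rs) × Listing T w
  tableau⇒path {T} tab@(inj , _) = map row (tabulate g) ,
    linear⇒path (tabulate g) decr (rows-skew rows) (Unique.tabulate⁺ g-injective)
      (tableau⇒linear f-injective T link onto tab) sound′ complete′ ,
    record { g = g ; letters = refl ; link = link ; onto = onto }
    where
    onto : ∀ m → ∃[ p ] Vec.lookup T p ≡ m
    onto = injective⇒surjective (Vec.lookup T) inj
    g : Fin n → Box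
    g m = f (proj₁ (onto m))
    link : ∀ p → g (Vec.lookup T p) ≡ f p
    link p = cong f (inj _ p (proj₂ (onto (Vec.lookup T p))))
    g-injective : ∀ {i j} → g i ≡ g j → i ≡ j
    g-injective {i} {j} eq = trans (sym (proj₂ (onto i))) (trans (cong (Vec.lookup T) (f-injective _ _ eq)) (proj₂ (onto j)))
    sound′ : ∀ {y} → y ∈ tabulate g → Between (starts rs) (ends rs) y
    sound′ y∈ with ∈-tabulate⁻ y∈
    ... | m , refl = sound (∈-lookup (proj₁ (onto m)))
    complete′ : ∀ {y} → Between (starts rs) (ends rs) y → y ∈ tabulate g
    complete′ y = subst (_∈ tabulate g) (trans (link (Any.index (complete y))) (sym (Any.lookup-index (complete y))))
      (∈-tabulate⁺ (Vec.lookup T (Any.index (complete y))))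

  Has⇔path : ∀ {β} → Has f β ⇔ (∃[ w ] Path b (starts rs) w (ends rs) × ascents w ≡ β)
  Has⇔path = mk⇔
    (λ (T , tab , eq) → let w , π , listing = tableau⇒path {T} tab in w , π , trans (sym (Listing.descents≡ascents listing)) eq)
    (λ (w , π , eq) → let T , tab , listing = path⇒tableau π in T , tab , trans (Listing.descents≡ascents listing) eq)

  Distinguished⇒Good : Distinguished f → Good b (starts rs) (ends rs)
  Distinguished⇒Good dist {w} {w′} π π′ eq = same-word (path⇒tableau π) (path⇒tableau π′)
    where
    same-word : ∃[ T ] IsTableau f T × Listing T w → ∃[ T ] IsTableau f T × Listing T w′ → w ≡ w′
    same-word (T , tab , l) (T′ , tab′ , l′)
      with dist T T′ tab tab′ (trans (Listing.descents≡ascents l) (trans eq (sym (Listing.descents≡ascents l′))))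
    ... | refl = trans (Listing.letters l) (trans (cong (map row) (List.tabulate-cong g≗g′)) (sym (Listing.letters l′)))
      where
      g≗g′ : ∀ m → Listing.g l m ≡ Listing.g l′ m
      g≗g′ m with Listing.onto l m
      ... | p , refl = trans (Listing.link l p) (sym (Listing.link l′ p))

-- The rows of a skew shape

rowsFrom : (ℕ → ℕ) → (ℕ → ℕ) → ℕ → List Row
rowsFrom f g h = applyUpTo (λ i → f i , g i) h

concatMap-rows : ∀ f g (ι : ℕ → ℕ) k h → (∀ i → ι i ≡ k + i) →
                 concatMap (λ i → applyUpTo (λ j → i , f i + j) (g i ∸ f i)) (applyUpTo ι h) ≡
                 boxesFrom k (rowsFrom (f ∘ ι) (g ∘ ι) h)
concatMap-rows f g ι k zero    ι≡ = refl
concatMap-rows f g ι k (suc h) ι≡ = cong₂ _++_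
  (cong (λ i → applyUpTo (λ j → i , f (ι 0) + j) (g (ι 0) ∸ f (ι 0))) (trans (ι≡ 0) (+-identityʳ k)))
  (concatMap-rows f g (ι ∘ suc) (suc k) h (λ i → trans (ι≡ (suc i)) (+-suc k i)))

rowsOf : SkewShape → List Row
rowsOf A = rowsFrom (part (inner A)) (part (outer A)) (height A)

boxes-rows : ∀ A → boxes A ≡ boxesFrom 0 (rowsOf A)
boxes-rows A = concatMap-rows (part (inner A)) (part (outer A)) id 0 (height A) (λ _ → refl)

nonempty? : Decidable (λ (r : Row) → proj₁ r < proj₂ r)
nonempty? (a , e) = a <? e

nonempty : List Row → List Row
nonempty = filter nonempty?

rows⁺ : SkewShape → List Row
rows⁺ A = nonempty (rowsOf A)

StrictlyMonotone : (ℕ → ℕ) → Set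
StrictlyMonotone φ = ∀ {x y} → x < y → φ x < φ y

monotone-reflects : ∀ {φ} → StrictlyMonotone φ → ∀ {x y} → φ x < φ y → x < y
monotone-reflects mono {x} {y} lt with ℕ.<-cmp x y
... | tri< x<y _ _  = x<y
... | tri≈ _ refl _ = contradiction lt (ℕ.<-irrefl refl)
... | tri> _ _ y<x  = contradiction (mono y<x) (ℕ.<-asym lt)

compress-map : ∀ {φ ψ} → StrictlyMonotone φ → StrictlyMonotone ψ → ∀ bs →
               compress (map (λ (r , c) → φ r , ψ c) bs) ≡ compress bs
compress-map {φ} {ψ} φ-mono ψ-mono bs = sym (subst₂ (λ xs ys → compress xs ≡ compress ys)
  (trans (sym (List.map-∘ bs)) (List.map-id bs)) (sym (List.map-∘ bs))
  (compress-matching {zs} (record { rows-match = similar row φ φ-mono (λ _ → refl) ; cols-match = similar col ψ ψ-mono (λ _ → refl) })))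
  where
  zs : List (Box × Box)
  zs = map (λ b → b , (φ (row b) , ψ (col b))) bs
  similar : ∀ (h : Box → ℕ) χ → StrictlyMonotone χ → (∀ b → h (φ (row b) , ψ (col b)) ≡ χ (h b)) →
            Similar (map (λ (x , y) → h x , h y) zs)
  similar h χ mono h≡ z∈ z′∈ with ∈-map⁻ _ z∈ | ∈-map⁻ _ z′∈
  ... | _ , w∈ , refl | _ , w′∈ , refl with ∈-map⁻ _ w∈ | ∈-map⁻ _ w′∈
  ...   | b , _ , refl | b′ , _ , refl rewrite h≡ b | h≡ b′ = mk⇔ mono (monotone-reflects mono)

boxesFrom-suc : ∀ k rs → boxesFrom (suc k) rs ≡ map (λ (r , c) → suc r , c) (boxesFrom k rs)
boxesFrom-suc k []             = refl
boxesFrom-suc k ((a , e) ∷ rs) = sym (trans (List.map-++ _ (applyUpTo (λ j → k , a + j) (e ∸ a)) (boxesFrom (suc k) rs))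
  (cong₂ _++_ (List.map-applyUpTo (λ j → k , a + j) _ (e ∸ a)) (sym (boxesFrom-suc (suc k) rs))))

-- With or without a first row that is kept, given the original numbers of the later kept rows.
extendNumbering : Bool → (ℕ → ℕ) → ℕ → ℕ
extendNumbering false φ i       = suc (φ i)
extendNumbering true  φ zero    = 0
extendNumbering true  φ (suc i) = suc (φ i)

originalRow : List Row → ℕ → ℕ
originalRow []             = id
originalRow ((a , e) ∷ rs) = extendNumbering (a <ᵇ e) (originalRow rs)

originalRow-mono : ∀ rs → StrictlyMonotone (originalRow rs)
originalRow-mono []             x<y = x<y
originalRow-mono ((a , e) ∷ rs) x<y with a <ᵇ e
... | false = s≤s (originalRow-mono rs x<y)
originalRow-mono (r ∷ rs) {zero}  {suc y} _         | true = s≤s z≤n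
originalRow-mono (r ∷ rs) {suc x} {suc y} (s≤s x<y) | true = s≤s (originalRow-mono rs x<y)

renumber : (ℕ → ℕ) → Box → Box
renumber φ (r , c) = φ r , c

boxesFrom-nonempty : ∀ rs → boxesFrom 0 rs ≡ map (renumber (originalRow rs)) (boxesFrom 0 (nonempty rs))
boxesFrom-nonempty []             = refl
boxesFrom-nonempty ((a , e) ∷ rs) with a <ᵇ e in eq
... | true = sym (begin
  map (renumber φ) (applyUpTo (λ j → 0 , a + j) (e ∸ a) ++ boxesFrom 1 (nonempty rs))
    ≡⟨ List.map-++ (renumber φ) (applyUpTo (λ j → 0 , a + j) (e ∸ a)) (boxesFrom 1 (nonempty rs)) ⟩
  map (renumber φ) (applyUpTo (λ j → 0 , a + j) (e ∸ a)) ++ map (renumber φ) (boxesFrom 1 (nonempty rs))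
    ≡⟨ cong₂ _++_ (List.map-applyUpTo (λ j → 0 , a + j) (renumber φ) (e ∸ a)) below-rows ⟩
  applyUpTo (λ j → 0 , a + j) (e ∸ a) ++ boxesFrom 1 rs ∎)
  where
  open ≡-Reasoning
  φ : ℕ → ℕ
  φ = extendNumbering true (originalRow rs)
  below-rows : map (renumber φ) (boxesFrom 1 (nonempty rs)) ≡ boxesFrom 1 rs
  below-rows = begin
    map (renumber φ) (boxesFrom 1 (nonempty rs))                              ≡⟨ cong (map (renumber φ)) (boxesFrom-suc 0 (nonempty rs)) ⟩
    map (renumber φ) (map (renumber suc) (boxesFrom 0 (nonempty rs)))         ≡⟨ List.map-∘ (boxesFrom 0 (nonempty rs)) ⟨
    map (renumber (suc ∘ originalRow rs)) (boxesFrom 0 (nonempty rs))         ≡⟨ List.map-∘ (boxesFrom 0 (nonempty rs)) ⟩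
    map (renumber suc) (map (renumber (originalRow rs)) (boxesFrom 0 (nonempty rs)))
                                                                              ≡⟨ cong (map (renumber suc)) (boxesFrom-nonempty rs) ⟨
    map (renumber suc) (boxesFrom 0 rs)                                       ≡⟨ boxesFrom-suc 0 rs ⟨
    boxesFrom 1 rs                                                            ∎
... | false = begin
  applyUpTo (λ j → 0 , a + j) (e ∸ a) ++ boxesFrom 1 rs                       ≡⟨ cong (λ t → applyUpTo (λ j → 0 , a + j) t ++ boxesFrom 1 rs) (ℕ.m≤n⇒m∸n≡0 e≤a) ⟩
  boxesFrom 1 rs                                                              ≡⟨ boxesFrom-suc 0 rs ⟩
  map (renumber suc) (boxesFrom 0 rs)                                         ≡⟨ cong (map (renumber suc)) (boxesFrom-nonempty rs) ⟩
  map (renumber suc) (map (renumber (originalRow rs)) (boxesFrom 0 (nonempty rs)))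
                                                                              ≡⟨ List.map-∘ (boxesFrom 0 (nonempty rs)) ⟨
  map (renumber (suc ∘ originalRow rs)) (boxesFrom 0 (nonempty rs))           ∎
  where
  open ≡-Reasoning
  e≤a : e ≤ a
  e≤a = ℕ.≮⇒≥ λ a<e → contradiction (trans (sym (<⇒<ᵇ-true a<e)) eq) λ ()

compress-rows⁺ : ∀ A → compress (boxes A) ≡ compress (boxesFrom 0 (rows⁺ A))
compress-rows⁺ A = begin
  compress (boxes A)                                                                   ≡⟨ cong compress (boxes-rows A) ⟩
  compress (boxesFrom 0 (rowsOf A))                                                    ≡⟨ cong compress (boxesFrom-nonempty (rowsOf A)) ⟩
  compress (map (renumber (originalRow (rowsOf A))) (boxesFrom 0 (rows⁺ A)))    ≡⟨ compress-map (originalRow-mono (rowsOf A)) id (boxesFrom 0 (rows⁺ A)) ⟩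
  compress (boxesFrom 0 (rows⁺ A))                                                     ∎
  where open ≡-Reasoning

rows-≤ : ∀ {α α′ β β′ rs} → α ≤ α′ → β ≤ β′ → Rows α β rs → Rows α′ β′ rs
rows-≤ α≤ β≤ []                       = []
rows-≤ α≤ β≤ (cons a<e a≤α e≤β rows) = cons a<e (≤-trans a≤α α≤) (≤-trans e≤β β≤) rows

nonempty-rows : ∀ f g h → (∀ i → f i ≥ f (suc i)) → (∀ i → g i ≥ g (suc i)) → Rows (f 0) (g 0) (nonempty (rowsFrom f g h))
nonempty-rows f g zero    f↓ g↓ = []
nonempty-rows f g (suc h) f↓ g↓ with f 0 <ᵇ g 0 in eq
... | true    =
    cons (ℕ.<ᵇ⇒< (f 0) (g 0) (subst T (sym eq) tt)) ≤-refl ≤-refl (rows-≤ (f↓ 0) (g↓ 0) (nonempty-rows (f ∘ suc) (g ∘ suc) h (f↓ ∘ suc) (g↓ ∘ suc)))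
... | false   = rows-≤ (f↓ 0) (g↓ 0) (nonempty-rows (f ∘ suc) (g ∘ suc) h (f↓ ∘ suc) (g↓ ∘ suc))

rows⁺-rows : ∀ A → Rows (part (inner A) 0) (width A) (rows⁺ A)
rows⁺-rows A = nonempty-rows (part (inner A)) (part (outer A)) (height A) (part-decreasing (inner A)) (part-decreasing (outer A))

-- Rows of the rotated shape

flipRow : ℕ → Row → Row
flipRow W (a , e) = W ∸ e , W ∸ a

rotRows : ℕ → List Row → List Row
rotRows W rs = reverse (map (flipRow W) rs)

nonempty-∷ : ∀ r {xs ys} → nonempty xs ≡ nonempty ys → nonempty (r ∷ xs) ≡ nonempty (r ∷ ys)
nonempty-∷ (a , e) eq with a <ᵇ e
... | true  = cong ((a , e) ∷_) eq
... | false = eq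

nonempty-zero : ∀ f g h → (∀ i → g i ≥ g (suc i)) → g 0 ≡ 0 → nonempty (rowsFrom f g h) ≡ []
nonempty-zero f g zero    g↓ g0 = refl
nonempty-zero f g (suc h) g↓ g0 = trans (List.filter-reject nonempty? (λ f<g → ℕ.n≮0 (subst (f 0 <_) g0 f<g)))
  (nonempty-zero (f ∘ suc) (g ∘ suc) h (g↓ ∘ suc) (ℕ.n≤0⇒n≡0 (subst (g 1 ≤_) g0 (g↓ 0))))

positivePrefix : (ℕ → ℕ) → ℕ → List ℕ
positivePrefix f h = takeWhile (0 <?_) (applyUpTo f h)

positivePrefix-zero : ∀ f h → f 0 ≡ 0 → positivePrefix f h ≡ []
positivePrefix-zero f zero    f0 = refl
positivePrefix-zero f (suc h) f0 with f 0
positivePrefix-zero f (suc h) refl | zero = refl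

positivePrefix-suc : ∀ f h {t} → f 0 ≡ suc t → positivePrefix f (suc h) ≡ f 0 ∷ positivePrefix (f ∘ suc) h
positivePrefix-suc f h f0 with f 0
positivePrefix-suc f h refl | suc t = refl

-- The zeros dropped by fromRows only lead to empty rows.
nonempty-fromRows : ∀ f g h → (∀ i → f i ≥ f (suc i)) → (∀ i → g i ≥ g (suc i)) →
  nonempty (rowsFrom (nth (positivePrefix f h)) (nth (positivePrefix g h)) (length (positivePrefix g h))) ≡ nonempty (rowsFrom f g h)
nonempty-fromRows f g zero    f↓ g↓ = refl
nonempty-fromRows f g (suc h) f↓ g↓ = cases (g 0) (f 0) refl refl
  where
  ih = nonempty-fromRows (f ∘ suc) (g ∘ suc) h (f↓ ∘ suc) (g↓ ∘ suc)
  cases : ∀ t u → g 0 ≡ t → f 0 ≡ u →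
    nonempty (rowsFrom (nth (positivePrefix f (suc h))) (nth (positivePrefix g (suc h))) (length (positivePrefix g (suc h)))) ≡
    nonempty (rowsFrom f g (suc h))
  cases zero    u       g0 f0 rewrite positivePrefix-zero g (suc h) g0 = sym (nonempty-zero f g (suc h) g↓ g0)
  cases (suc t) (suc u) g0 f0 rewrite positivePrefix-suc g h g0 | positivePrefix-suc f h f0 = nonempty-∷ (f 0 , g 0) ih
  cases (suc t) zero    g0 f0 rewrite positivePrefix-suc g h g0 | positivePrefix-zero f (suc h) f0 =
    trans (nonempty-∷ (0 , g 0) (trans (cong (λ xs → nonempty (rowsFrom (nth xs) (nth (positivePrefix (g ∘ suc) h)) (length (positivePrefix (g ∘ suc) h)))) (sym none)) ih))
          (cong (λ v → nonempty ((v , g 0) ∷ rowsFrom (f ∘ suc) (g ∘ suc) h)) (sym f0))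
    where
    none : positivePrefix (f ∘ suc) h ≡ []
    none = positivePrefix-zero (f ∘ suc) h (ℕ.n≤0⇒n≡0 (subst (f 1 ≤_) f0 (f↓ 0)))

rotRows-rowsFrom : ∀ W f g h → rowsFrom (λ i → W ∸ g (h ∸ suc i)) (λ i → W ∸ f (h ∸ suc i)) h ≡ rotRows W (rowsFrom f g h)
rotRows-rowsFrom W f g h = begin
  applyUpTo (λ i → W ∸ g (h ∸ suc i) , W ∸ f (h ∸ suc i)) h   ≡⟨ applyUpTo-reflect h (λ _ _ → refl) ⟩
  applyDownFrom (λ i → W ∸ g i , W ∸ f i) h                   ≡⟨ List.reverse-applyUpTo (λ i → W ∸ g i , W ∸ f i) h ⟨
  reverse (applyUpTo (λ i → W ∸ g i , W ∸ f i) h)             ≡⟨ cong reverse (List.map-applyUpTo (λ i → f i , g i) (flipRow W) h) ⟨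
  rotRows W (rowsFrom f g h)                                  ∎
  where open ≡-Reasoning

InRow : ℕ → Row → Set
InRow W (a , e) = a ≤ W × e ≤ W

-- With all coordinates at most `W`, truncated subtraction reverses the order, so a row is empty
-- exactly if its reflection is.
nonempty-rotRows : ∀ {W rs} → All (InRow W) rs → nonempty (rotRows W rs) ≡ rotRows W (nonempty rs)
nonempty-rotRows {W} {[]}           []                       = refl
nonempty-rotRows {W} {(a , e) ∷ rs} ((a≤W , e≤W) ∷ inside) = begin
  nonempty (reverse (flipRow W (a , e) ∷ map (flipRow W) rs))              ≡⟨ cong nonempty (List.unfold-reverse (flipRow W (a , e)) (map (flipRow W) rs)) ⟩
  nonempty (rotRows W rs ∷ʳ flipRow W (a , e))                             ≡⟨ List.filter-++ nonempty? (rotRows W rs) _ ⟩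
  nonempty (rotRows W rs) ++ nonempty (flipRow W (a , e) ∷ [])             ≡⟨ cong (_++ nonempty (flipRow W (a , e) ∷ [])) (nonempty-rotRows inside) ⟩
  rotRows W (nonempty rs) ++ nonempty (flipRow W (a , e) ∷ [])             ≡⟨ final (a <? e) ⟩
  rotRows W (nonempty ((a , e) ∷ rs))                                      ∎
  where
  open ≡-Reasoning
  final : Dec (a < e) → rotRows W (nonempty rs) ++ nonempty (flipRow W (a , e) ∷ []) ≡ rotRows W (nonempty ((a , e) ∷ rs))
  final (yes a<e) = begin
    rotRows W (nonempty rs) ++ nonempty (flipRow W (a , e) ∷ [])  ≡⟨ cong (rotRows W (nonempty rs) ++_) (List.filter-accept nonempty? (ℕ.∸-monoʳ-< a<e e≤W)) ⟩
    rotRows W (nonempty rs) ∷ʳ flipRow W (a , e)                  ≡⟨ List.unfold-reverse (flipRow W (a , e)) (map (flipRow W) (nonempty rs)) ⟨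
    rotRows W ((a , e) ∷ nonempty rs)                             ≡⟨ cong (rotRows W) (List.filter-accept nonempty? a<e) ⟨
    rotRows W (nonempty ((a , e) ∷ rs))                           ∎
  final (no a≮e) = begin
    rotRows W (nonempty rs) ++ nonempty (flipRow W (a , e) ∷ [])  ≡⟨ cong (rotRows W (nonempty rs) ++_) (List.filter-reject nonempty? (ℕ.≤⇒≯ (ℕ.∸-monoʳ-≤ W (ℕ.≮⇒≥ a≮e)))) ⟩
    rotRows W (nonempty rs) ++ []                                 ≡⟨ List.++-identityʳ (rotRows W (nonempty rs)) ⟩
    rotRows W (nonempty rs)                                       ≡⟨ cong (rotRows W) (List.filter-reject nonempty? a≮e) ⟨
    rotRows W (nonempty ((a , e) ∷ rs))                           ∎

rows⁺-° : ∀ A → rows⁺ (A °) ≡ rotRows (width A) (rows⁺ A)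
rows⁺-° A = begin
  rows⁺ (A °)
    ≡⟨ nonempty-fromRows (λ i → W ∸ part (outer A) (h ∸ suc i)) (λ i → W ∸ part (inner A) (h ∸ suc i)) h (flip↓ (outer A)) (flip↓ (inner A)) ⟩
  nonempty (rowsFrom (λ i → W ∸ part (outer A) (h ∸ suc i)) (λ i → W ∸ part (inner A) (h ∸ suc i)) h)
    ≡⟨ cong nonempty (rotRows-rowsFrom W (part (inner A)) (part (outer A)) h) ⟩
  nonempty (rotRows W (rowsOf A))
    ≡⟨ nonempty-rotRows (All.applyUpTo⁺₂ _ h (λ i → ≤-trans (inner⊆outer A i) (part-antitone (outer A) z≤n) , part-antitone (outer A) z≤n)) ⟩
  rotRows W (rows⁺ A) ∎
  where
  open ≡-Reasoning
  W = width A
  h = height A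
  flip↓ : ∀ p i → W ∸ part p (h ∸ suc i) ≥ W ∸ part p (h ∸ suc (suc i))
  flip↓ p i = ℕ.∸-monoʳ-≤ W (part-antitone p (ℕ.∸-monoʳ-≤ h (ℕ.n≤1+n (suc i))))

-- The boxes of the rotated rows

boxesFrom-∷ʳ : ∀ k rs a e → boxesFrom k (rs ∷ʳ (a , e)) ≡ boxesFrom k rs ++ applyUpTo (λ j → k + length rs , a + j) (e ∸ a)
boxesFrom-∷ʳ k []             a e = trans (List.++-identityʳ _) (cong (λ r → applyUpTo (λ j → r , a + j) (e ∸ a)) (sym (+-identityʳ k)))
boxesFrom-∷ʳ k ((b , d) ∷ rs) a e = trans
  (cong (applyUpTo (λ j → k , b + j) (d ∸ b) ++_) (trans (boxesFrom-∷ʳ (suc k) rs a e)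
    (cong (λ r → boxesFrom (suc k) rs ++ applyUpTo (λ j → r , a + j) (e ∸ a)) (sym (+-suc k (length rs))))))
  (sym (List.++-assoc (applyUpTo (λ j → k , b + j) (d ∸ b)) (boxesFrom (suc k) rs) _))

-- Rows are numbered from 0 here, so the rows k, …, k + length rs - 1 are reflected in k + length rs - 1.
boxesFrom-rotRows : ∀ {W} rs → All (InRow W) rs → ∀ k →
                    boxesFrom 0 (rotRows W rs) ≡ rotateBoxes (k + length rs ∸ 1) (W ∸ 1) (boxesFrom k rs)
boxesFrom-rotRows {W} []             []                       k = refl
boxesFrom-rotRows {W} ((a , e) ∷ rs) ((a≤W , e≤W) ∷ inside) k = begin
  boxesFrom 0 (reverse (flipRow W (a , e) ∷ map (flipRow W) rs))
    ≡⟨ cong (boxesFrom 0) (List.unfold-reverse (flipRow W (a , e)) (map (flipRow W) rs)) ⟩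
  boxesFrom 0 (rotRows W rs ∷ʳ flipRow W (a , e))
    ≡⟨ boxesFrom-∷ʳ 0 (rotRows W rs) (W ∸ e) (W ∸ a) ⟩
  boxesFrom 0 (rotRows W rs) ++ applyUpTo (λ j → length (rotRows W rs) , W ∸ e + j) (W ∸ a ∸ (W ∸ e))
    ≡⟨ cong₂ _++_ (boxesFrom-rotRows rs inside (suc k)) rotated-row ⟩
  rotateBoxes (k + length rs) (W ∸ 1) (boxesFrom (suc k) rs) ++ reverse (map (flip (k + length rs) (W ∸ 1)) first)
    ≡⟨ List.reverse-++ (map (flip (k + length rs) (W ∸ 1)) first) (map (flip (k + length rs) (W ∸ 1)) (boxesFrom (suc k) rs)) ⟨
  reverse (map (flip (k + length rs) (W ∸ 1)) first ++ map (flip (k + length rs) (W ∸ 1)) (boxesFrom (suc k) rs))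
    ≡⟨ cong reverse (List.map-++ (flip (k + length rs) (W ∸ 1)) first (boxesFrom (suc k) rs)) ⟨
  rotateBoxes (k + length rs) (W ∸ 1) (first ++ boxesFrom (suc k) rs)
    ≡⟨ cong (λ H → rotateBoxes (H ∸ 1) (W ∸ 1) (first ++ boxesFrom (suc k) rs)) (sym (+-suc k (length rs))) ⟩
  rotateBoxes (k + suc (length rs) ∸ 1) (W ∸ 1) (boxesFrom k ((a , e) ∷ rs)) ∎
  where
  open ≡-Reasoning
  first : List Box
  first = applyUpTo (λ j → k , a + j) (e ∸ a)
  rows≡ : length (rotRows W rs) ≡ length rs
  rows≡ = trans (List.length-reverse (map (flipRow W) rs)) (List.length-map (flipRow W) rs)
  lengths : W ∸ a ∸ (W ∸ e) ≡ e ∸ a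
  lengths = (width-lemma (ℕ.≤-total a e))
    where
    width-lemma : a ≤ e ⊎ e ≤ a → W ∸ a ∸ (W ∸ e) ≡ e ∸ a
    width-lemma (inj₁ a≤e) = trans (ℕ.∸-+-assoc W a (W ∸ e)) (trans (cong (W ∸_) (+-comm a (W ∸ e)))
      (trans (sym (ℕ.∸-+-assoc W (W ∸ e) a)) (cong (_∸ a) (ℕ.m∸[m∸n]≡n e≤W))))
    width-lemma (inj₂ e≤a) = trans (ℕ.m≤n⇒m∸n≡0 (ℕ.∸-monoʳ-≤ W e≤a)) (sym (ℕ.m≤n⇒m∸n≡0 e≤a))
  same-box : ∀ j → j < e ∸ a → (length (rotRows W rs) , W ∸ e + j) ≡ flip (k + length rs) (W ∸ 1) (k , a + (e ∸ a ∸ suc j))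
  same-box j j< = cong₂ _,_ (trans rows≡ (sym (ℕ.m+n∸m≡n k (length rs)))) (sym (begin
    W ∸ 1 ∸ (a + (e ∸ a ∸ suc j))     ≡⟨ ℕ.∸-+-assoc W 1 (a + (e ∸ a ∸ suc j)) ⟩
    W ∸ suc (a + (e ∸ a ∸ suc j))     ≡⟨ cong (W ∸_) shift ⟩
    W ∸ (e ∸ j)                       ≡⟨ cong (_∸ (e ∸ j)) (ℕ.m∸n+n≡m e≤W) ⟨
    W ∸ e + e ∸ (e ∸ j)               ≡⟨ ℕ.+-∸-assoc (W ∸ e) (ℕ.m∸n≤m e j) ⟩
    W ∸ e + (e ∸ (e ∸ j))             ≡⟨ cong (W ∸ e +_) (ℕ.m∸[m∸n]≡n j≤e) ⟩
    W ∸ e + j                         ∎))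
    where
    j≤e : j ≤ e
    j≤e = ≤-trans (ℕ.<⇒≤ j<) (ℕ.m∸n≤m e a)
    a≤e : a ≤ e
    a≤e = ℕ.<⇒≤ (ℕ.m∸n≢0⇒n<m (λ eq → ℕ.n≮0 (subst (j <_) eq j<)))
    shift : suc (a + (e ∸ a ∸ suc j)) ≡ e ∸ j
    shift = begin
      suc (a + (e ∸ a ∸ suc j))   ≡⟨ +-suc a (e ∸ a ∸ suc j) ⟨
      a + suc (e ∸ a ∸ suc j)     ≡⟨ cong (a +_) (ℕ.+-∸-assoc 1 j<) ⟨
      a + (e ∸ a ∸ j)             ≡⟨ ℕ.+-∸-assoc a (ℕ.<⇒≤ j<) ⟨
      a + (e ∸ a) ∸ j             ≡⟨ cong (_∸ j) (ℕ.m+[n∸m]≡n a≤e) ⟩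
      e ∸ j                       ∎
  rotated-row : applyUpTo (λ j → length (rotRows W rs) , W ∸ e + j) (W ∸ a ∸ (W ∸ e)) ≡ reverse (map (flip (k + length rs) (W ∸ 1)) first)
  rotated-row = begin
    applyUpTo (λ j → length (rotRows W rs) , W ∸ e + j) (W ∸ a ∸ (W ∸ e))    ≡⟨ cong (applyUpTo (λ j → length (rotRows W rs) , W ∸ e + j)) lengths ⟩
    applyUpTo (λ j → length (rotRows W rs) , W ∸ e + j) (e ∸ a)              ≡⟨ applyUpTo-reflect (e ∸ a) same-box ⟩
    applyDownFrom (λ j → flip (k + length rs) (W ∸ 1) (k , a + j)) (e ∸ a)   ≡⟨ List.reverse-applyUpTo _ (e ∸ a) ⟨
    reverse (applyUpTo (λ j → flip (k + length rs) (W ∸ 1) (k , a + j)) (e ∸ a))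
                                                                             ≡⟨ cong reverse (List.map-applyUpTo (λ j → k , a + j) _ (e ∸ a)) ⟨
    reverse (map (flip (k + length rs) (W ∸ 1)) first)                       ∎

bounded : ∀ bs → ∃₂ λ H W → All (Inside H W) bs
bounded []             = 0 , 0 , []
bounded ((r , c) ∷ bs) with bounded bs
... | H , W , inside = r ⊔ H , c ⊔ W , (ℕ.m≤m⊔n r H , ℕ.m≤m⊔n c W) ∷
  All.map (λ (r≤ , c≤) → ℕ.m≤n⇒m≤o⊔n r r≤ , ℕ.m≤n⇒m≤o⊔n c c≤) inside

-- Both sides agree with the rotation of the common compression; the rectangles used for rotating
-- only have to contain the boxes.
compress-rotate : ∀ {H W H′ W′} bs cs → All (Inside H W) bs → All (Inside H′ W′) cs → compress bs ≡ compress cs →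
                  compress (rotateBoxes H W bs) ≡ compress (rotateBoxes H′ W′ cs)
compress-rotate bs cs in-bs in-cs eq = trans (half bs in-bs (subst (All _) (sym eq) in-c))
  (trans (cong (λ ds → compress (rotateBoxes (proj₁ bound) (proj₁ (proj₂ bound)) ds)) eq) (sym (half cs in-cs in-c)))
  where
  bound = bounded (compress cs)
  in-c : All (Inside (proj₁ bound) (proj₁ (proj₂ bound))) (compress cs)
  in-c = proj₂ (proj₂ bound)
  half : ∀ {H W H″ W″} bs → All (Inside H W) bs → All (Inside H″ W″) (compress bs) →
         compress (rotateBoxes H W bs) ≡ compress (rotateBoxes H″ W″ (compress bs))
  half {H} {W} {H″} {W″} bs in-bs in-c = subst₂ (λ xs ys → compress (rotateBoxes H W xs) ≡ compress (rotateBoxes H″ W″ ys))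
    (proj₁-withCompressed bs) (proj₂-withCompressed bs)
    (rotateBoxes-matching (withCompressed-matching bs)
      (All.map⁺ in-bs) (All.map⁺ (All.map⁻ in-c)))

between-bounds : ∀ {rs W i c} → All (InRow W) rs → Between (starts rs) (ends rs) (i , c) → i < length rs × c < W
between-bounds ((_ , e≤W) ∷ _) (here _ c<e) = s≤s z≤n , ℕ.<-≤-trans c<e e≤W
between-bounds (_ ∷ inside)    (there y)    = let i< , c< = between-bounds inside y in s≤s i< , c<

boxesFrom-inside : ∀ {W rs} → All (InRow W) rs → All (Inside (length rs ∸ 1) (W ∸ 1)) (boxesFrom 0 rs)
boxesFrom-inside {W} {rs} inside = All.tabulate λ y∈ → from-between (∈-boxesFrom⁻ 0 rs y∈)
  where
  from-between : ∀ {y} → ∃[ i ] row y ≡ i × Between (starts rs) (ends rs) (i , col y) → Inside (length rs ∸ 1) (W ∸ 1) y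
  from-between (i , refl , y) = let i< , c< = between-bounds inside y in ℕ.∸-monoˡ-≤ 1 i< , ℕ.∸-monoˡ-≤ 1 c<

rowsOf-inside : ∀ A → All (InRow (width A)) (rowsOf A)
rowsOf-inside A = All.applyUpTo⁺₂ _ (height A) λ i →
  ≤-trans (inner⊆outer A i) (part-antitone (outer A) z≤n) , part-antitone (outer A) z≤n

rows⁺-inside : ∀ A → All (InRow (width A)) (rows⁺ A)
rows⁺-inside A = All.filter⁺ nonempty? (rowsOf-inside A)

-- Replaces the rectangle fixed by `_°` with an arbitrary one containing the boxes.
compress-° : ∀ A {H W} → All (Inside H W) (boxes A) → compress (boxes (A °)) ≡ compress (rotateBoxes H W (boxes A))
compress-° A {H} {W} inside = begin
  compress (boxes (A °))                                      ≡⟨ compress-rows⁺ (A °) ⟩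
  compress (boxesFrom 0 (rows⁺ (A °)))                        ≡⟨ cong (compress ∘ boxesFrom 0) (rows⁺-° A) ⟩
  compress (boxesFrom 0 (rotRows (width A) (rows⁺ A)))        ≡⟨ cong compress (boxesFrom-rotRows (rows⁺ A) (rows⁺-inside A) 0) ⟩
  compress (rotateBoxes (length (rows⁺ A) ∸ 1) (width A ∸ 1) (boxesFrom 0 (rows⁺ A)))
    ≡⟨ compress-rotate (boxesFrom 0 (rows⁺ A)) (boxes A) (boxesFrom-inside (rows⁺-inside A)) inside (sym (compress-rows⁺ A)) ⟩
  compress (rotateBoxes H W (boxes A))                        ∎
  where open ≡-Reasoning

°-cong : ∀ {A B} → A ≋ B → A ° ≋ B °
°-cong {A} {B} A≋B = let _ , _ , in-A = bounded (boxes A) ; _ , _ , in-B = bounded (boxes B) in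
  trans (compress-° A in-A) (trans (compress-rotate (boxes A) (boxes B) in-A in-B A≋B) (sym (compress-° B in-B)))

rotateBoxes-involutive : ∀ {H W bs} → All (Inside H W) bs → rotateBoxes H W (rotateBoxes H W bs) ≡ bs
rotateBoxes-involutive {H} {W} {bs} inside = begin
  reverse (map (flip H W) (reverse (map (flip H W) bs)))   ≡⟨ cong reverse (List.reverse-map (flip H W) (map (flip H W) bs)) ⟩
  reverse (reverse (map (flip H W) (map (flip H W) bs)))   ≡⟨ List.reverse-involutive _ ⟩
  map (flip H W) (map (flip H W) bs)                       ≡⟨ List.map-∘ bs ⟨
  map (flip H W ∘ flip H W) bs                             ≡⟨ List.map-id-local (All.map (λ (r≤ , c≤) → cong₂ _,_ (ℕ.m∸[m∸n]≡n r≤) (ℕ.m∸[m∸n]≡n c≤)) inside) ⟩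
  bs                                                       ∎
  where open ≡-Reasoning

rotateBoxes-inside : ∀ {H W} bs → All (Inside H W) (rotateBoxes H W bs)
rotateBoxes-inside {H} {W} bs = All.tabulate λ y∈ → flipped-inside (∈-map⁻ (flip H W) (Any.reverse⁻ y∈))
  where
  flipped-inside : ∀ {y} → ∃[ x ] x ∈ bs × y ≡ flip H W x → Inside H W y
  flipped-inside ((r , c) , _ , refl) = ℕ.m∸n≤m H r , ℕ.m∸n≤m W c

-- Only up to `_≋_`: empty rows and columns at the border may disappear in a rotation.
°-involutive : ∀ A → A ° ° ≋ A
°-involutive A = let H , W , in-A = bounded (boxes A) ; _ , _ , in-A° = bounded (boxes (A °)) in
  trans (compress-° (A °) in-A°)
    (trans (compress-rotate (boxes (A °)) (rotateBoxes H W (boxes A)) in-A° (rotateBoxes-inside (boxes A)) (compress-° A in-A))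
      (cong compress (rotateBoxes-involutive in-A)))

Has-° : ∀ A {β} → Has (lookup (boxes A)) β → Has (lookup (boxes (A °))) (reverse β)
Has-° A has = let H , W , in-A = bounded (boxes A) in
  Has-≡compress {rotateBoxes H W (boxes A)} {boxes (A °)} (sym (compress-° A in-A)) (Has-rotateBoxes in-A has)

-- The descent vectors of the good shapes

-- The square (2,2) is `two-row 0`; accordingly `two-col` begins with a row of one box below the
-- square.
data Type : Set where
  hook disjoint   : (m k : ℕ) → Type
  two-row two-col : ℕ → Type
  3-3 4-4 2-2-2 2-2-2-2 : Type

shape : Type → List Row
shape (hook m k)  = (0 , suc m) ∷ cells 0 k
shape (disjoint m k) = (1 , 2 + m) ∷ cells 0 (suc k)
shape (two-row m) = (0 , 2 + m) ∷ (0 , 2) ∷ []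
shape (two-col k) = (0 , 2) ∷ (0 , 2) ∷ cells 0 (suc k)
shape 3-3         = (0 , 3) ∷ (0 , 3) ∷ []
shape 4-4         = (0 , 4) ∷ (0 , 4) ∷ []
shape 2-2-2       = replicate 3 (0 , 2)
shape 2-2-2-2     = replicate 4 (0 , 2)

trues : List Bool → ℕ
trues []          = 0
trues (true ∷ β)  = suc (trues β)
trues (false ∷ β) = trues β

-- The columns of cells, with the first j cells filled.
column : ℕ → ℕ → List ℕ
column j r = replicate j 1 ++ replicate r 0

no-step-at-0 : ∀ {r i ps} → ¬ Step 0 (replicate r 0) i ps
no-step-at-0 {suc r} (here ())
no-step-at-0 {suc r} (there s) = no-step-at-0 {r} s

column-step : ∀ {x i ps N} j r → Step x (column j r) i ps → ps ≤* replicate N 1 →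
              ∃[ r′ ] r ≡ suc r′ × i ≡ j × ps ≡ column (suc j) r′
column-step zero    (suc r) (here _)  _                  = r , refl , refl , refl
column-step zero    (suc r) (there s) _                  = contradiction s (no-step-at-0 {r})
column-step {N = suc N} (suc j) r (here _)  (s≤s () ∷ _)
column-step {N = suc N} (suc j) r (there s) (_ ∷ le) with column-step {N = N} j r s le
... | r′ , refl , refl , refl = r′ , refl , refl , refl

column-step⁺ : ∀ {x} j r → 0 < x → Step x (column j (suc r)) j (column (suc j) r)
column-step⁺ zero    r 0<x = here 0<x
column-step⁺ (suc j) r 0<x = there (column-step⁺ j r (s≤s z≤n))

column-full⁻ : ∀ {N} j r → column j r ≡ replicate N 1 → r ≡ 0
column-full⁻         zero    zero    _  = refl
column-full⁻ {suc N} zero    (suc r) ()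
column-full⁻ {suc N} (suc j) r       eq = column-full⁻ j r (List.∷-injectiveʳ eq)

column-full⁺ : ∀ {N} j → j + 0 ≡ N → column j 0 ≡ replicate N 1
column-full⁺ j refl = trans (List.++-identityʳ (replicate j 1)) (cong (λ k → replicate k 1) (sym (+-identityʳ j)))

≤⇒<ᵇsuc : ∀ {y j} → y ≤ j → (y <ᵇ suc j) ≡ true
≤⇒<ᵇsuc y≤j = <⇒<ᵇ-true (s≤s y≤j)

-- `y` is the previous letter. The next cell of the column is in row `suc j`, below it, so a letter
-- of the column is always an ascent and a letter 0 never: the ascents are the `r` cells still to be
-- filled.
row-column⁻ : ∀ {b x x′ ps w qs N} j r → Path b ps w qs → ps ≡ x ∷ column j r → qs ≡ x′ ∷ replicate N 1 →
              ∀ {y} → y ≤ j → trues (ascentsFrom y w) ≡ r × length (ascentsFrom y w) + x ≡ x′ + r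
row-column⁻ {N = N} j r [] refl eq y≤j with column-full⁻ {N} j r (List.∷-injectiveʳ eq) | List.∷-injectiveˡ eq
... | refl | refl = refl , sym (+-identityʳ _)
row-column⁻ {x = x} j r (here _ ∷ π) refl eq y≤j = let tr , len = row-column⁻ j r π refl eq z≤n in tr , trans (sym (+-suc _ x)) len
row-column⁻ {x′ = x′} {N = N} j r (there s ∷ π) refl refl {y} y≤j with path-≤* π
... | _ ∷ le with column-step {N = N} j r s le
...   | r′ , refl , refl , refl rewrite ≤⇒<ᵇsuc y≤j =
  let tr , len = row-column⁻ (suc j) r′ π refl refl ≤-refl in cong suc tr , trans (cong suc len) (sym (+-suc x′ r′))

trues≤length : ∀ β → trues β ≤ length β
trues≤length []          = z≤n
trues≤length (true ∷ β)  = s≤s (trues≤length β)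
trues≤length (false ∷ β) = ℕ.m≤n⇒m≤1+n (trues≤length β)

-- Reads `γ` as instructions: `true` fills the next cell of the column, `false` the next of the `s`
-- boxes left in the row. The two counts ensure that neither supply runs out.
row-column⁺ : ∀ {b x x′ N} j r s γ → length γ ≡ s + r → trues γ ≡ r → 0 < x → s + x ≡ x′ → x′ ≤ b → j + r ≡ N → ∀ {y} → y ≤ j →
              ∃[ w ] Path b (x ∷ column j r) w (x′ ∷ replicate N 1) × ascentsFrom y w ≡ γ
row-column⁺ {b} {x} j r zero [] len refl 0<x refl x≤b jr y≤j =
  [] , subst (λ ps → Path b (x ∷ column j 0) [] (x ∷ ps)) (column-full⁺ j jr) [] , refl
row-column⁺ j r zero    (false ∷ γ) len tr 0<x sx x≤b jr y≤j =
  contradiction (ℕ.≤-trans (ℕ.≤-reflexive (trans len (sym tr))) (trues≤length γ)) ℕ.1+n≰n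
row-column⁺ {x = x} j r (suc s) (false ∷ γ) len tr 0<x refl x≤b jr y≤j
  with row-column⁺ j r s γ (ℕ.suc-injective len) tr (s≤s z≤n) (+-suc s x) x≤b jr {0} z≤n
... | w , π , eq = 0 ∷ w , here (≤-trans (s≤s (ℕ.m≤n+m x s)) x≤b) ∷ π , cong (false ∷_) eq
row-column⁺ j (suc r) s (true ∷ γ) len tr 0<x sx x≤b jr y≤j
  with row-column⁺ (suc j) r s γ (ℕ.suc-injective (trans len (+-suc s r))) (ℕ.suc-injective tr) 0<x sx x≤b (trans (sym (+-suc j r)) jr) {suc j} ≤-refl
... | w , π , eq = suc j ∷ w , there (column-step⁺ j r 0<x) ∷ π , cong₂ _∷_ (≤⇒<ᵇsuc y≤j) eq

-- Vectors of length m + 3, constant `x` except for one `y` not at either end, or for two `y` that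
-- are not adjacent.
data Sparse (x y : Bool) (m : ℕ) : List Bool → Set where
  single : ∀ i j   → i + j ≡ m     → Sparse x y m (replicate (suc i) x ++ y ∷ replicate (suc j) x)
  double : ∀ i j l → i + j + l ≡ m → Sparse x y m (replicate i x ++ y ∷ replicate (suc j) x ++ y ∷ replicate l x)

-- Enumeration of all paths of a given length

pathsFrom : ℕ → ℕ → List ℕ → List (List ℕ × List ℕ)
stepsFrom : ℕ → ℕ → ℕ → List ℕ × Bool → List (List ℕ × List ℕ)
pathsFrom zero    b ps = ([] , ps) ∷ []
pathsFrom (suc l) b ps = concatMap (λ i → stepsFrom l b i (stepᵇ b ps i)) (upTo (length ps))
stepsFrom l b i (σ , true)  = map (λ (w , qs) → i ∷ w , qs) (pathsFrom l b σ)
stepsFrom l b i (σ , false) = []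

step-complete : ∀ {b ps i qs} → Step b ps i qs → stepᵇ b ps i ≡ (qs , true)
step-complete (here {x = x} {ps} x<b) = cong (suc x ∷ ps ,_) (<⇒<ᵇ-true x<b)
step-complete (there s)  = cong (λ (qs , t) → _ ∷ qs , t) (step-complete s)

pathsFrom-complete : ∀ {b ps w qs} → Path b ps w qs → (w , qs) ∈ pathsFrom (length w) b ps
pathsFrom-complete []                              = here refl
pathsFrom-complete {b} {ps} (_∷_ {i = i} {ps′} {w} s π) =
  ∈-concatMap⁺ (λ i → stepsFrom (length w) b i (stepᵇ b ps i)) (lose (∈-upTo⁺ (step-row s)) in-step)
  where
  in-step : (i ∷ w , _) ∈ stepsFrom (length w) b i (stepᵇ b ps i)
  in-step rewrite step-complete s = ∈-map⁺ (λ (w , qs) → i ∷ w , qs) (pathsFrom-complete π)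

pathsFrom-sound : ∀ l b ps {w qs} → (w , qs) ∈ pathsFrom l b ps → Path b ps w qs
pathsFrom-sound zero    b ps (here refl) = []
pathsFrom-sound (suc l) b ps w∈
  with find (∈-concatMap⁻ (λ i → stepsFrom l b i (stepᵇ b ps i)) {xs = upTo (length ps)} w∈)
... | i , _ , w∈i with stepᵇ b ps i in eq
...   | σ , true with ∈-map⁻ _ w∈i
...     | _ , w′∈ , refl = subst (λ τ → Step b ps i (proj₁ τ)) eq (step-sound b ps i (subst (T ∘ proj₂) (sym eq) tt)) ∷ pathsFrom-sound l b σ w′∈

vectorsOf : ℕ → ℕ → List ℕ → List (List Bool)
vectorsOf l b ps = map (ascents ∘ proj₁) (pathsFrom l b ps)

Form : Type → List Bool → Set
Form (hook m k)  β = length β ≡ m + k × trues β ≡ k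
Form (disjoint m k) β = length β ≡ suc (m + k) × (trues β ≡ k ⊎ trues β ≡ suc k)
Form (two-row m) β = Sparse false true m β
Form (two-col k) β = Sparse true false (suc k) β
Form 3-3         β = β ∈ vectorsOf 6 3 (0 ∷ 0 ∷ [])
Form 4-4         β = β ∈ vectorsOf 8 4 (0 ∷ 0 ∷ [])
Form 2-2-2       β = β ∈ vectorsOf 6 2 (0 ∷ 0 ∷ 0 ∷ [])
Form 2-2-2-2     β = β ∈ vectorsOf 8 2 (0 ∷ 0 ∷ 0 ∷ 0 ∷ [])

HasPath : ℕ → List ℕ → List ℕ → List Bool → Set
HasPath b ps qs β = ∃[ w ] Path b ps w qs × ascents w ≡ β

-- The corner is filled first; afterwards exactly the k boxes of the leg are descents, in arbitrary
-- positions.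
hook⇔ : ∀ {m k β} → HasPath (suc m) (0 ∷ replicate k 0) (suc m ∷ replicate k 1) β ⇔ Form (hook m k) β
hook⇔ {m} {k} = mk⇔ to from
  where
  to : ∀ {β} → HasPath (suc m) (0 ∷ replicate k 0) (suc m ∷ replicate k 1) β → Form (hook m k) β
  to (_ , (there s ∷ π) , _)    = contradiction s (no-step-at-0 {k})
  to (_ , (here _ ∷ π)  , refl) = let tr , len = row-column⁻ 0 k π refl refl z≤n in
    ℕ.suc-injective (trans (+-comm 1 _) len) , tr
  from : ∀ {β} → Form (hook m k) β → HasPath (suc m) (0 ∷ replicate k 0) (suc m ∷ replicate k 1) β
  from {β} (len , tr) = let w , π , eq = row-column⁺ 0 k m β len tr (s≤s z≤n) (+-comm m 1) ≤-refl refl {0} z≤n in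
    0 ∷ w , here (s≤s z≤n) ∷ π , eq

-- If the word starts in the row, each of the k + 1 cells of the column is an ascent; if it starts
-- in the column, the first letter is preceded by nothing and one ascent is lost.
disjoint⇔ : ∀ {m k β} → HasPath (2 + m) (1 ∷ replicate (suc k) 0) (2 + m ∷ replicate (suc k) 1) β ⇔ Form (disjoint m k) β
disjoint⇔ {m} {k} = mk⇔ to from
  where
  to : ∀ {β} → HasPath (2 + m) (1 ∷ replicate (suc k) 0) (2 + m ∷ replicate (suc k) 1) β → Form (disjoint m k) β
  to (_ , (here _ ∷ π)  , refl) = let tr , len = row-column⁻ 0 (suc k) π refl refl z≤n in
    ℕ.+-cancelʳ-≡ 2 _ (suc (m + k)) (trans len (trans (cong (2 +_) (+-suc m k)) (+-comm 2 (suc (m + k))))) , inj₂ tr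
  to (_ , (there s ∷ π) , refl) with path-≤* π
  ... | _ ∷ le with column-step {N = suc k} 0 (suc k) s le
  ...   | .k , refl , refl , refl = let tr , len = row-column⁻ 1 k π refl refl (s≤s z≤n) in
    ℕ.suc-injective (trans (+-comm 1 _) len) , inj₁ tr
  from : ∀ {β} → Form (disjoint m k) β → HasPath (2 + m) (1 ∷ replicate (suc k) 0) (2 + m ∷ replicate (suc k) 1) β
  from {β} (len , inj₂ tr) =
    let w , π , eq = row-column⁺ 0 (suc k) m β (trans len (sym (+-suc m k))) tr (s≤s z≤n) (+-comm m 2) ≤-refl refl {0} z≤n in
    0 ∷ w , here (s≤s (s≤s z≤n)) ∷ π , eq
  from {β} (len , inj₁ tr) =
    let w , π , eq = row-column⁺ 1 k (suc m) β len tr (s≤s z≤n) (+-comm (suc m) 1) ≤-refl refl {1} ≤-refl in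
    1 ∷ w , there (column-step⁺ 0 k (s≤s z≤n)) ∷ π , eq

-- Two rows: the letters 1 stand at two places, the first one not at the beginning.

two-row-0⁻ : ∀ {b x X w} → Path b (x ∷ 2 ∷ []) w (X ∷ 2 ∷ []) → ∃[ z ] w ≡ replicate z 0 × z + x ≡ X
two-row-0⁻ []                   = 0 , refl , refl
two-row-0⁻ {x = x} (here _ ∷ π) with two-row-0⁻ π
... | z , refl , eq = suc z , refl , trans (sym (+-suc z x)) eq
two-row-0⁻ (there (here _) ∷ π) with path-≤* π
... | _ ∷ (s≤s (s≤s ()) ∷ _)

two-row-1⁻ : ∀ {b x X w} → Path b (x ∷ 1 ∷ []) w (X ∷ 2 ∷ []) →
             ∃₂ λ y z → w ≡ replicate y 0 ++ 1 ∷ replicate z 0 × 1 < y + x × z + (y + x) ≡ X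
two-row-1⁻ {x = x} (here _ ∷ π) with two-row-1⁻ π
... | y , z , refl , lt , eq = suc y , z , refl , subst (1 <_) (+-suc y x) lt , trans (cong (z +_) (sym (+-suc y x))) eq
two-row-1⁻ (there (here 1<x) ∷ π) with two-row-0⁻ π
... | z , refl , eq = 0 , z , refl , 1<x , eq

-- `x` boxes of the first row are filled already. The inequalities say that the second row stays
-- shorter: its first box needs one box above, its second box two.
two-row-2⁻ : ∀ {b x X w} → Path b (x ∷ 0 ∷ []) w (X ∷ 2 ∷ []) →
             ∃₂ λ u y → ∃[ z ] w ≡ replicate u 0 ++ 1 ∷ replicate y 0 ++ 1 ∷ replicate z 0 × 0 < u + x × 1 < y + (u + x) × z + (y + (u + x)) ≡ X
two-row-2⁻ {x = x} (here _ ∷ π) with two-row-2⁻ π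
... | u , y , z , refl , lt , lt′ , eq = suc u , y , z , refl , s≤s z≤n ,
  subst (λ t → 1 < y + t) (+-suc u x) lt′ , trans (cong (λ t → z + (y + t)) (sym (+-suc u x))) eq
two-row-2⁻ (there (here 0<x) ∷ π) with two-row-1⁻ π
... | y , z , refl , lt , eq = 0 , y , z , refl , 0<x , lt , eq

replicate-false : ∀ z → ascentsFrom 0 (replicate z 0) ≡ replicate z false
replicate-false zero    = refl
replicate-false (suc z) = cong (false ∷_) (replicate-false z)

after-1 : ∀ z → ascentsFrom 1 (replicate z 0) ≡ replicate z false
after-1 zero    = refl
after-1 (suc z) = cong (false ∷_) (replicate-false z)

ascents-11 : ∀ u z → ascentsFrom 0 (replicate u 0 ++ 1 ∷ 1 ∷ replicate z 0) ≡ replicate u false ++ true ∷ false ∷ replicate z false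
ascents-11 u z = trans (ascentsFrom-replicate 0 u _) (cong (λ γ → replicate u false ++ true ∷ false ∷ γ) (after-1 z))

ascents-1-1 : ∀ u y z → ascentsFrom 0 (replicate u 0 ++ 1 ∷ replicate (suc y) 0 ++ 1 ∷ replicate z 0) ≡
              replicate u false ++ true ∷ replicate (suc y) false ++ true ∷ replicate z false
ascents-1-1 u y z = trans (ascentsFrom-replicate 0 u _)
  (cong (λ γ → replicate u false ++ true ∷ false ∷ γ)
    (trans (ascentsFrom-replicate 0 y _) (cong (λ γ → replicate y false ++ true ∷ γ) (after-1 z))))

two-row⇔ : ∀ {m β} → HasPath (2 + m) (0 ∷ 0 ∷ []) (2 + m ∷ 2 ∷ []) β ⇔ Form (two-row m) β
two-row⇔ {m} = mk⇔ (λ (w , π , eq) → to (two-row-2⁻ π) eq) from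
  where
  to : ∀ {w β} → (∃₂ λ u y → ∃[ z ] w ≡ replicate u 0 ++ 1 ∷ replicate y 0 ++ 1 ∷ replicate z 0 × 0 < u + 0 × 1 < y + (u + 0) × z + (y + (u + 0)) ≡ 2 + m) →
       ascents w ≡ β → Form (two-row m) β
  to (suc (suc u) , zero  , z , refl , _ , _ , eq) refl = subst (Sparse false true m) (sym (ascents-11 (suc u) z))
    (single u z (trans (+-comm u z) (ℕ.+-cancelˡ-≡ 2 _ _ (trans (sym (trans (+-suc z (suc (u + 0))) (cong suc (trans (+-suc z (u + 0)) (cong (λ t → suc (z + t)) (+-identityʳ u)))))) eq))))
  to (suc zero    , zero  , z , refl , _ , s≤s () , eq)
  to (suc u       , suc y , z , refl , _ , _ , eq) refl = subst (Sparse false true m) (sym (ascents-1-1 u y z))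
    (double u y z (ℕ.+-cancelˡ-≡ 2 _ _ (trans (arith u y z) eq)))
    where
    arith : ∀ u y z → 2 + (u + y + z) ≡ z + (suc y + (suc u + 0))
    arith = solve-∀
  from : ∀ {β} → Form (two-row m) β → HasPath (2 + m) (0 ∷ 0 ∷ []) (2 + m ∷ 2 ∷ []) β
  from (single i j refl) = replicate (2 + i) 0 ++ 1 ∷ 1 ∷ replicate j 0 ,
    run₀ (2 + i) (+-identityʳ (2 + i)) (s≤s (s≤s (ℕ.m≤m+n i j))) ▷
    (there (here (s≤s z≤n)) ∷ there (here (s≤s (s≤s z≤n))) ∷ run₀ j (trans (+-comm j (2 + i)) refl) ≤-refl) ,
    ascents-11 (suc i) j
  from (double i j l refl) = replicate (suc i) 0 ++ 1 ∷ replicate (suc j) 0 ++ 1 ∷ replicate l 0 ,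
    run₀ (suc i) (+-identityʳ (suc i)) (s≤s (ℕ.m≤n⇒m≤1+n (ℕ.≤-trans (ℕ.m≤m+n i j) (ℕ.m≤m+n (i + j) l)))) ▷
    (there (here (s≤s z≤n)) ∷ (run₀ (suc j) (trans (cong suc (+-suc j i)) (cong (2 +_) (+-comm j i))) (s≤s (s≤s (ℕ.m≤m+n (i + j) l))) ▷
    (there (here (s≤s (s≤s z≤n))) ∷ run₀ l (+-comm l (2 + (i + j))) ≤-refl))) ,
    ascents-1-1 i j l

-- Two columns: the first column is read in order, the letters 0 and 1 appear once more, in this order.

module _ {b N : ℕ} where

  private
    full : List ℕ
    full = 2 ∷ 2 ∷ replicate N 1

  second-done⁻ : ∀ {ps w qs} j r → Path b ps w qs → ps ≡ 2 ∷ 2 ∷ column j r → qs ≡ full →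
                 ∀ {y} → y ≤ suc j → ascentsFrom y w ≡ replicate r true
  second-done⁻ j r [] refl eq y≤ rewrite column-full⁻ {N} j r (List.∷-injectiveʳ (List.∷-injectiveʳ eq)) = refl
  second-done⁻ j r (here _ ∷ π)         refl refl y≤ with path-≤* π
  ... | s≤s (s≤s ()) ∷ _
  second-done⁻ j r (there (here _) ∷ π) refl refl y≤ with path-≤* π
  ... | _ ∷ (s≤s (s≤s ()) ∷ _)
  second-done⁻ j r (there (there s) ∷ π) refl refl y≤ with path-≤* π
  ... | _ ∷ (_ ∷ le) with column-step {N = N} j r s le
  ...   | r′ , refl , refl , refl = cong₂ _∷_ (≤⇒<ᵇsuc y≤) (second-done⁻ (suc j) r′ π refl refl ≤-refl)

  -- The previous letter is positive, so the outstanding letter 1 is the only non-ascent. Directly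
  -- after a 0 it would be an ascent, the case of `second-open-0⁻`.
  second-open⁻ : ∀ {ps w qs} j r → Path b ps w qs → ps ≡ 2 ∷ 1 ∷ column j r → qs ≡ full →
                 ∀ {y} → suc y ≤ suc j → ∃₂ λ l l′ → l + l′ ≡ r × ascentsFrom (suc y) w ≡ replicate l true ++ false ∷ replicate l′ true
  second-open⁻ j r [] refl ()
  second-open⁻ j r (here _ ∷ π) refl refl y≤ with path-≤* π
  ... | s≤s (s≤s ()) ∷ _
  second-open⁻ j r (there (here _) ∷ π) refl refl {y} y≤ =
    0 , r , refl , cong₂ _∷_ (≥⇒<ᵇ-false {suc y} {1} (s≤s z≤n)) (second-done⁻ j r π refl refl (s≤s z≤n))
  second-open⁻ j r (there (there s) ∷ π) refl refl y≤ with path-≤* π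
  ... | _ ∷ (_ ∷ le) with column-step {N = N} j r s le
  ...   | r′ , refl , refl , refl with second-open⁻ (suc j) r′ π refl refl ≤-refl
  ...     | l , l′ , refl , eq = suc l , l′ , refl , cong₂ _∷_ (≤⇒<ᵇsuc y≤) eq

  -- After the second letter 0.
  Tail : ℕ → List Bool → Set
  Tail r γ = γ ≡ replicate (suc r) true ⊎ ∃₂ λ p q → suc p + q ≡ r × γ ≡ replicate (suc p) true ++ false ∷ replicate q true

  second-open-0⁻ : ∀ {ps w qs} j r → Path b ps w qs → ps ≡ 2 ∷ 1 ∷ column j r → qs ≡ full → Tail r (ascentsFrom 0 w)
  second-open-0⁻ j r [] refl ()
  second-open-0⁻ j r (here _ ∷ π) refl refl with path-≤* π
  ... | s≤s (s≤s ()) ∷ _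
  second-open-0⁻ j r (there (here _) ∷ π) refl refl = inj₁ (cong (true ∷_) (second-done⁻ j r π refl refl (s≤s z≤n)))
  second-open-0⁻ j r (there (there s) ∷ π) refl refl with path-≤* π
  ... | _ ∷ (_ ∷ le) with column-step {N = N} j r s le
  ...   | r′ , refl , refl , refl with second-open⁻ (suc j) r′ π refl refl ≤-refl
  ...     | l , l′ , refl , eq = inj₂ (l , l′ , refl , cong (true ∷_) eq)

  -- The previous letter is the last one of the first column. More of that column gives ascents
  -- until the second letter 0, which is a non-ascent and leaves a `Tail`.
  first-open⁻ : ∀ {ps w qs} j r → Path b ps w qs → ps ≡ 1 ∷ 1 ∷ column j r → qs ≡ full →
                ∃₂ λ l l′ → ∃[ δ ] l + l′ ≡ r × ascentsFrom (suc j) w ≡ replicate l true ++ false ∷ δ × Tail l′ δ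
  first-open⁻ j r [] refl ()
  first-open⁻ j r (here _ ∷ π) refl refl = 0 , r , _ , refl , refl , second-open-0⁻ j r π refl refl
  first-open⁻ j r (there (here (s≤s ())) ∷ π) refl refl
  first-open⁻ j r (there (there s) ∷ π) refl refl with path-≤* π
  ... | _ ∷ (_ ∷ le) with column-step {N = N} j r s le
  ...   | r′ , refl , refl , refl with first-open⁻ (suc j) r′ π refl refl
  ...     | l , l′ , δ , refl , eq , tail = suc l , l′ , δ , refl , cong₂ _∷_ (n<ᵇ1+n j) eq , tail

  second-done⁺ : ∀ j r {y} → j + r ≡ N → y ≤ suc j → ∃[ w ] Path b (2 ∷ 2 ∷ column j r) w full × ascentsFrom y w ≡ replicate r true
  second-done⁺ j zero    jr y≤ = [] , subst (λ ps → Path b (2 ∷ 2 ∷ column j 0) [] (2 ∷ 2 ∷ ps)) (column-full⁺ j jr) [] , refl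
  second-done⁺ j (suc r) jr y≤ with second-done⁺ (suc j) r {2 + j} (trans (sym (+-suc j r)) jr) ≤-refl
  ... | w , π , eq = 2 + j ∷ w , there (there (column-step⁺ j r (s≤s z≤n))) ∷ π , cong₂ _∷_ (≤⇒<ᵇsuc y≤) eq

  second-open⁺ : ∀ j l l′ {y} → j + (l + l′) ≡ N → suc y ≤ suc j →
                 ∃[ w ] Path b (2 ∷ 1 ∷ column j (l + l′)) w full × ascentsFrom (suc y) w ≡ replicate l true ++ false ∷ replicate l′ true
  second-open⁺ j zero    l′ {y} jl y≤ with second-done⁺ j l′ {1} jl (s≤s z≤n)
  ... | w , π , eq = 1 ∷ w , there (here (s≤s (s≤s z≤n))) ∷ π , cong₂ _∷_ (≥⇒<ᵇ-false {suc y} {1} (s≤s z≤n)) eq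
  second-open⁺ j (suc l) l′ jl y≤ with second-open⁺ (suc j) l l′ {suc j} (trans (sym (+-suc j (l + l′))) jl) ≤-refl
  ... | w , π , eq = 2 + j ∷ w , there (there (column-step⁺ j (l + l′) (s≤s z≤n))) ∷ π , cong₂ _∷_ (≤⇒<ᵇsuc y≤) eq

  second-open-0⁺ : ∀ j r {δ} → j + r ≡ N → Tail r δ → ∃[ w ] Path b (2 ∷ 1 ∷ column j r) w full × ascentsFrom 0 w ≡ δ
  second-open-0⁺ j r jr (inj₁ refl) with second-done⁺ j r {1} jr (s≤s z≤n)
  ... | w , π , eq = 1 ∷ w , there (here (s≤s (s≤s z≤n))) ∷ π , cong (true ∷_) eq
  second-open-0⁺ j r jr (inj₂ (p , q , refl , refl)) with second-open⁺ (suc j) p q {suc j} (trans (sym (+-suc j (p + q))) jr) ≤-refl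
  ... | w , π , eq = 2 + j ∷ w , there (there (column-step⁺ j (p + q) (s≤s z≤n))) ∷ π , cong (true ∷_) eq

  first-open⁺ : 2 ≤ b → ∀ j l l′ {δ} → j + (l + l′) ≡ N → Tail l′ δ →
                ∃[ w ] Path b (1 ∷ 1 ∷ column j (l + l′)) w full × ascentsFrom (suc j) w ≡ replicate l true ++ false ∷ δ
  first-open⁺ 2≤b j zero    l′ jl tail with second-open-0⁺ j l′ jl tail
  ... | w , π , eq = 0 ∷ w , here 2≤b ∷ π , cong (false ∷_) eq
  first-open⁺ 2≤b j (suc l) l′ jl tail with first-open⁺ 2≤b (suc j) l l′ (trans (sym (+-suc j (l + l′))) jl) tail
  ... | w , π , eq = 2 + j ∷ w , there (there (column-step⁺ j (l + l′) (s≤s z≤n))) ∷ π , cong₂ _∷_ (n<ᵇ1+n j) eq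

two-col⇔ : ∀ {r β} → HasPath 2 (0 ∷ 0 ∷ replicate r 0) (2 ∷ 2 ∷ replicate r 1) β ⇔ Sparse true false r β
two-col⇔ {r} = mk⇔ to from
  where
  to : ∀ {β} → HasPath 2 (0 ∷ 0 ∷ replicate r 0) (2 ∷ 2 ∷ replicate r 1) β → Sparse true false r β
  to (_ , there (here ()) ∷ _ , _)
  to (_ , there (there s) ∷ _ , _) = contradiction s (no-step-at-0 {r})
  to (_ , here _ ∷ there (there s) ∷ _ , _) = contradiction s (no-step-at-0 {r})
  to (_ , here _ ∷ there (here _) ∷ π , refl) with first-open⁻ {N = r} 0 r π refl refl
  ... | l , l′ , _ , refl , eq , inj₁ refl = subst (Sparse true false r) (sym (cong (true ∷_) eq)) (single l l′ refl)
  ... | l , _ , _ , refl , eq , inj₂ (p , q , refl , refl) = subst (Sparse true false r) (sym (cong (true ∷_) eq))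
    (double (suc l) p q (trans (cong suc (+-assoc l p q)) (sym (+-suc l (p + q)))))
  to (_ , here _ ∷ here _ ∷ there (there s) ∷ _ , _) = contradiction s (no-step-at-0 {r})
  to (_ , here _ ∷ here _ ∷ here (s≤s (s≤s ())) ∷ _ , _)
  to (_ , here _ ∷ here _ ∷ there (here _) ∷ π , refl) with second-open⁻ {N = r} 0 r π refl refl ≤-refl
  ... | l , l′ , refl , eq = subst (Sparse true false r) (sym (cong (λ γ → false ∷ true ∷ γ) eq)) (double 0 l l′ refl)
  from : ∀ {β} → Sparse true false r β → HasPath 2 (0 ∷ 0 ∷ replicate r 0) (2 ∷ 2 ∷ replicate r 1) β
  from (single i j refl) with first-open⁺ {N = i + j} ≤-refl 0 i j refl (inj₁ refl)
  ... | w , π , eq = 0 ∷ 1 ∷ w , here (s≤s z≤n) ∷ there (here (s≤s z≤n)) ∷ π , cong (true ∷_) eq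
  from (double zero p q refl) with second-open⁺ {2} {p + q} 0 p q {0} refl ≤-refl
  ... | w , π , eq = 0 ∷ 0 ∷ 1 ∷ w , here (s≤s z≤n) ∷ here (s≤s (s≤s z≤n)) ∷ there (here (s≤s z≤n)) ∷ π , cong (λ γ → false ∷ true ∷ γ) eq
  from (double (suc i) p q eqr) with first-open⁺ {N = i + (suc p + q)} ≤-refl 0 i (suc p + q) refl (inj₂ (p , q , refl , refl))
  ... | w , π , eq = subst (λ r → HasPath 2 (0 ∷ 0 ∷ replicate r 0) (2 ∷ 2 ∷ replicate r 1) _) r≡
      (0 ∷ 1 ∷ w , here (s≤s z≤n) ∷ there (here (s≤s z≤n)) ∷ π , cong (true ∷_) eq)
    where
    r≡ : i + (suc p + q) ≡ r
    r≡ = trans (+-suc i (p + q)) (trans (cong suc (sym (+-assoc i p q))) eqr)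

-- `pathsFrom` does not fix the final row ends; `unique` checks by evaluation that every path of `l`
-- steps ends at `qs`, as happens for the rectangles.
enumeration⇔ : ∀ {b ps qs} l → l + sum ps ≡ sum qs →
               True (All.all? (λ (_ , σ) → List.≡-dec _≟_ σ qs) (pathsFrom l b ps)) →
               ∀ {β} → HasPath b ps qs β ⇔ β ∈ vectorsOf l b ps
enumeration⇔ {b} {ps} {qs} l len unique {β} = mk⇔ to from
  where
  to : HasPath b ps qs β → β ∈ vectorsOf l b ps
  to (w , π , refl) = ∈-map⁺ (ascents ∘ proj₁)
    (subst (λ l → (w , qs) ∈ pathsFrom l b ps) (ℕ.+-cancelʳ-≡ _ (length w) l (trans (path-sum π) (sym len))) (pathsFrom-complete π))
  from : β ∈ vectorsOf l b ps → HasPath b ps qs β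
  from β∈ with ∈-map⁻ (ascents ∘ proj₁) β∈
  ... | (w , σ) , w∈ , refl with All.lookup (toWitness unique) w∈
  ...   | refl = w , pathsFrom-sound l b ps w∈ , refl

top-end : Type → ℕ
top-end (hook m k)     = suc m
top-end (disjoint m k) = 2 + m
top-end (two-row m)    = 2 + m
top-end (two-col k)    = 2
top-end 3-3            = 3
top-end 4-4            = 4
top-end 2-2-2          = 2
top-end 2-2-2-2        = 2

cells-starts : ∀ k → replicate k 0 ≡ starts (cells 0 k)
cells-starts k = sym (List.map-replicate proj₁ k (0 , 1))

cells-ends : ∀ k → replicate k 1 ≡ ends (cells 0 k)
cells-ends k = sym (List.map-replicate proj₂ k (0 , 1))

HasPath⇔Form : ∀ t {β} → HasPath (top-end t) (starts (shape t)) (ends (shape t)) β ⇔ Form t β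
HasPath⇔Form (hook m k) {β} = subst₂ (λ ps qs → HasPath (suc m) (0 ∷ ps) (suc m ∷ qs) β ⇔ Form (hook m k) β) (cells-starts k) (cells-ends k) hook⇔
HasPath⇔Form (disjoint m k) {β} =
  subst₂ (λ ps qs → HasPath (2 + m) (1 ∷ ps) (2 + m ∷ qs) β ⇔ Form (disjoint m k) β) (cells-starts (suc k)) (cells-ends (suc k)) disjoint⇔
HasPath⇔Form (two-row m) = two-row⇔
HasPath⇔Form (two-col k) {β} =
  subst₂ (λ ps qs → HasPath 2 (0 ∷ 0 ∷ ps) (2 ∷ 2 ∷ qs) β ⇔ Form (two-col k) β) (cells-starts (suc k)) (cells-ends (suc k)) two-col⇔
HasPath⇔Form 3-3     = enumeration⇔ 6 refl tt
HasPath⇔Form 4-4     = enumeration⇔ 8 refl tt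
HasPath⇔Form 2-2-2   = enumeration⇔ 6 refl tt
HasPath⇔Form 2-2-2-2 = enumeration⇔ 8 refl tt

-- Shapes of a given type

infix 4 _≈_
-- A record rather than the bare equation, so that `A` and `t` can be inferred from a proof.
record _≈_ (A : SkewShape) (t : Type) : Set where
  constructor of-type
  field
    compress≡ : compress (boxes A) ≡ compress (boxesFrom 0 (shape t))

open _≈_ public

data Standard : Type → List Row → Set where
  hook     : ∀ c m k → Standard (hook m k) (bar c m ∷ cells c k)
  disjoint : ∀ c a m k → c < a → Standard (disjoint m k) (bar a m ∷ cells c (suc k))
  2-row    : ∀ c m → Standard (two-row m) (bar c (suc m) ∷ bar c 1 ∷ [])
  2-col    : ∀ c k → Standard (two-col k) (bar c 1 ∷ bar c 1 ∷ cells c (suc k))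
  3-3      : ∀ c → Standard 3-3 (bar c 2 ∷ bar c 2 ∷ [])
  4-4      : ∀ c → Standard 4-4 (bar c 3 ∷ bar c 3 ∷ [])
  2-2-2    : ∀ c → Standard 2-2-2 (replicate 3 (bar c 1))
  2-2-2-2  : ∀ c → Standard 2-2-2-2 (replicate 4 (bar c 1))

shiftRow : ℕ → Row → Row
shiftRow c (a , e) = a + c , e + c

moveColumns : (ℕ → ℕ) → Box → Box
moveColumns ψ (r , c) = r , ψ c

boxesFrom-shift : ∀ c k rs → boxesFrom k (map (shiftRow c) rs) ≡ map (moveColumns (_+ c)) (boxesFrom k rs)
boxesFrom-shift c k []             = refl
boxesFrom-shift c k ((a , e) ∷ rs) = sym (trans (List.map-++ _ (applyUpTo (λ j → k , a + j) (e ∸ a)) (boxesFrom (suc k) rs))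
  (cong₂ _++_ (trans (List.map-applyUpTo (λ j → k , a + j) (moveColumns (_+ c)) (e ∸ a)) shifted) (sym (boxesFrom-shift c (suc k) rs))))
  where
  applyUpTo-cong : ∀ {X : Set} {f g : ℕ → X} n → (∀ i → f i ≡ g i) → applyUpTo f n ≡ applyUpTo g n
  applyUpTo-cong zero    f≡g = refl
  applyUpTo-cong (suc n) f≡g = cong₂ _∷_ (f≡g 0) (applyUpTo-cong n (f≡g ∘ suc))
  shifted : applyUpTo (λ j → k , a + j + c) (e ∸ a) ≡ applyUpTo (λ j → k , a + c + j) (e + c ∸ (a + c))
  shifted = trans (applyUpTo-cong (e ∸ a) (λ j → cong (k ,_) (trans (+-assoc a j c) (trans (cong (a +_) (+-comm j c)) (sym (+-assoc a c j))))))
    (cong (applyUpTo (λ j → k , a + c + j)) (sym (trans (cong₂ _∸_ (+-comm e c) (+-comm a c)) (ℕ.[m+n]∸[m+o]≡n∸o c e a))))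

compress-shift : ∀ c rs → compress (boxesFrom 0 (map (shiftRow c) rs)) ≡ compress (boxesFrom 0 rs)
compress-shift c rs = trans (cong compress (boxesFrom-shift c 0 rs)) (compress-map id (ℕ.+-monoˡ-< c) (boxesFrom 0 rs))

shift-cells : ∀ c k → map (shiftRow c) (cells 0 k) ≡ cells c k
shift-cells c k = List.map-replicate (shiftRow c) k (0 , 1)

-- Moves the column of the standard `disjoint` shape to column c and its row to start in column a.
-- The map is strictly monotone, so `compress` does not see the gap.
spread : ℕ → ℕ → ℕ → ℕ
spread c a zero    = c
spread c a (suc j) = a + j

spread-mono : ∀ {c a} → c < a → StrictlyMonotone (spread c a)
spread-mono {c} {a} c<a {zero}  {suc y} _         = ≤-trans c<a (ℕ.m≤m+n a y)
spread-mono {c} {a} c<a {suc x} {suc y} (s≤s x<y) = ℕ.+-monoʳ-< a x<y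

boxesFrom-cells : ∀ ψ k n → map (moveColumns ψ) (boxesFrom k (cells 0 n)) ≡ boxesFrom k (cells (ψ 0) n)
boxesFrom-cells ψ k zero    = refl
boxesFrom-cells ψ k (suc n) = sym (trans (cong (λ t → applyUpTo (λ j → k , ψ 0 + j) t ++ boxesFrom (suc k) (cells (ψ 0) n)) (ℕ.m+n∸n≡m 1 (ψ 0)))
  (cong₂ _∷_ (cong (k ,_) (+-identityʳ (ψ 0))) (sym (boxesFrom-cells ψ (suc k) n))))

shifted⇒compress : ∀ c t {rs} → rs ≡ map (shiftRow c) (shape t) → compress (boxesFrom 0 rs) ≡ compress (boxesFrom 0 (shape t))
shifted⇒compress c t refl = compress-shift c (shape t)

Standard⇒compress : ∀ {t rs} → Standard t rs → compress (boxesFrom 0 rs) ≡ compress (boxesFrom 0 (shape t))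
Standard⇒compress (disjoint c a m k c<a) = trans (cong compress spread≡) (compress-map id (spread-mono c<a) (boxesFrom 0 (shape (disjoint m k))))
  where
  spread≡ : boxesFrom 0 (bar a m ∷ cells c (suc k)) ≡ map (moveColumns (spread c a)) (boxesFrom 0 (shape (disjoint m k)))
  spread≡ = sym (trans (List.map-++ _ (applyUpTo (λ j → 0 , 1 + j) (suc m)) (boxesFrom 1 (cells 0 (suc k))))
    (cong₂ _++_ (trans (List.map-applyUpTo (λ j → 0 , 1 + j) (moveColumns (spread c a)) (suc m))
                       (cong (applyUpTo (λ j → 0 , a + j)) (sym (ℕ.m+n∸n≡m (suc m) a))))
      (boxesFrom-cells (spread c a) 1 (suc k))))
Standard⇒compress (hook c m k) = shifted⇒compress c (hook m k) (cong (bar c m ∷_) (sym (shift-cells c k)))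
Standard⇒compress (2-row c m)  = shifted⇒compress c (two-row m) refl
Standard⇒compress (2-col c k)  = shifted⇒compress c (two-col k) (cong (λ rs → bar c 1 ∷ bar c 1 ∷ rs) (sym (shift-cells c (suc k))))
Standard⇒compress (3-3 c)      = shifted⇒compress c 3-3 refl
Standard⇒compress (4-4 c)      = shifted⇒compress c 4-4 refl
Standard⇒compress (2-2-2 c)    = shifted⇒compress c 2-2-2 refl
Standard⇒compress (2-2-2-2 c)  = shifted⇒compress c 2-2-2-2 refl

Standard⇒≈ : ∀ A {t rs} → rows⁺ A ≡ rs → Standard t rs → A ≈ t
Standard⇒≈ A refl std = of-type (trans (compress-rows⁺ A) (Standard⇒compress std))

flip-bar : ∀ {W} c m → suc (m + c) ≤ W → flipRow W (bar c m) ≡ bar (W ∸ suc (m + c)) m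
flip-bar {W} c m le = cong (W ∸ suc (m + c) ,_) (begin
  W ∸ c                            ≡⟨ ℕ.m+[n∸m]≡n (ℕ.m+n≤o⇒m≤o∸n (suc m) le) ⟨
  suc m + (W ∸ c ∸ suc m)          ≡⟨ cong (suc m +_) (ℕ.∸-+-assoc W c (suc m)) ⟩
  suc m + (W ∸ (c + suc m))        ≡⟨ cong (λ t → suc m + (W ∸ t)) (+-comm c (suc m)) ⟩
  suc (m + (W ∸ suc (m + c)))      ∎)
  where open ≡-Reasoning

reverse-replicate : ∀ {X : Set} k (x : X) → reverse (replicate k x) ≡ replicate k x
reverse-replicate zero    x = refl
reverse-replicate (suc k) x = trans (List.unfold-reverse x (replicate k x)) (trans (cong (_∷ʳ x) (reverse-replicate k x))
  (trans (replicate-∷ k []) (cong (x ∷_) (List.++-identityʳ (replicate k x)))))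

rotRows-cells : ∀ {W} c k rs → suc c ≤ W → rotRows W (cells c k ++ rs) ≡ rotRows W rs ++ cells (W ∸ suc c) k
rotRows-cells {W} c k rs c<W = begin
  reverse (map (flipRow W) (cells c k ++ rs))                        ≡⟨ cong reverse (List.map-++ (flipRow W) (cells c k) rs) ⟩
  reverse (map (flipRow W) (cells c k) ++ map (flipRow W) rs)        ≡⟨ List.reverse-++ (map (flipRow W) (cells c k)) (map (flipRow W) rs) ⟩
  rotRows W rs ++ reverse (map (flipRow W) (cells c k))              ≡⟨ cong (λ us → rotRows W rs ++ reverse us) (List.map-replicate (flipRow W) k (bar c 0)) ⟩
  rotRows W rs ++ reverse (replicate k (flipRow W (bar c 0)))        ≡⟨ cong (rotRows W rs ++_) (reverse-replicate k _) ⟩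
  rotRows W rs ++ replicate k (flipRow W (bar c 0))                  ≡⟨ cong (λ r → rotRows W rs ++ replicate k r) (flip-bar c 0 c<W) ⟩
  rotRows W rs ++ cells (W ∸ suc c) k                                ∎
  where open ≡-Reasoning

Pattern⇒Standard : ∀ {rs W} → Pattern rs → All (InRow W) rs → ∃[ t ] (Standard t rs ⊎ Standard t (rotRows W rs))
Pattern⇒Standard (hook c m k)           _ = _ , inj₁ (hook c m k)
Pattern⇒Standard (disjoint c a m k c<a) _ = _ , inj₁ (disjoint c a m k c<a)
Pattern⇒Standard (2-row c m)            _ = _ , inj₁ (2-row c m)
Pattern⇒Standard (2-col c k)            _ = _ , inj₁ (2-col c k)
Pattern⇒Standard (3-3 c)                _ = _ , inj₁ (3-3 c)
Pattern⇒Standard (4-4 c)                _ = _ , inj₁ (4-4 c)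
Pattern⇒Standard (2-2-2 c)              _ = _ , inj₁ (2-2-2 c)
Pattern⇒Standard (2-2-2-2 c)            _ = _ , inj₁ (2-2-2-2 c)
Pattern⇒Standard {W = W} (hook° c m k) ((_ , y<W) ∷ _) = _ , inj₂ (subst (Standard (hook (suc m) (suc k))) (sym rotated)
  (hook (W ∸ suc (suc m + c)) (suc m) (suc k)))
  where
  rotated : rotRows W (cells (suc m + c) (suc k) ++ bar c (suc m) ∷ []) ≡ bar (W ∸ suc (suc m + c)) (suc m) ∷ cells (W ∸ suc (suc m + c)) (suc k)
  rotated =
    trans (rotRows-cells (suc m + c) (suc k) (bar c (suc m) ∷ []) y<W) (cong (_∷ cells (W ∸ suc (suc m + c)) (suc k)) (flip-bar c (suc m) y<W))
Pattern⇒Standard {W = W} (disjoint° c a m k m+c<a) ((_ , a<W) ∷ _) = _ , inj₂ (subst (Standard (disjoint m k)) (sym rotated)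
  (disjoint (W ∸ suc a) (W ∸ suc (m + c)) m k (ℕ.∸-monoʳ-< (s≤s m+c<a) a<W)))
  where
  rotated : rotRows W (cells a (suc k) ++ bar c m ∷ []) ≡ bar (W ∸ suc (m + c)) m ∷ cells (W ∸ suc a) (suc k)
  rotated = trans (rotRows-cells a (suc k) (bar c m ∷ []) a<W)
    (cong (_∷ cells (W ∸ suc a) (suc k)) (flip-bar c m (≤-trans (s≤s (ℕ.<⇒≤ m+c<a)) a<W)))
Pattern⇒Standard {W = W} (2-row° c m) ((_ , le) ∷ (_ , le′) ∷ []) = _ , inj₂ (subst (Standard (two-row (suc m))) (sym rotated)
  (2-row (W ∸ suc (2 + m + c)) (suc m)))
  where
  rotated : rotRows W (bar (suc m + c) 1 ∷ bar c (2 + m) ∷ []) ≡ bar (W ∸ suc (2 + m + c)) (2 + m) ∷ bar (W ∸ suc (2 + m + c)) 1 ∷ []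
  rotated = cong₂ (λ r r′ → r ∷ r′ ∷ []) (flip-bar c (2 + m) le′) (flip-bar (suc m + c) 1 le)
Pattern⇒Standard {W = W} (2-col° c k) ((_ , le) ∷ _) = _ , inj₂ (subst (Standard (two-col k)) (sym rotated) (2-col (W ∸ suc (suc c)) k))
  where
  rotated : rotRows W (cells (suc c) (suc k) ++ bar c 1 ∷ bar c 1 ∷ []) ≡ bar (W ∸ suc (suc c)) 1 ∷ bar (W ∸ suc (suc c)) 1 ∷ cells (W ∸ suc (suc c)) (suc k)
  rotated = trans (rotRows-cells (suc c) (suc k) (bar c 1 ∷ bar c 1 ∷ []) le)
    (cong (λ r → r ∷ r ∷ cells (W ∸ suc (suc c)) (suc k)) (flip-bar c 1 le))

-- Every shape with distinguished tableaux is empty or has a type up to rotation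

Classified : SkewShape → Type → Set
Classified A t = A ≈ t ⊎ A ° ≈ t

Distinguished⇒GoodRows : ∀ {α β rs} → Rows α β rs → Distinguished (lookup (boxesFrom 0 rs)) → GoodRows rs
Distinguished⇒GoodRows []                    _    = tt
Distinguished⇒GoodRows rows@(cons _ _ e≤β _) dist = Good-≤ e≤β (Distinguished⇒Good rows dist)

Distinguished⇒Classified : ∀ A → Distinguished (lookup (boxes A)) → rows⁺ A ≡ [] ⊎ ∃[ t ] Classified A t
Distinguished⇒Classified A dist = classify (classification (rows⁺-rows A) (Distinguished⇒GoodRows (rows⁺-rows A)
  (Distinguished-≡compress {boxes A} {boxesFrom 0 (rows⁺ A)} (compress-rows⁺ A) dist)))
  where
  standard : ∃[ t ] (Standard t (rows⁺ A) ⊎ Standard t (rotRows (width A) (rows⁺ A))) → ∃[ t ] Classified A t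
  standard (t , inj₁ std) = t , inj₁ (Standard⇒≈ A refl std)
  standard (t , inj₂ std) = t , inj₂ (Standard⇒≈ (A °) (rows⁺-° A) std)
  classify : rows⁺ A ≡ [] ⊎ Pattern (rows⁺ A) → rows⁺ A ≡ [] ⊎ ∃[ t ] Classified A t
  classify (inj₁ none)     = inj₁ none
  classify (inj₂ pattern′) = inj₂ (standard (Pattern⇒Standard pattern′ (rows⁺-inside A)))

cells-rows : ∀ {α β} k → 1 ≤ β → Rows α β (cells 0 k)
cells-rows zero    _   = []
cells-rows (suc k) 1≤β = cons (s≤s z≤n) z≤n 1≤β (cells-rows k ≤-refl)

shape-rows : ∀ t → Rows 1 (top-end t) (shape t)
shape-rows (hook m k)     = cons (s≤s z≤n) z≤n ≤-refl (cells-rows k (s≤s z≤n))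
shape-rows (disjoint m k) = cons (s≤s (s≤s z≤n)) ≤-refl ≤-refl (cells-rows (suc k) (s≤s z≤n))
shape-rows (two-row m)    = cons (s≤s z≤n) z≤n ≤-refl (cons (s≤s z≤n) z≤n (s≤s (s≤s z≤n)) [])
shape-rows (two-col k)    = cons (s≤s z≤n) z≤n ≤-refl (cons (s≤s z≤n) z≤n ≤-refl (cells-rows (suc k) (s≤s z≤n)))
shape-rows 3-3            = cons (s≤s z≤n) z≤n ≤-refl (cons (s≤s z≤n) z≤n ≤-refl [])
shape-rows 4-4            = cons (s≤s z≤n) z≤n ≤-refl (cons (s≤s z≤n) z≤n ≤-refl [])
shape-rows 2-2-2          = cons (s≤s z≤n) z≤n ≤-refl (cons (s≤s z≤n) z≤n ≤-refl (cons (s≤s z≤n) z≤n ≤-refl []))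
shape-rows 2-2-2-2        = cons (s≤s z≤n) z≤n ≤-refl (cons (s≤s z≤n) z≤n ≤-refl (cons (s≤s z≤n) z≤n ≤-refl (cons (s≤s z≤n) z≤n ≤-refl [])))

≈⇒Has⇔Form : ∀ A t → A ≈ t → ∀ {β} → Has (lookup (boxes A)) β ⇔ Form t β
≈⇒Has⇔Form A t A≈t = mk⇔
  (Equivalence.to (HasPath⇔Form t) ∘ Equivalence.to (Has⇔path (shape-rows t)) ∘ Has-≡compress {boxes A} {boxesFrom 0 (shape t)} (compress≡ A≈t))
  (Has-≡compress {boxesFrom 0 (shape t)} {boxes A} (sym (compress≡ A≈t)) ∘ Equivalence.from (Has⇔path (shape-rows t)) ∘ Equivalence.from (HasPath⇔Form t))

-- Reversal of descent vectors

trues-++ : ∀ β γ → trues (β ++ γ) ≡ trues β + trues γ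
trues-++ []          γ = refl
trues-++ (true ∷ β)  γ = cong suc (trues-++ β γ)
trues-++ (false ∷ β) γ = trues-++ β γ

trues-reverse : ∀ β → trues (reverse β) ≡ trues β
trues-reverse []      = refl
trues-reverse (b ∷ β) = trans (cong trues (List.unfold-reverse b β)) (trans (trues-++ (reverse β) (b ∷ []))
  (trans (+-comm (trues (reverse β)) (trues (b ∷ []))) (trans (cong (trues (b ∷ []) +_) (trues-reverse β)) (sym (trues-++ (b ∷ []) β)))))

Sparse-reverse : ∀ {x y m β} → Sparse x y m β → Sparse x y m (reverse β)
Sparse-reverse {x} {y} {m} (single i j i+j) = subst (Sparse x y m) (sym (begin
  reverse (replicate (suc i) x ++ y ∷ replicate (suc j) x)              ≡⟨ List.reverse-++ (replicate (suc i) x) (y ∷ replicate (suc j) x) ⟩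
  reverse (y ∷ replicate (suc j) x) ++ reverse (replicate (suc i) x)    ≡⟨ cong₂ _++_ (List.unfold-reverse y (replicate (suc j) x)) (reverse-replicate (suc i) x) ⟩
  (reverse (replicate (suc j) x) ∷ʳ y) ++ replicate (suc i) x           ≡⟨ List.∷ʳ-++ (reverse (replicate (suc j) x)) y (replicate (suc i) x) ⟩
  reverse (replicate (suc j) x) ++ y ∷ replicate (suc i) x              ≡⟨ cong (_++ y ∷ replicate (suc i) x) (reverse-replicate (suc j) x) ⟩
  replicate (suc j) x ++ y ∷ replicate (suc i) x                        ∎)) (single j i (trans (+-comm j i) i+j))
  where open ≡-Reasoning
Sparse-reverse {x} {y} {m} (double i j l ijl) = subst (Sparse x y m) (sym (begin
  reverse (replicate i x ++ y ∷ replicate (suc j) x ++ y ∷ replicate l x)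
    ≡⟨ reverse-∷ (replicate i x) (replicate (suc j) x ++ y ∷ replicate l x) ⟩
  reverse (replicate (suc j) x ++ y ∷ replicate l x) ++ y ∷ reverse (replicate i x)
    ≡⟨ cong (_++ y ∷ reverse (replicate i x)) (reverse-∷ (replicate (suc j) x) (replicate l x)) ⟩
  (reverse (replicate l x) ++ y ∷ reverse (replicate (suc j) x)) ++ y ∷ reverse (replicate i x)
    ≡⟨ List.++-assoc (reverse (replicate l x)) (y ∷ reverse (replicate (suc j) x)) (y ∷ reverse (replicate i x)) ⟩
  reverse (replicate l x) ++ y ∷ reverse (replicate (suc j) x) ++ y ∷ reverse (replicate i x)
    ≡⟨ cong₂ (λ u v → u ++ y ∷ v) (reverse-replicate l x) (cong₂ (λ u v → u ++ y ∷ v) (reverse-replicate (suc j) x) (reverse-replicate i x)) ⟩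
  replicate l x ++ y ∷ replicate (suc j) x ++ y ∷ replicate i x ∎)) (double l j i (trans (arith l j i) ijl))
  where
  open ≡-Reasoning
  reverse-∷ : ∀ u v → reverse (u ++ y ∷ v) ≡ reverse v ++ y ∷ reverse u
  reverse-∷ u v = trans (List.reverse-++ u (y ∷ v)) (trans (cong (_++ reverse u) (List.unfold-reverse y v)) (List.∷ʳ-++ (reverse v) y (reverse u)))
  arith : ∀ l j i → l + j + i ≡ i + j + l
  arith = solve-∀

∈-closed : ∀ (L : List (List Bool)) → True (All.all? (λ β → Any.any? (List.≡-dec Bool._≟_ (reverse β)) L) L) →
           ∀ {β} → β ∈ L → reverse β ∈ L
∈-closed L closed β∈ = All.lookup (toWitness closed) β∈

-- Rotation reverses descent vectors, so this closure is what gives A and `A °` the same vectors and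
-- lets a type describe a shape up to rotation.
Form-reverse : ∀ t {β} → Form t β → Form t (reverse β)
Form-reverse (hook m k)     {β} (len , tr) = trans (List.length-reverse β) len , trans (trues-reverse β) tr
Form-reverse (disjoint m k) {β} (len , tr) = trans (List.length-reverse β) len ,
  [ inj₁ ∘ trans (trues-reverse β) , inj₂ ∘ trans (trues-reverse β) ]′ tr
Form-reverse (two-row m)    = Sparse-reverse
Form-reverse (two-col k)    = Sparse-reverse
Form-reverse 3-3            = ∈-closed (vectorsOf 6 3 (0 ∷ 0 ∷ [])) tt
Form-reverse 4-4            = ∈-closed (vectorsOf 8 4 (0 ∷ 0 ∷ [])) tt
Form-reverse 2-2-2          = ∈-closed (vectorsOf 6 2 (0 ∷ 0 ∷ 0 ∷ [])) tt
Form-reverse 2-2-2-2        = ∈-closed (vectorsOf 8 2 (0 ∷ 0 ∷ 0 ∷ 0 ∷ [])) tt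

Has-°° : ∀ A {β} → Has (lookup (boxes (A °))) β → Has (lookup (boxes A)) (reverse β)
Has-°° A has = Has-≡compress {boxes (A ° °)} {boxes A} (°-involutive A) (Has-° (A °) has)

Classified⇒Has⇔Form : ∀ A t → Classified A t → ∀ {β} → Has (lookup (boxes A)) β ⇔ Form t β
Classified⇒Has⇔Form A t (inj₁ A≈t)  = ≈⇒Has⇔Form A t A≈t
Classified⇒Has⇔Form A t (inj₂ A°≈t) {β} = mk⇔
  (λ has → subst (Form t) (List.reverse-involutive β) (Form-reverse t (Equivalence.to (≈⇒Has⇔Form (A °) t A°≈t) (Has-° A has))))
  (λ form → subst (Has (lookup (boxes A))) (List.reverse-involutive β) (Has-°° A (Equivalence.from (≈⇒Has⇔Form (A °) t A°≈t) (Form-reverse t form))))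

Classified-° : ∀ {A t} → Classified A t → Classified (A °) t
Classified-° {A} (inj₁ A≈t)  = inj₂ (of-type (trans (°-involutive A) (compress≡ A≈t)))
Classified-° {A} (inj₂ A°≈t) = inj₁ A°≈t

-- Comparing the sets of descent vectors

size′ lowest highest : Type → ℕ
size′ (hook m k)     = m + k
size′ (disjoint m k) = suc (m + k)
size′ (two-row m)    = 3 + m
size′ (two-col k)    = 4 + k
size′ 3-3            = 5
size′ 4-4            = 7
size′ 2-2-2          = 5
size′ 2-2-2-2        = 7
lowest (hook m k)     = k
lowest (disjoint m k) = k
lowest (two-row m)    = 1
lowest (two-col k)    = 2 + k
lowest 3-3            = 1
lowest 4-4            = 1
lowest 2-2-2          = 2
lowest 2-2-2-2        = 3
highest (hook m k)     = k
highest (disjoint m k) = suc k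
highest (two-row m)    = 2
highest (two-col k)    = 3 + k
highest 3-3            = 3
highest 4-4            = 4
highest 2-2-2          = 4
highest 2-2-2-2        = 6

trues-all-true : ∀ k → trues (replicate k true) ≡ k
trues-all-true zero    = refl
trues-all-true (suc k) = cong suc (trues-all-true k)

trues-all-false : ∀ k → trues (replicate k false) ≡ 0
trues-all-false zero    = refl
trues-all-false (suc k) = trues-all-false k

record Bounded (t : Type) (β : List Bool) : Set where
  constructor bounds
  field
    size-≡    : length β ≡ size′ t
    lowest-≤  : lowest t ≤ trues β
    ≤-highest : trues β ≤ highest t

trues-single : ∀ x y i j → trues (replicate (suc i) x ++ y ∷ replicate (suc j) x) ≡ trues (replicate (suc i) x) + trues (y ∷ []) + trues (replicate (suc j) x)
trues-single x y i j = trans (trues-++ (replicate (suc i) x) (y ∷ replicate (suc j) x))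
  (trans (cong (trues (replicate (suc i) x) +_) (trues-++ (y ∷ []) (replicate (suc j) x))) (sym (+-assoc (trues (replicate (suc i) x)) (trues (y ∷ [])) _)))

trues-double : ∀ x y i j l → trues (replicate i x ++ y ∷ replicate (suc j) x ++ y ∷ replicate l x) ≡
               trues (replicate i x) + (trues (y ∷ []) + (trues (replicate (suc j) x) + (trues (y ∷ []) + trues (replicate l x))))
trues-double x y i j l = trans (trues-++ (replicate i x) (y ∷ replicate (suc j) x ++ y ∷ replicate l x)) (cong (trues (replicate i x) +_)
  (trans (trues-++ (y ∷ []) (replicate (suc j) x ++ y ∷ replicate l x)) (cong (trues (y ∷ []) +_)
    (trans (trues-++ (replicate (suc j) x) (y ∷ replicate l x)) (cong (trues (replicate (suc j) x) +_) (trues-++ (y ∷ []) (replicate l x)))))))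

Sparse-length : ∀ {x y m β} → Sparse x y m β → length β ≡ 3 + m
Sparse-length {x} {y} (single i j refl) = trans (List.length-++ (replicate (suc i) x))
  (trans (cong₂ (λ a b → a + suc b) (List.length-replicate (suc i)) (List.length-replicate (suc j))) (arith i j))
  where
  arith : ∀ i j → suc i + suc (suc j) ≡ 3 + (i + j)
  arith = solve-∀
Sparse-length {x} {y} (double i j l refl) = trans (List.length-++ (replicate i x))
  (trans (cong₂ (λ a b → a + suc b) (List.length-replicate i) (trans (List.length-++ (replicate (suc j) x))
    (cong₂ (λ a b → a + suc b) (List.length-replicate (suc j)) (List.length-replicate l)))) (arith i j l))
  where
  arith : ∀ i j l → i + suc (suc j + suc l) ≡ 3 + (i + j + l)
  arith = solve-∀

Sparse-few : ∀ {m β} → Sparse false true m β → trues β ≡ 1 ⊎ trues β ≡ 2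
Sparse-few (single i j _)   = inj₁ (trans (trues-single false true i j)
  (cong₂ (λ a b → a + 1 + b) (trues-all-false (suc i)) (trues-all-false (suc j))))
Sparse-few (double i j l _) = inj₂ (trans (trues-double false true i j l)
  (cong₂ (λ a b → a + (1 + b)) (trues-all-false i) (cong₂ (λ a b → a + (1 + b)) (trues-all-false (suc j)) (trues-all-false l))))

Sparse-many : ∀ {m β} → Sparse true false m β → trues β ≡ suc m ⊎ trues β ≡ 2 + m
Sparse-many (single i j refl)   = inj₂ (trans (trues-single true false i j)
  (trans (cong₂ (λ a b → a + 0 + b) (trues-all-true (suc i)) (trues-all-true (suc j))) (arith i j)))
  where
  arith : ∀ i j → suc i + 0 + suc j ≡ 2 + (i + j)
  arith = solve-∀
Sparse-many (double i j l refl) = inj₁ (trans (trues-double true false i j l)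
  (trans (cong₂ _+_ (trues-all-true i) (cong₂ _+_ (trues-all-true (suc j)) (trues-all-true l))) (arith i j l)))
  where
  arith : ∀ i j l → i + (suc j + l) ≡ suc (i + j + l)
  arith = solve-∀

checkBounded : ∀ t (L : List (List Bool)) →
  True (All.all? (λ β → (length β ≟ size′ t) ×-dec ((lowest t ≤? trues β) ×-dec (trues β ≤? highest t))) L) → ∀ {β} → β ∈ L → Bounded t β
checkBounded t L ok β∈ = let l , lo , hi = All.lookup (toWitness ok) β∈ in bounds l lo hi

Form⇒Bounded : ∀ t {β} → Form t β → Bounded t β
Form⇒Bounded (hook m k)     (len , refl)      = bounds len ≤-refl ≤-refl
Form⇒Bounded (disjoint m k) (len , inj₁ refl) = bounds len ≤-refl (ℕ.n≤1+n k)
Form⇒Bounded (disjoint m k) (len , inj₂ tr)   = bounds len (ℕ.≤-trans (ℕ.n≤1+n k) (ℕ.≤-reflexive (sym tr))) (ℕ.≤-reflexive tr)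
Form⇒Bounded (two-row m)    f with Sparse-few f
... | inj₁ tr = bounds (Sparse-length f) (ℕ.≤-reflexive (sym tr)) (ℕ.≤-trans (ℕ.≤-reflexive tr) (ℕ.n≤1+n 1))
... | inj₂ tr = bounds (Sparse-length f) (ℕ.≤-trans (ℕ.n≤1+n 1) (ℕ.≤-reflexive (sym tr))) (ℕ.≤-reflexive tr)
Form⇒Bounded (two-col k)    f with Sparse-many f
... | inj₁ tr = bounds (Sparse-length f) (ℕ.≤-reflexive (sym tr)) (ℕ.≤-trans (ℕ.≤-reflexive tr) (ℕ.n≤1+n _))
... | inj₂ tr = bounds (Sparse-length f) (ℕ.≤-trans (ℕ.n≤1+n _) (ℕ.≤-reflexive (sym tr))) (ℕ.≤-reflexive tr)
Form⇒Bounded 3-3     = checkBounded 3-3     (vectorsOf 6 3 (0 ∷ 0 ∷ [])) tt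
Form⇒Bounded 4-4     = checkBounded 4-4     (vectorsOf 8 4 (0 ∷ 0 ∷ [])) tt
Form⇒Bounded 2-2-2   = checkBounded 2-2-2   (vectorsOf 6 2 (0 ∷ 0 ∷ 0 ∷ [])) tt
Form⇒Bounded 2-2-2-2 = checkBounded 2-2-2-2 (vectorsOf 8 2 (0 ∷ 0 ∷ 0 ∷ 0 ∷ [])) tt

-- The vectors of hooks and disjoint sums whose descents come first; no other type has such a vector.
flat : ℕ → ℕ → List Bool
flat i j = replicate i true ++ replicate j false

length-flat : ∀ i j → length (flat i j) ≡ i + j
length-flat i j = trans (List.length-++ (replicate i true)) (cong₂ _+_ (List.length-replicate i) (List.length-replicate j))

trues-flat : ∀ i j → trues (flat i j) ≡ i
trues-flat i j = trans (trues-++ (replicate i true) (replicate j false)) (trans (cong₂ _+_ (trues-all-true i) (trues-all-false j)) (+-identityʳ i))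

_∈ᵛ?_ : ∀ (β : List Bool) L → Dec (β ∈ L)
β ∈ᵛ? L = Any.any? (List.≡-dec Bool._≟_ β) L

-- Vectors attaining the bounds `lowest` and `highest`; an inclusion of forms therefore implies an
-- inclusion of these ranges.
lowVector highVector : Type → List Bool
lowVector (hook m k)     = flat k m
lowVector (disjoint m k) = flat k (suc m)
lowVector (two-row m)    = false ∷ true ∷ replicate (suc m) false
lowVector (two-col k)    = false ∷ true ∷ false ∷ replicate (suc k) true
lowVector 3-3            = false ∷ false ∷ true ∷ false ∷ false ∷ []
lowVector 4-4            = false ∷ false ∷ false ∷ true ∷ false ∷ false ∷ false ∷ []
lowVector 2-2-2          = false ∷ true ∷ false ∷ true ∷ false ∷ []
lowVector 2-2-2-2        = false ∷ true ∷ false ∷ true ∷ false ∷ true ∷ false ∷ []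
highVector (hook m k)     = flat k m
highVector (disjoint m k) = flat (suc k) m
highVector (two-row m)    = true ∷ false ∷ true ∷ replicate m false
highVector (two-col k)    = true ∷ false ∷ replicate (2 + k) true
highVector 3-3            = true ∷ false ∷ true ∷ false ∷ true ∷ []
highVector 4-4            = true ∷ false ∷ true ∷ false ∷ true ∷ false ∷ true ∷ []
highVector 2-2-2          = true ∷ true ∷ false ∷ true ∷ true ∷ []
highVector 2-2-2-2        = true ∷ true ∷ true ∷ false ∷ true ∷ true ∷ true ∷ []

lowVector-form : ∀ t → Form t (lowVector t) × trues (lowVector t) ≡ lowest t
lowVector-form (hook m k)     = (trans (length-flat k m) (+-comm k m) , trues-flat k m) , trues-flat k m
lowVector-form (disjoint m k) = (trans (length-flat k (suc m)) (+-comm k (suc m)) , inj₁ (trues-flat k (suc m))) , trues-flat k (suc m)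
lowVector-form (two-row m)    = single 0 m refl , cong suc (trues-all-false (suc m))
lowVector-form (two-col k)    = double 0 0 (suc k) refl , cong suc (trues-all-true (suc k))
lowVector-form 3-3            = toWitness {a? = _ ∈ᵛ? vectorsOf 6 3 (0 ∷ 0 ∷ [])} tt , refl
lowVector-form 4-4            = toWitness {a? = _ ∈ᵛ? vectorsOf 8 4 (0 ∷ 0 ∷ [])} tt , refl
lowVector-form 2-2-2          = toWitness {a? = _ ∈ᵛ? vectorsOf 6 2 (0 ∷ 0 ∷ 0 ∷ [])} tt , refl
lowVector-form 2-2-2-2        = toWitness {a? = _ ∈ᵛ? vectorsOf 8 2 (0 ∷ 0 ∷ 0 ∷ 0 ∷ [])} tt , refl

highVector-form : ∀ t → Form t (highVector t) × trues (highVector t) ≡ highest t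
highVector-form (hook m k)     = lowVector-form (hook m k)
highVector-form (disjoint m k) = (trans (length-flat (suc k) m) (cong suc (+-comm k m)) , inj₂ (trues-flat (suc k) m)) , trues-flat (suc k) m
highVector-form (two-row m)    = double 0 0 m refl , cong (2 +_) (trues-all-false m)
highVector-form (two-col k)    = single 0 (suc k) refl , cong suc (trues-all-true (2 + k))
highVector-form 3-3            = toWitness {a? = _ ∈ᵛ? vectorsOf 6 3 (0 ∷ 0 ∷ [])} tt , refl
highVector-form 4-4            = toWitness {a? = _ ∈ᵛ? vectorsOf 8 4 (0 ∷ 0 ∷ [])} tt , refl
highVector-form 2-2-2          = toWitness {a? = _ ∈ᵛ? vectorsOf 6 2 (0 ∷ 0 ∷ 0 ∷ [])} tt , refl
highVector-form 2-2-2-2        = toWitness {a? = _ ∈ᵛ? vectorsOf 8 2 (0 ∷ 0 ∷ 0 ∷ 0 ∷ [])} tt , refl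

flat-no-rise : ∀ i j u v w → flat i j ≢ u ++ false ∷ v ++ true ∷ w
flat-no-rise (suc i) j []      v w ()
flat-no-rise (suc i) j (_ ∷ u) v w eq = flat-no-rise i j u v w (List.∷-injectiveʳ eq)
flat-no-rise zero    j u       v w eq = all-false j (subst (true ∈_) (sym eq) (∈-++⁺ʳ u (there (∈-++⁺ʳ v (here refl)))))
  where
  all-false : ∀ j → true ∉ replicate j false
  all-false (suc j) (there true∈) = all-false j true∈

¬Sparse-few-flat : ∀ {m} i j → ¬ Sparse false true m (flat i j)
¬Sparse-few-flat {m} i j f = go f refl
  where
  go : ∀ {β} → Sparse false true m β → flat i j ≢ β
  go (single i′ j′ _)   eq = flat-no-rise i j [] (replicate i′ false) (replicate (suc j′) false) eq
  go (double i′ j′ l _) eq = flat-no-rise i j (replicate i′ false ∷ʳ true) (replicate j′ false) (replicate l false)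
    (trans eq (sym (List.∷ʳ-++ (replicate i′ false) true _)))

¬Sparse-many-flat : ∀ {m} i j → ¬ Sparse true false m (flat i j)
¬Sparse-many-flat {m} i j f = go f refl
  where
  go : ∀ {β} → Sparse true false m β → flat i j ≢ β
  go (single i′ j′ _)   eq = flat-no-rise i j (replicate (suc i′) true) [] (replicate j′ true) eq
  go (double i′ j′ l _) eq = flat-no-rise i j (replicate i′ true) [] (replicate j′ true ++ false ∷ replicate l true) eq

-- Every vector of these types has a non-descent before a descent.
risesᵇ : List Bool → Bool
risesᵇ []          = false
risesᵇ (true ∷ β)  = risesᵇ β
risesᵇ (false ∷ β) = 1 ≤ᵇ trues β

flat-risesᵇ : ∀ i j → risesᵇ (flat i j) ≡ false
flat-risesᵇ (suc i) j       = flat-risesᵇ i j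
flat-risesᵇ zero    zero    = refl
flat-risesᵇ zero    (suc j) rewrite trues-all-false j = refl

¬∈-flat : ∀ L → True (All.all? (λ β → risesᵇ β Bool.≟ true) L) → ∀ i j → flat i j ∉ L
¬∈-flat L rising i j f∈ = contradiction (trans (sym (flat-risesᵇ i j)) (All.lookup (toWitness rising) f∈)) λ ()

data Flat : Type → Set where
  hook     : ∀ m k → Flat (hook m k)
  disjoint : ∀ m k → Flat (disjoint m k)

Flat-flat : ∀ {t} → Flat t → ∃₂ λ i j → Form t (flat i j)
Flat-flat (hook m k)     = k , m , proj₁ (lowVector-form (hook m k))
Flat-flat (disjoint m k) = k , suc m , proj₁ (lowVector-form (disjoint m k))

-- For `disjoint m k` put n = m + k + 2 and ℓ = k + 1. Then `longer-arm` is (n - ℓ + 1, 1^(ℓ - 1))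
-- and `longer-leg` is (n - ℓ, 1^ℓ). `rows` is case (b), and `cols` is case (c) for n at least 5;
-- for n = 4 that case is `rows 0`.
data Exceptional : Type → Type → Set where
  longer-arm : ∀ m k → Exceptional (disjoint m k) (hook (suc m) k)
  longer-leg : ∀ m k → Exceptional (disjoint m k) (hook m (suc k))
  rows       : ∀ m → Exceptional (disjoint (suc m) 1) (two-row m)
  cols       : ∀ k → Exceptional (disjoint 1 (2 + k)) (two-col k)

-- A record because the two types could not be recovered from an inclusion of the computed sets
-- `Form b` and `Form a`.
record _⊑_ (b a : Type) : Set where
  constructor contained
  field
    embed : ∀ {β} → Form b β → Form a β

open _⊑_ public

module _ {a b : Type} (b⊑a : b ⊑ a) where

  private
    low : Bounded a (lowVector b)
    low = Form⇒Bounded a (embed b⊑a (proj₁ (lowVector-form b)))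

    high : Bounded a (highVector b)
    high = Form⇒Bounded a (embed b⊑a (proj₁ (highVector-form b)))

  ⊑-size : size′ b ≡ size′ a
  ⊑-size = trans (sym (Bounded.size-≡ (Form⇒Bounded b (proj₁ (lowVector-form b))))) (Bounded.size-≡ low)

  ⊑-lowest : lowest a ≤ lowest b
  ⊑-lowest = subst (lowest a ≤_) (proj₂ (lowVector-form b)) (Bounded.lowest-≤ low)

  ⊑-highest : highest b ≤ highest a
  ⊑-highest = subst (_≤ highest a) (proj₂ (highVector-form b)) (Bounded.≤-highest high)

-- All tableaux of a hook have the same number of descents, so no type with a varying number fits
-- in.
⊑-hook : ∀ {m k b} → lowest b < highest b → ¬ b ⊑ hook m k
⊑-hook lt b⊑a = ℕ.<⇒≱ lt (≤-trans (⊑-highest b⊑a) (⊑-lowest b⊑a))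

squeeze : ∀ {k k′} → k ≤ k′ → k′ ≤ suc k → k′ ≡ k ⊎ k′ ≡ suc k
squeeze k≤k′ k′≤1+k with ℕ.m≤n⇒m<n∨m≡n k≤k′
... | inj₁ k<k′ = inj₂ (ℕ.≤-antisym k′≤1+k k<k′)
... | inj₂ k≡k′ = inj₁ (sym k≡k′)

compare-hook : ∀ m k b → b ⊑ hook m k → hook m k ≡ b
compare-hook m k (hook m′ k′) b⊑a with ℕ.≤-antisym (⊑-lowest b⊑a) (⊑-highest b⊑a)
... | refl = cong (λ m → hook m k) (sym (ℕ.+-cancelʳ-≡ k m′ m (⊑-size b⊑a)))
compare-hook m k (disjoint m′ k′) b⊑a = contradiction b⊑a (⊑-hook {b = disjoint m′ k′} ≤-refl)
compare-hook m k (two-row m′)     b⊑a = contradiction b⊑a (⊑-hook {b = two-row m′} ≤-refl)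
compare-hook m k (two-col k′)     b⊑a = contradiction b⊑a (⊑-hook {b = two-col k′} ≤-refl)
compare-hook m k 3-3              b⊑a = contradiction b⊑a (⊑-hook {b = 3-3} (s≤s (s≤s z≤n)))
compare-hook m k 4-4              b⊑a = contradiction b⊑a (⊑-hook {b = 4-4} (s≤s (s≤s z≤n)))
compare-hook m k 2-2-2            b⊑a = contradiction b⊑a (⊑-hook {b = 2-2-2} (s≤s (s≤s (s≤s z≤n))))
compare-hook m k 2-2-2-2          b⊑a = contradiction b⊑a (⊑-hook {b = 2-2-2-2} (s≤s (s≤s (s≤s (s≤s z≤n)))))

-- The numbers of descents of `b` lie between k and k + 1, which fixes one parameter of `b` or
-- leaves two choices for a hook; the size then fixes the other. The sporadic types have too wide a
-- range.
compare-disjoint : ∀ m k b → b ⊑ disjoint m k → disjoint m k ≡ b ⊎ Exceptional (disjoint m k) b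
compare-disjoint m k (hook m′ k′) b⊑a with squeeze (⊑-lowest b⊑a) (⊑-highest b⊑a)
... | inj₁ refl with ℕ.+-cancelʳ-≡ k m′ (suc m) (⊑-size b⊑a)
...   | refl = inj₂ (longer-arm m k)
compare-disjoint m k (hook m′ k′) b⊑a | inj₂ refl with ℕ.+-cancelʳ-≡ (suc k) m′ m (trans (⊑-size b⊑a) (sym (+-suc m k)))
... | refl = inj₂ (longer-leg m k)
compare-disjoint m k (disjoint m′ k′) b⊑a with ℕ.≤-antisym (⊑-lowest b⊑a) (ℕ.≤-pred (⊑-highest b⊑a))
... | refl = inj₁ (cong (λ m → disjoint m k) (sym (ℕ.+-cancelʳ-≡ k m′ m (ℕ.suc-injective (⊑-size b⊑a)))))
compare-disjoint m k (two-row m′) b⊑a with ℕ.≤-antisym (⊑-lowest b⊑a) (ℕ.≤-pred (⊑-highest b⊑a))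
... | refl with ℕ.suc-injective (trans (⊑-size b⊑a) (cong suc (+-comm m 1)))
...   | refl = inj₂ (rows m′)
compare-disjoint m k (two-col k′) b⊑a with ℕ.≤-antisym (⊑-lowest b⊑a) (ℕ.≤-pred (⊑-highest b⊑a))
... | refl with ℕ.+-cancelʳ-≡ (2 + k′) 1 m (ℕ.suc-injective (⊑-size b⊑a))
...   | refl = inj₂ (cols k′)
compare-disjoint m k 3-3     b⊑a = contradiction (ℕ.≤-trans (ℕ.≤-pred (⊑-highest b⊑a)) (⊑-lowest b⊑a)) λ { (s≤s ()) }
compare-disjoint m k 4-4     b⊑a = contradiction (ℕ.≤-trans (ℕ.≤-pred (⊑-highest b⊑a)) (⊑-lowest b⊑a)) λ { (s≤s ()) }
compare-disjoint m k 2-2-2   b⊑a = contradiction (ℕ.≤-trans (ℕ.≤-pred (⊑-highest b⊑a)) (⊑-lowest b⊑a)) λ { (s≤s (s≤s ())) }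
compare-disjoint m k 2-2-2-2 b⊑a = contradiction (ℕ.≤-trans (ℕ.≤-pred (⊑-highest b⊑a)) (⊑-lowest b⊑a)) λ { (s≤s (s≤s (s≤s ()))) }

no-flat : ∀ {a b} → (∀ i j → ¬ Form a (flat i j)) → Flat b → ¬ b ⊑ a
no-flat none fl b⊑a = let i , j , f = Flat-flat fl in none i j (embed b⊑a f)

compare-two-row : ∀ m b → b ⊑ two-row m → two-row m ≡ b
compare-two-row m (hook m′ k′)     b⊑a = contradiction b⊑a (no-flat {two-row m} ¬Sparse-few-flat (hook m′ k′))
compare-two-row m (disjoint m′ k′) b⊑a = contradiction b⊑a (no-flat {two-row m} ¬Sparse-few-flat (disjoint m′ k′))
compare-two-row m (two-row m′)     b⊑a with ⊑-size b⊑a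
... | refl = refl
compare-two-row m (two-col k′)     b⊑a = contradiction (⊑-highest b⊑a) λ { (s≤s (s≤s ())) }
compare-two-row m 3-3              b⊑a = contradiction (⊑-highest b⊑a) λ { (s≤s (s≤s ())) }
compare-two-row m 4-4              b⊑a = contradiction (⊑-highest b⊑a) λ { (s≤s (s≤s ())) }
compare-two-row m 2-2-2            b⊑a = contradiction (⊑-highest b⊑a) λ { (s≤s (s≤s ())) }
compare-two-row m 2-2-2-2          b⊑a = contradiction (⊑-highest b⊑a) λ { (s≤s (s≤s ())) }

compare-two-col : ∀ k b → b ⊑ two-col k → two-col k ≡ b
compare-two-col k (hook m′ k′)     b⊑a = contradiction b⊑a (no-flat {two-col k} ¬Sparse-many-flat (hook m′ k′))
compare-two-col k (disjoint m′ k′) b⊑a = contradiction b⊑a (no-flat {two-col k} ¬Sparse-many-flat (disjoint m′ k′))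
compare-two-col k (two-row m′)     b⊑a = contradiction (⊑-lowest b⊑a) λ { (s≤s ()) }
compare-two-col k (two-col k′)     b⊑a with ⊑-size b⊑a
... | refl = refl
compare-two-col k 3-3              b⊑a = contradiction (⊑-lowest b⊑a) λ { (s≤s ()) }
compare-two-col k 4-4              b⊑a = contradiction (⊑-lowest b⊑a) λ { (s≤s ()) }
compare-two-col k 2-2-2            b⊑a with ⊑-size b⊑a
... | refl = contradiction (⊑-lowest b⊑a) λ { (s≤s (s≤s ())) }
compare-two-col k 2-2-2-2          b⊑a with ⊑-size b⊑a
... | refl = contradiction (⊑-lowest b⊑a) λ { (s≤s (s≤s (s≤s ()))) }

-- For the remaining types a, a two-row or two-column shape of the right size has a vector that a lacks.
lacks : ∀ (L : List (List Bool)) β → True (¬? (β ∈ᵛ? L)) → β ∉ L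
lacks L β = toWitness

compare-3-3 : ∀ b → b ⊑ 3-3 → 3-3 ≡ b
compare-3-3 (hook m k)     b⊑a = contradiction b⊑a (no-flat {3-3} (¬∈-flat (vectorsOf 6 3 (0 ∷ 0 ∷ [])) tt) (hook m k))
compare-3-3 (disjoint m k) b⊑a = contradiction b⊑a (no-flat {3-3} (¬∈-flat (vectorsOf 6 3 (0 ∷ 0 ∷ [])) tt) (disjoint m k))
compare-3-3 (two-row m)    b⊑a with ⊑-size b⊑a
... | refl = contradiction (embed b⊑a (single 0 2 refl)) (lacks (vectorsOf 6 3 (0 ∷ 0 ∷ [])) (false ∷ true ∷ replicate 3 false) tt)
compare-3-3 (two-col k)    b⊑a with ⊑-size b⊑a
... | refl = contradiction (⊑-highest b⊑a) λ { (s≤s (s≤s (s≤s ()))) }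
compare-3-3 3-3            b⊑a = refl
compare-3-3 4-4            b⊑a = contradiction (⊑-size b⊑a) λ ()
compare-3-3 2-2-2          b⊑a = contradiction (⊑-highest b⊑a) λ { (s≤s (s≤s (s≤s ()))) }
compare-3-3 2-2-2-2        b⊑a = contradiction (⊑-size b⊑a) λ ()

compare-4-4 : ∀ b → b ⊑ 4-4 → 4-4 ≡ b
compare-4-4 (hook m k)     b⊑a = contradiction b⊑a (no-flat {4-4} (¬∈-flat (vectorsOf 8 4 (0 ∷ 0 ∷ [])) tt) (hook m k))
compare-4-4 (disjoint m k) b⊑a = contradiction b⊑a (no-flat {4-4} (¬∈-flat (vectorsOf 8 4 (0 ∷ 0 ∷ [])) tt) (disjoint m k))
compare-4-4 (two-row m)    b⊑a with ⊑-size b⊑a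
... | refl = contradiction (embed b⊑a (single 0 4 refl)) (lacks (vectorsOf 8 4 (0 ∷ 0 ∷ [])) (false ∷ true ∷ replicate 5 false) tt)
compare-4-4 (two-col k)    b⊑a with ⊑-size b⊑a
... | refl = contradiction (⊑-highest b⊑a) λ { (s≤s (s≤s (s≤s (s≤s ())))) }
compare-4-4 3-3            b⊑a = contradiction (⊑-size b⊑a) λ ()
compare-4-4 4-4            b⊑a = refl
compare-4-4 2-2-2          b⊑a = contradiction (⊑-size b⊑a) λ ()
compare-4-4 2-2-2-2        b⊑a = contradiction (⊑-highest b⊑a) λ { (s≤s (s≤s (s≤s (s≤s ())))) }

compare-2-2-2 : ∀ b → b ⊑ 2-2-2 → 2-2-2 ≡ b
compare-2-2-2 (hook m k)     b⊑a = contradiction b⊑a (no-flat {2-2-2} (¬∈-flat (vectorsOf 6 2 (0 ∷ 0 ∷ 0 ∷ [])) tt) (hook m k))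
compare-2-2-2 (disjoint m k) b⊑a = contradiction b⊑a (no-flat {2-2-2} (¬∈-flat (vectorsOf 6 2 (0 ∷ 0 ∷ 0 ∷ [])) tt) (disjoint m k))
compare-2-2-2 (two-row m)    b⊑a = contradiction (⊑-lowest b⊑a) λ { (s≤s ()) }
compare-2-2-2 (two-col k)    b⊑a with ⊑-size b⊑a
... | refl = contradiction (embed b⊑a (single 0 2 refl)) (lacks (vectorsOf 6 2 (0 ∷ 0 ∷ 0 ∷ [])) (true ∷ false ∷ replicate 3 true) tt)
compare-2-2-2 3-3            b⊑a = contradiction (⊑-lowest b⊑a) λ { (s≤s ()) }
compare-2-2-2 4-4            b⊑a = contradiction (⊑-size b⊑a) λ ()
compare-2-2-2 2-2-2          b⊑a = refl
compare-2-2-2 2-2-2-2        b⊑a = contradiction (⊑-size b⊑a) λ ()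

compare-2-2-2-2 : ∀ b → b ⊑ 2-2-2-2 → 2-2-2-2 ≡ b
compare-2-2-2-2 (hook m k)     b⊑a = contradiction b⊑a (no-flat {2-2-2-2} (¬∈-flat (vectorsOf 8 2 (0 ∷ 0 ∷ 0 ∷ 0 ∷ [])) tt) (hook m k))
compare-2-2-2-2 (disjoint m k) b⊑a = contradiction b⊑a (no-flat {2-2-2-2} (¬∈-flat (vectorsOf 8 2 (0 ∷ 0 ∷ 0 ∷ 0 ∷ [])) tt) (disjoint m k))
compare-2-2-2-2 (two-row m)    b⊑a = contradiction (⊑-lowest b⊑a) λ { (s≤s ()) }
compare-2-2-2-2 (two-col k)    b⊑a with ⊑-size b⊑a
... | refl = contradiction (embed b⊑a (single 0 4 refl)) (lacks (vectorsOf 8 2 (0 ∷ 0 ∷ 0 ∷ 0 ∷ [])) (true ∷ false ∷ replicate 5 true) tt)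
compare-2-2-2-2 3-3            b⊑a = contradiction (⊑-size b⊑a) λ ()
compare-2-2-2-2 4-4            b⊑a = contradiction (⊑-lowest b⊑a) λ { (s≤s ()) }
compare-2-2-2-2 2-2-2          b⊑a = contradiction (⊑-size b⊑a) λ ()
compare-2-2-2-2 2-2-2-2        b⊑a = refl

compare-types : ∀ a b → b ⊑ a → a ≡ b ⊎ Exceptional a b
compare-types (hook m k)     b b⊑a = inj₁ (compare-hook m k b b⊑a)
compare-types (disjoint m k) b b⊑a = compare-disjoint m k b b⊑a
compare-types (two-row m)    b b⊑a = inj₁ (compare-two-row m b b⊑a)
compare-types (two-col k)    b b⊑a = inj₁ (compare-two-col k b b⊑a)
compare-types 3-3            b b⊑a = inj₁ (compare-3-3 b b⊑a)
compare-types 4-4            b b⊑a = inj₁ (compare-4-4 b b⊑a)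
compare-types 2-2-2          b b⊑a = inj₁ (compare-2-2-2 b b⊑a)
compare-types 2-2-2-2        b b⊑a = inj₁ (compare-2-2-2-2 b b⊑a)

-- An exceptional pair has a `disjoint` type on the left and never on the right, so it cannot be
-- exceptional both ways.
⊑-antisym : ∀ a b → b ⊑ a → a ⊑ b → a ≡ b
⊑-antisym a b b⊑a a⊑b with compare-types a b b⊑a | compare-types b a a⊑b
... | inj₁ a≡b             | _        = a≡b
... | inj₂ _               | inj₁ b≡a = sym b≡a
... | inj₂ (longer-arm _ _) | inj₂ ()
... | inj₂ (longer-leg _ _) | inj₂ ()
... | inj₂ (rows _)         | inj₂ ()
... | inj₂ (cols _)         | inj₂ ()

-- A vector belongs to `disjoint m k` as soon as it has the right length and k or k + 1 descents, so
-- only these numbers need checking. For the hooks this reflects that e_ℓ h_(n-ℓ) is the sum of the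
-- two hook Schur functions.
Exceptional⇒⊑ : ∀ {a b} → Exceptional a b → b ⊑ a
Exceptional⇒⊑ (longer-arm m k) = contained λ (len , tr) → len , inj₁ tr
Exceptional⇒⊑ (longer-leg m k) = contained λ (len , tr) → trans len (+-suc m k) , inj₂ tr
Exceptional⇒⊑ (rows m) = contained λ f → trans (Sparse-length f) (cong (2 +_) (+-comm 1 m)) , Sparse-few f
Exceptional⇒⊑ (cols k) = contained λ f → Sparse-length f , Sparse-many f

-- Translation to the exceptional pairs of shapes

length-compress : ∀ bs → length (compress bs) ≡ length bs
length-compress bs = List.length-map (compressBox bs) bs

size-° : ∀ A → size (A °) ≡ size A
size-° A = let H , W , inside = bounded (boxes A) in begin
  length (boxes (A °))                          ≡⟨ length-compress (boxes (A °)) ⟨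
  length (compress (boxes (A °)))               ≡⟨ cong length (compress-° A inside) ⟩
  length (compress (rotateBoxes H W (boxes A))) ≡⟨ length-compress (rotateBoxes H W (boxes A)) ⟩
  length (rotateBoxes H W (boxes A))            ≡⟨ List.length-reverse (map (flip H W) (boxes A)) ⟩
  length (map (flip H W) (boxes A))             ≡⟨ List.length-map (flip H W) (boxes A) ⟩
  length (boxes A)                              ∎
  where open ≡-Reasoning

length-cells : ∀ i k → length (boxesFrom i (cells 0 k)) ≡ k
length-cells i zero    = refl
length-cells i (suc k) = cong suc (length-cells (suc i) k)

size-disjoint : ∀ {A m k} → A ≈ disjoint m k → size A ≡ 2 + m + k
size-disjoint {A} {m} {k} A≈ = begin
  length (boxes A)                                     ≡⟨ length-compress (boxes A) ⟨
  length (compress (boxes A))                          ≡⟨ cong length (compress≡ A≈) ⟩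
  length (compress (boxesFrom 0 (shape (disjoint m k)))) ≡⟨ length-compress (boxesFrom 0 (shape (disjoint m k))) ⟩
  length (boxesFrom 0 (shape (disjoint m k)))          ≡⟨ List.length-++ (applyUpTo (λ j → 0 , 1 + j) (suc m)) ⟩
  length (applyUpTo (λ j → 0 , 1 + j) (suc m)) + length (boxesFrom 1 (cells 0 (suc k)))
    ≡⟨ cong₂ _+_ (List.length-applyUpTo (λ j → 0 , 1 + j) (suc m)) (length-cells 1 (suc k)) ⟩
  suc m + suc k                                        ≡⟨ cong suc (+-suc m k) ⟩
  2 + m + k                                            ∎
  where open ≡-Reasoning

rowsFrom-parts : ∀ xs → rowsFrom (nth []) (nth xs) (length xs) ≡ map (0 ,_) xs
rowsFrom-parts []       = refl
rowsFrom-parts (x ∷ xs) = cong ((0 , x) ∷_) (rowsFrom-parts xs)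

rowsOf-straight : ∀ p → rowsOf (straight p) ≡ map (0 ,_) (parts p)
rowsOf-straight p = rowsFrom-parts (parts p)

straight-≈ : ∀ p {t} → map (0 ,_) (parts p) ≡ shape t → straight p ≈ t
straight-≈ p eq = of-type $ cong compress (trans (boxes-rows (straight p)) (cong (boxesFrom 0) (trans (rowsOf-straight p) eq)))

IsPartitionShape⇒≈ : ∀ {A xs t} → map (0 ,_) xs ≡ shape t → IsPartitionShape A xs → A ≈ t
IsPartitionShape⇒≈ {t = t} eq (p , refl , A≋p) = of-type (trans A≋p (compress≡ (straight-≈ p {t} eq)))

≈⇒IsPartitionShape : ∀ {A t} (p : Partition) → map (0 ,_) (parts p) ≡ shape t → A ≈ t → IsPartitionShape A (parts p)
≈⇒IsPartitionShape {t = t} p eq A≈t = p , refl , trans (compress≡ A≈t) (sym (compress≡ (straight-≈ p {t} eq)))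

linked-ones : ∀ {x} k → 1 ≤ x → Linked _≥_ (x ∷ replicate k 1)
linked-ones zero    1≤x = [-]
linked-ones (suc k) 1≤x = 1≤x ∷ linked-ones k ≤-refl

positive-ones : ∀ k → All (0 <_) (replicate k 1)
positive-ones zero    = []
positive-ones (suc k) = s≤s z≤n ∷ positive-ones k

ones : ℕ → Partition
ones zero    = mkPartition [] [] []
ones (suc k) = mkPartition (replicate (suc k) 1) (linked-ones k ≤-refl) (positive-ones (suc k))

hookPartition : ℕ → ℕ → Partition
hookPartition m k = mkPartition (suc m ∷ replicate k 1) (linked-ones k (s≤s z≤n)) (s≤s z≤n ∷ positive-ones k)

shape-hook : ∀ m k → map (0 ,_) (suc m ∷ replicate k 1) ≡ shape (hook m k)
shape-hook m k = cong ((0 , suc m) ∷_) (List.map-replicate (0 ,_) k 1)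

twoRowPartition : ℕ → Partition
twoRowPartition m = mkPartition (2 + m ∷ 2 ∷ []) (s≤s (s≤s z≤n) ∷ [-]) (s≤s z≤n ∷ s≤s z≤n ∷ [])

twoColumnPartition : ℕ → Partition
twoColumnPartition k = mkPartition (2 ∷ 2 ∷ replicate (suc k) 1) (≤-refl ∷ linked-ones (suc k) (s≤s z≤n)) (s≤s z≤n ∷ s≤s z≤n ∷ positive-ones (suc k))

shape-two-col : ∀ k → map (0 ,_) (2 ∷ 2 ∷ replicate (suc k) 1) ≡ shape (two-col k)
shape-two-col k = cong (λ rs → (0 , 2) ∷ (0 , 2) ∷ rs) (List.map-replicate (0 ,_) (suc k) 1)

positivePrefix-ones : ∀ f h → (∀ i → i < h → f i ≡ 1) → positivePrefix f h ≡ replicate h 1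
positivePrefix-ones f zero    f≡1 = refl
positivePrefix-ones f (suc h) f≡1 = trans (positivePrefix-suc f h (f≡1 0 (s≤s z≤n)))
  (cong₂ _∷_ (f≡1 0 (s≤s z≤n)) (positivePrefix-ones (f ∘ suc) h (λ i i<h → f≡1 (suc i) (s≤s i<h))))

nth-ones : ∀ k i → i < k → nth (replicate k 1) i ≡ 1
nth-ones (suc k) zero    _         = refl
nth-ones (suc k) (suc i) (s≤s i<k) = nth-ones k i i<k

rowsOf-disjoint : ∀ p q {m k} → parts p ≡ replicate (suc k) 1 → parts q ≡ suc m ∷ [] →
                  rowsOf (straight p ⊕ straight q) ≡ shape (disjoint m k)
rowsOf-disjoint (mkPartition _ _ _) (mkPartition _ _ _) {m} {k} refl refl =
  -- The row is moved right by the width 1 of the column, and the zero inner parts of the column are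
  -- dropped, so the inner partition is (1).
  trans (cong (λ xs → rowsFrom (nth (1 ∷ [])) (nth (2 + m ∷ xs)) (suc (length xs))) ones-part)
    (cong ((1 , 2 + m) ∷_) (trans (rowsFrom-parts (replicate (suc k) 1)) (List.map-replicate (0 ,_) (suc k) 1)))
  where
  h≡ : length (replicate (suc k) 1) ≡ suc k
  h≡ = List.length-replicate (suc k)
  ones-part = trans (positivePrefix-ones _ (length (replicate (suc k) 1)) (λ i i< → nth-ones (suc k) i (subst (i <_) h≡ i<)))
    (cong (λ h → replicate h 1) h≡)

⊕-≈ : ∀ p q {m k} → parts p ≡ replicate (suc k) 1 → parts q ≡ suc m ∷ [] → (straight p ⊕ straight q) ≈ disjoint m k
⊕-≈ p q ep eq = of-type $ cong compress (trans (boxes-rows (straight p ⊕ straight q)) (cong (boxesFrom 0) (rowsOf-disjoint p q ep eq)))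

IsDirectSum⇒≈ : ∀ {A m k xs ys} → xs ≡ replicate (suc k) 1 → ys ≡ suc m ∷ [] → IsDirectSum A xs ys → A ≈ disjoint m k
IsDirectSum⇒≈ ex ey (p , q , ep , eq , A≋) = of-type (trans A≋ (compress≡ (⊕-≈ p q (trans ep ex) (trans eq ey))))

≈⇒IsDirectSum : ∀ {A m k} → A ≈ disjoint m k → IsDirectSum A (replicate (suc k) 1) (suc m ∷ [])
≈⇒IsDirectSum {m = m} {k} A≈ = ones (suc k) , row-partition , refl , refl ,
  trans (compress≡ A≈) (sym (compress≡ (⊕-≈ (ones (suc k)) row-partition refl refl)))
  where
  row-partition : Partition
  row-partition = mkPartition (suc m ∷ []) [-] (s≤s z≤n ∷ [])

ofType : Type → Type → SkewShape → SkewShape → Set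
ofType a b A B = A ≈ a × B ≈ b

Exceptional⇒pair : ∀ {a b A B} → Exceptional a b → ofType a b A B → ExceptionalPair (size A) A B
Exceptional⇒pair {A = A} {B} (longer-arm m k) (A≈ , B≈) = inj₁ (arm (size-disjoint {A} A≈))
  where
  arm : ∀ {n} → n ≡ 2 + m + k → HookPair n A B
  arm refl = suc k , s≤s z≤n , s≤s (ℕ.m≤n+m k m) ,
    subst (λ r → IsDirectSum A (replicate (suc k) 1) (r ∷ [])) (sym (ℕ.m+n∸n≡m (suc m) k)) (≈⇒IsDirectSum A≈) ,
    inj₂ (subst (λ r → IsPartitionShape B (r ∷ replicate k 1)) (sym (trans (cong (_+ 1) (ℕ.m+n∸n≡m (suc m) k)) (+-comm (suc m) 1)))
      (≈⇒IsPartitionShape {t = hook (suc m) k} (hookPartition (suc m) k) (shape-hook (suc m) k) B≈))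
Exceptional⇒pair {A = A} {B} (longer-leg m k) (A≈ , B≈) = inj₁ (leg (size-disjoint {A} A≈))
  where
  leg : ∀ {n} → n ≡ 2 + m + k → HookPair n A B
  leg refl = suc k , s≤s z≤n , s≤s (ℕ.m≤n+m k m) ,
    subst (λ r → IsDirectSum A (replicate (suc k) 1) (r ∷ [])) (sym (ℕ.m+n∸n≡m (suc m) k)) (≈⇒IsDirectSum A≈) ,
    inj₁ (subst (λ r → IsPartitionShape B (r ∷ replicate (suc k) 1)) (sym (ℕ.m+n∸n≡m (suc m) k))
      (≈⇒IsPartitionShape {t = hook m (suc k)} (hookPartition m (suc k)) (shape-hook m (suc k)) B≈))
Exceptional⇒pair {A = A} {B} (rows m) (A≈ , B≈) = inj₂ (inj₁ (two-rows′ (trans (size-disjoint {A} A≈) (cong (3 +_) (+-comm m 1)))))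
  where
  two-rows′ : ∀ {n} → n ≡ 4 + m → TwoRowPair n A B
  two-rows′ refl = s≤s (s≤s (s≤s (s≤s z≤n))) , ≈⇒IsDirectSum A≈ , ≈⇒IsPartitionShape {t = two-row m} (twoRowPartition m) refl B≈
Exceptional⇒pair {A = A} {B} (cols k) (A≈ , B≈) = inj₂ (inj₂ (two-cols (size-disjoint {A} A≈)))
  where
  two-cols : ∀ {n} → n ≡ 5 + k → TwoColumnPair n A B
  two-cols refl = s≤s (s≤s (s≤s (s≤s z≤n))) , ≈⇒IsDirectSum A≈ ,
    ≈⇒IsPartitionShape {t = two-col k} (twoColumnPartition k) (shape-two-col k) B≈

pair⇒Exceptional : ∀ {n A B} → ExceptionalPair n A B → ∃₂ λ a b → Exceptional a b × ofType a b A B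
pair⇒Exceptional {suc n} {A} {B} (inj₁ (suc k , _ , k<n , A-sum , B-shape)) = hooks (ℕ.m≤n⇒∃[o]m+o≡n k<n) A-sum B-shape
  where
  hooks : ∃[ m ] suc k + m ≡ n → IsDirectSum A (replicate (suc k) 1) (n ∸ k ∷ []) →
          IsPartitionShape B (n ∸ k ∷ replicate (suc k) 1) ⊎ IsPartitionShape B (n ∸ k + 1 ∷ replicate k 1) →
          ∃₂ λ a b → Exceptional a b × ofType a b A B
  hooks (m , refl) A-sum B-shape = split B-shape
    where
    row≡ : suc k + m ∸ k ≡ suc m
    row≡ = trans (cong (_∸ k) (sym (+-suc k m))) (ℕ.m+n∸m≡n k (suc m))
    A≈ : A ≈ disjoint m k
    A≈ = IsDirectSum⇒≈ refl (cong (_∷ []) row≡) A-sum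
    split : IsPartitionShape B (suc k + m ∸ k ∷ replicate (suc k) 1) ⊎ IsPartitionShape B (suc k + m ∸ k + 1 ∷ replicate k 1) →
            ∃₂ λ a b → Exceptional a b × ofType a b A B
    split (inj₁ B-hook) = disjoint m k , hook m (suc k) , longer-leg m k , A≈ ,
      IsPartitionShape⇒≈ {t = hook m (suc k)} (trans (cong (λ r → map (0 ,_) (r ∷ replicate (suc k) 1)) row≡) (shape-hook m (suc k))) B-hook
    split (inj₂ B-hook) = disjoint m k , hook (suc m) k , longer-arm m k , A≈ ,
      IsPartitionShape⇒≈ {t = hook (suc m) k} (trans (cong (λ r → map (0 ,_) (r ∷ replicate k 1)) (trans (cong (_+ 1) row≡) (+-comm (suc m) 1))) (shape-hook (suc m) k)) B-hook
pair⇒Exceptional (inj₂ (inj₁ (s≤s (s≤s (s≤s (s≤s {n = m} z≤n))) , A-sum , B-shape))) =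
  disjoint (suc m) 1 , two-row m , rows m , IsDirectSum⇒≈ refl refl A-sum , IsPartitionShape⇒≈ {t = two-row m} refl B-shape
-- For n = 4 the shape (2,2) of case (c) is also that of case (b), and it is classified as
-- `two-row 0`.
pair⇒Exceptional (inj₂ (inj₂ (s≤s (s≤s (s≤s (s≤s {n = zero} z≤n))) , A-sum , B-shape))) =
  disjoint 1 1 , two-row 0 , rows 0 , IsDirectSum⇒≈ refl refl A-sum , IsPartitionShape⇒≈ {t = two-row 0} refl B-shape
pair⇒Exceptional (inj₂ (inj₂ (s≤s (s≤s (s≤s (s≤s {n = suc k} z≤n))) , A-sum , B-shape))) =
  disjoint 1 (2 + k) , two-col k , cols k , IsDirectSum⇒≈ refl refl A-sum , IsPartitionShape⇒≈ {t = two-col k} (shape-two-col k) B-shape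

-- Comparing shapes

empty⇒≋ : ∀ {A B} → size A ≡ size B → rows⁺ A ≡ [] → B ≋ A
empty⇒≋ {A} {B} sizes none = trans (cong compress (no-boxes (boxes B) (trans (sym sizes) size≡0))) (cong compress (sym (no-boxes (boxes A) size≡0)))
  where
  size≡0 : size A ≡ 0
  size≡0 = trans (sym (length-compress (boxes A)))
    (cong length (trans (compress-rows⁺ A) (cong (compress ∘ boxesFrom 0) none)))
  no-boxes : ∀ (bs : List Box) → length bs ≡ 0 → bs ≡ []
  no-boxes [] _ = refl

same-type : ∀ {A B t} → Classified A t → Classified B t → B ≋ A ⊎ B ≋ A °
same-type {A} {B} (inj₁ A≈)  (inj₁ B≈)  = inj₁ (trans (compress≡ B≈) (sym (compress≡ A≈)))
same-type {A} {B} (inj₁ A≈)  (inj₂ B°≈) =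
  inj₂ (trans (sym (°-involutive B)) (°-cong {B °} {A} (trans (compress≡ B°≈) (sym (compress≡ A≈)))))
same-type {A} {B} (inj₂ A°≈) (inj₁ B≈)  = inj₂ (trans (compress≡ B≈) (sym (compress≡ A°≈)))
same-type {A} {B} (inj₂ A°≈) (inj₂ B°≈) = inj₁ (trans (sym (°-involutive B))
  (trans (°-cong {B °} {A °} (trans (compress≡ B°≈) (sym (compress≡ A°≈)))) (°-involutive A)))

Exceptional⇒UpToRotation : ∀ {a b A B} → Exceptional a b → Classified A a → Classified B b → UpToRotation (ExceptionalPair (size A)) A B
Exceptional⇒UpToRotation         exc (inj₁ A≈)  (inj₁ B≈)  = inj₁ (Exceptional⇒pair exc (A≈ , B≈))
Exceptional⇒UpToRotation {A = A} {B} exc (inj₂ A°≈) (inj₁ B≈)  =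
  inj₂ (inj₁ (subst (λ n → ExceptionalPair n (A °) B) (size-° A) (Exceptional⇒pair exc (A°≈ , B≈))))
Exceptional⇒UpToRotation         exc (inj₁ A≈)  (inj₂ B°≈) = inj₂ (inj₂ (inj₁ (Exceptional⇒pair exc (A≈ , B°≈))))
Exceptional⇒UpToRotation {A = A} {B} exc (inj₂ A°≈) (inj₂ B°≈) =
  inj₂ (inj₂ (inj₂ (subst (λ n → ExceptionalPair n (A °) (B °)) (size-° A) (Exceptional⇒pair exc (A°≈ , B°≈)))))

UpToRotation⇒Exceptional : ∀ {n A B} → UpToRotation (ExceptionalPair n) A B → ∃₂ λ a b → Exceptional a b × Classified A a × Classified B b
UpToRotation⇒Exceptional (inj₁ pair) =
  let a , b , exc , A≈ , B≈ = pair⇒Exceptional pair in a , b , exc , inj₁ A≈ , inj₁ B≈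
UpToRotation⇒Exceptional (inj₂ (inj₁ pair)) =
  let a , b , exc , A≈ , B≈ = pair⇒Exceptional pair in a , b , exc , inj₂ A≈ , inj₁ B≈
UpToRotation⇒Exceptional (inj₂ (inj₂ (inj₁ pair))) =
  let a , b , exc , A≈ , B≈ = pair⇒Exceptional pair in a , b , exc , inj₁ A≈ , inj₂ B≈
UpToRotation⇒Exceptional (inj₂ (inj₂ (inj₂ pair))) =
  let a , b , exc , A≈ , B≈ = pair⇒Exceptional pair in a , b , exc , inj₂ A≈ , inj₂ B≈

_Covers_ : SkewShape → SkewShape → Set
A Covers B = ∀ β → Realises B β → Realises A β

Covers⇒⊑ : ∀ {A B a b} → Classified A a → Classified B b → A Covers B → b ⊑ a
Covers⇒⊑ {A} {B} {a} {b} cA cB B⊆A = contained λ {β} f →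
  Equivalence.to (Classified⇒Has⇔Form A a cA) (Realises⇒Has A (B⊆A β (Has⇒Realises B (Equivalence.from (Classified⇒Has⇔Form B b cB) f))))

⊑⇒Covers : ∀ {A B a b} → Classified A a → Classified B b → b ⊑ a → A Covers B
⊑⇒Covers {A} {B} {a} {b} cA cB b⊑a β r =
  Has⇒Realises A (Equivalence.from (Classified⇒Has⇔Form A a cA) (embed b⊑a (Equivalence.to (Classified⇒Has⇔Form B b cB) (Realises⇒Has B r))))

≋⇒Covers : ∀ {A B} → B ≋ A → A Covers B
≋⇒Covers {A} {B} B≋A β r = Has⇒Realises A (Has-≡compress {boxes B} {boxes A} B≋A (Realises⇒Has B r))

-- The first alternative accounts for shapes without boxes, which have no type; at equal sizes two
-- of them coincide.
BothClassified : SkewShape → SkewShape → Set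
BothClassified A B = B ≋ A ⊎ ∃₂ λ a b → Classified A a × Classified B b

Distinguished⇒BothClassified : ∀ A B → size B ≡ size A → Distinguished (lookup (boxes A)) → Distinguished (lookup (boxes B)) →
                               BothClassified A B
Distinguished⇒BothClassified A B B≡A distA distB = combine (Distinguished⇒Classified A distA) (Distinguished⇒Classified B distB)
  where
  combine : rows⁺ A ≡ [] ⊎ ∃[ a ] Classified A a → rows⁺ B ≡ [] ⊎ ∃[ b ] Classified B b → BothClassified A B
  combine (inj₁ none)     _               = inj₁ (empty⇒≋ {A} {B} (sym B≡A) none)
  combine (inj₂ _)        (inj₁ none)     = inj₁ (sym (empty⇒≋ {B} {A} B≡A none))
  combine (inj₂ (a , cA)) (inj₂ (b , cB)) = inj₂ (a , b , cA , cB)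

equal-types⇒≋ : ∀ A B {a b} → a ≡ b → Classified A a → Classified B b → B ≋ A ⊎ B ≋ A °
equal-types⇒≋ A B refl cA cB = same-type {A} {B} cA cB

mutual-Covers⇒≋ : ∀ A B → BothClassified A B → A Covers B → B Covers A → B ≋ A ⊎ B ≋ A °
mutual-Covers⇒≋ A B (inj₁ B≋A)               _   _   = inj₁ B≋A
mutual-Covers⇒≋ A B (inj₂ (a , b , cA , cB)) B⊆A A⊆B =
  equal-types⇒≋ A B (⊑-antisym a b (Covers⇒⊑ {A} {B} cA cB B⊆A) (Covers⇒⊑ {B} {A} cB cA A⊆B)) cA cB

-- For the rotated case the types are used: A and `A °` have the same one, hence the same descent
-- vectors.
≋⇒mutual-Covers : ∀ A B → BothClassified A B → B ≋ A ⊎ B ≋ A ° → A Covers B × B Covers A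
≋⇒mutual-Covers A B _                       (inj₁ B≋A)  = ≋⇒Covers {A} {B} B≋A , ≋⇒Covers {B} {A} (sym B≋A)
≋⇒mutual-Covers A B (inj₁ B≋A)              (inj₂ _)    = ≋⇒Covers {A} {B} B≋A , ≋⇒Covers {B} {A} (sym B≋A)
≋⇒mutual-Covers A B (inj₂ (_ , _ , cA , _)) (inj₂ B≋A°) =
  (λ β r → ⊑⇒Covers {A} {A °} cA (Classified-° {A} cA) (contained id) β (≋⇒Covers {A °} {B} B≋A° β r)) ,
  (λ β r → ≋⇒Covers {B} {A °} (sym B≋A°) β (⊑⇒Covers {A °} {A} (Classified-° {A} cA) cA (contained id) β r))

Covers⇒exceptional : ∀ A B → BothClassified A B → ¬ (B ≋ A ⊎ B ≋ A °) → A Covers B → UpToRotation (ExceptionalPair (size A)) A B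
Covers⇒exceptional A B (inj₁ B≋A)               B≉A _   = contradiction (inj₁ B≋A) B≉A
Covers⇒exceptional A B (inj₂ (a , b , cA , cB)) B≉A B⊆A = exceptional (compare-types a b (Covers⇒⊑ {A} {B} cA cB B⊆A))
  where
  exceptional : a ≡ b ⊎ Exceptional a b → UpToRotation (ExceptionalPair (size A)) A B
  exceptional (inj₁ a≡b) = contradiction (equal-types⇒≋ A B a≡b cA cB) B≉A
  exceptional (inj₂ exc) = Exceptional⇒UpToRotation exc cA cB

exceptional⇒Covers : ∀ A B → UpToRotation (ExceptionalPair (size A)) A B → A Covers B
exceptional⇒Covers A B exceptional = covers (UpToRotation⇒Exceptional {size A} {A} {B} exceptional)
  where
  covers : (∃₂ λ a b → Exceptional a b × Classified A a × Classified B b) → A Covers B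
  covers (_ , _ , exc , cA , cB) = ⊑⇒Covers {A} {B} cA cB (Exceptional⇒⊑ exc)

-- From inclusions of descent vectors to Schur functions and supports

module _ {A B : SkewShape} (B≡A : size B ≡ size A)
         (A-free : FMultiplicityFree A) (B-free : FMultiplicityFree B) where

  private
    𝒜 = tableaux A (size A) refl
    ℬ = tableaux B (size A) B≡A

    B-free′ : Family.Free ℬ
    B-free′ = subst (λ n → ∃[ c ] FExpansion n (s B) c × (∀ α → α ⊨ n → c α ≡ 0ℤ ⊎ c α ≡ 1ℤ)) B≡A B-free

  Covers⇔Contained : A Covers B ⇔ Contained 𝒜 ℬ
  Covers⇔Contained = mk⇔
    (λ B⊆A β o → Realises⇒Occurs A (size A) refl β (B⊆A β (Occurs⇒Realises B (size A) B≡A β o)))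
    (λ B⊆A β r → Occurs⇒Realises A (size A) refl β (B⊆A β (Realises⇒Occurs B (size A) B≡A β r)))

  Covers⇔Contained′ : B Covers A ⇔ Contained ℬ 𝒜
  Covers⇔Contained′ = mk⇔
    (λ A⊆B β o → Realises⇒Occurs B (size A) B≡A β (A⊆B β (Occurs⇒Realises A (size A) refl β o)))
    (λ A⊆B β r → Occurs⇒Realises B (size A) B≡A β (A⊆B β (Realises⇒Occurs A (size A) refl β r)))

  A-distinguished : Distinguished (lookup (boxes A))
  A-distinguished T T′ tab tab′ eq = Family.Free⇒injective 𝒜 A-free (IsSYT⇒∈ A {T} tab) (IsSYT⇒∈ A {T′} tab′) eq

  B-distinguished : Distinguished (lookup (boxes B))
  B-distinguished T T′ tab tab′ eq = Family.Free⇒injective ℬ B-free′ (IsSYT⇒∈ B {T} tab) (IsSYT⇒∈ B {T′} tab′) eq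

  classified : BothClassified A B
  classified = Distinguished⇒BothClassified A B B≡A A-distinguished B-distinguished

  FPositive⇔Covers : FPositive (size A) (s A ⊖ s B) ⇔ A Covers B
  FPositive⇔Covers = mk⇔
    (λ pos → Equivalence.from Covers⇔Contained (Equivalence.to (FPositive⇔ 𝒜 ℬ B-free′) pos))
    (λ B⊆A → Equivalence.from (FPositive⇔ 𝒜 ℬ B-free′) (Equivalence.to Covers⇔Contained B⊆A))

  s≐⇔ : s A ≐ s B ⇔ (B ≋ A ⊎ B ≋ A °)
  s≐⇔ = mk⇔
    (λ sA≐sB → mutual-Covers⇒≋ A B classified
      (Equivalence.from Covers⇔Contained (series-determines 𝒜 ℬ sA≐sB))
      (Equivalence.from Covers⇔Contained′ (series-determines ℬ 𝒜 (λ e → sym (sA≐sB e)))))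
    (λ B≋A → let B⊆A , A⊆B = ≋⇒mutual-Covers A B classified B≋A in
      Contained⇒≐ 𝒜 ℬ A-free B-free′ (Equivalence.to Covers⇔Contained B⊆A) (Equivalence.to Covers⇔Contained′ A⊆B))

  suppF⇔Covers : suppF A ⊇ suppF B ⇔ A Covers B
  suppF⇔Covers = mk⇔
    (λ B⊆A → Equivalence.from Covers⇔Contained (Equivalence.to (Support-⊇⇔ 𝒜 ℬ) (λ {α} supp → B⊆A {α} (from-support {α} supp))))
    (λ B⊆A {α} supp → Equivalence.from (Support-⊇⇔ 𝒜 ℬ) (Equivalence.to Covers⇔Contained B⊆A) {α} (to-support {α} supp))
    where
    from-support : ∀ {α} → Family.Support ℬ α → suppF B α
    from-support {α} = subst (λ n → α ⊨ n × ∃[ c ] FExpansion n (s B) c × 0ℤ ℤ.< c α) (sym B≡A)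
    to-support : ∀ {α} → suppF B α → Family.Support ℬ α
    to-support {α} = subst (λ n → α ⊨ n × ∃[ c ] FExpansion n (s B) c × 0ℤ ℤ.< c α) B≡A

theorem6p2 : (n : ℕ) (A B : SkewShape) → size A ≡ n → size B ≡ n →
    FMultiplicityFree A → FMultiplicityFree B →
    (s A ≐ s B ⇔ (B ≋ A ⊎ B ≋ A °)) ×
    (¬ (B ≋ A ⊎ B ≋ A °) →
      (FPositive n (s A ⊖ s B) ⇔ suppF A ⊇ suppF B) ×
      (FPositive n (s A ⊖ s B) ⇔ UpToRotation (ExceptionalPair n) A B))
theorem6p2 .(size A) A B refl B≡A A-free B-free =
  s≐⇔ {A} {B} B≡A A-free B-free , λ B≉A →
    mk⇔ (λ pos {α} → Equivalence.from (suppF⇔Covers {A} {B} B≡A A-free B-free) (Equivalence.to (FPositive⇔Covers {A} {B} B≡A A-free B-free) pos) {α})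
        (λ B⊆A → Equivalence.from (FPositive⇔Covers {A} {B} B≡A A-free B-free) (Equivalence.to (suppF⇔Covers {A} {B} B≡A A-free B-free) (λ {α} → B⊆A {α}))) ,
    mk⇔ (λ pos → Covers⇒exceptional A B (classified {A} {B} B≡A A-free B-free) B≉A (Equivalence.to (FPositive⇔Covers {A} {B} B≡A A-free B-free) pos))
        (λ exc → Equivalence.from (FPositive⇔Covers {A} {B} B≡A A-free B-free) (exceptional⇒Covers A B exc))
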